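{- Fix $0<\varepsilon<1/2$. There exists an $O(n^4)$-time TSP-domination algorithm which has domination ratio at least $1-6n^{ -2\varepsilon}$ for every $(n,d,\varepsilon)$-sparse instance of TSP with $n\ge225$.
   Context: $K_n=(V_n,E_n)$ is the complete graph on $n$ vertices, $\mathcal H_n$ its set of (undirected) Hamilton cycles; $w(G)=\sum_{e\in E(G)}w(e)$; a $\{0,1\}$-instance has $w:E_n\to\{0,1\}$. A TSP-domination algorithm, given $(n,w)$, outputs a Hamilton cycle $H^*$; it has domination ratio at least $\rho$ for $(n,w)$ if $\mathbb{P}(w(H)<w(H^*))\le1-\rho$ for $H$ uniform in $\mathcal H_n$. For $0<\varepsilon<1/2$, a $\{0,1\}$-instance $(n,w)$ is $(n,d,\varepsilon)$-sparse if $w(K_n)=d\binom n2$ with $d\le\frac14n^{ -1/2-\varepsilon}$. -}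

module Defs where

open import Algebra.Bundles using (CommutativeRing)
import Algebra.Definitions.RawSemiring
import Algebra.Properties.Group
import Algebra.Properties.Semiring.Exp
open import Data.Empty using (⊥-elim)
open import Data.Fin as Fin using (Fin; toℕ; fromℕ<; remQuot)
import Data.Fin.Properties as Fin
open import Data.Integer as ℤ using (ℤ; +_; -[1+_])
import Data.Integer.Properties as ℤ
open import Data.List using (List; []; _∷_; _∷ʳ_; allFin; cartesianProduct; cartesianProductWith; deduplicate; filter; length; map; mapMaybe; zip)
import Data.List.Properties as List
import Data.List.Membership.DecPropositional as DecMembership
open import Data.Maybe using (Maybe; just; nothing)
open import Data.Nat as ℕ using (ℕ; zero; suc; NonZero; _∸_)
open import Data.Nat.ListAction using (sum)
open import Data.Nat.Combinatorics using (_C_)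
import Data.Nat.Properties as ℕ
open import Data.Product using (∃; ∃₂; _×_; _,_)
import Data.Product.Properties as Product
open import Data.Rational as ℚ using (ℚ; 0ℚ; 1ℚ; ½; mkℚ; ↥_; ↧ₙ_; Positive)
open import Data.Rational.Literals using (fromℤ)
import Data.Rational.Properties as ℚ
open import Data.Sum using (_⊎_; inj₁; inj₂)
open import Data.Vec using (Vec; []; _∷_; lookup; toList)
open import Data.Vec.Relation.Unary.AllPairs using (allPairs?)
open import Data.Vec.Relation.Unary.Unique.Propositional using (Unique)
open import Relation.Binary.Definitions using (DecidableEquality; tri<; tri≈; tri>)
open import Relation.Binary.PropositionalEquality using (_≡_; refl; sym; subst)
open import Relation.Nullary using (¬_; yes; no)
open import Relation.Nullary.Decidable using (¬?; map′; _×-dec_; _⊎-dec_)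
open import Relation.Unary using (Decidable)

------------------------------------------------------------------------
-- Real numbers

private
  module Exp = Algebra.Properties.Semiring.Exp (CommutativeRing.semiring ℚ.+-*-commutativeRing)

open Algebra.Definitions.RawSemiring ℚ.+-*-rawSemiring public using () renaming (_^_ to _^ℚ_)

-- One-sided Dedekind cuts (as in Rudin): nonempty, proper, downward
-- closed sets of rationals without a greatest element; `cut q` says
-- that q is strictly less than the real number.

record ℝ : Set₁ where
  field
    cut       : ℚ → Set
    inhabited : ∃ λ q → cut q
    proper    : ∃ λ q → ¬ cut q
    closed    : ∀ {p q} → p ℚ.< q → cut q → cut p
    rounded   : ∀ {p} → cut p → ∃ λ q → p ℚ.< q × cut q

open ℝ public

infix 4 _≤ʳ_ _<ʳ_

_≤ʳ_ : ℝ → ℝ → Set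
x ≤ʳ y = ∀ q → cut x q → cut y q

_<ʳ_ : ℝ → ℝ → Set
x <ʳ y = ∃ λ q → ¬ cut x q × cut y q

p-1<p : ∀ p → p ℚ.- 1ℚ ℚ.< p
p-1<p p = subst (p ℚ.- 1ℚ ℚ.<_) (ℚ.+-identityʳ p) (ℚ.+-monoʳ-< p (ℚ.*<* ℤ.-<+))

neg-involutive : ∀ p → ℚ.- (ℚ.- p) ≡ p
neg-involutive = Algebra.Properties.Group.⁻¹-involutive ℚ.+-0-group

cut⇒< : ∀ x {q u} → cut x q → ¬ cut x u → q ℚ.< u
cut⇒< x {q} {u} xq ¬xu with ℚ.<-cmp q u
... | tri< q<u _ _ = q<u
... | tri≈ _ refl _ = ⊥-elim (¬xu xq)
... | tri> _ _ u<q = ⊥-elim (¬xu (closed x u<q xq))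

fromℚ : ℚ → ℝ
fromℚ r = record
  { cut       = ℚ._< r
  ; inhabited = r ℚ.- 1ℚ , p-1<p r
  ; proper    = r , ℚ.<-irrefl refl
  ; closed    = ℚ.<-trans
  ; rounded   = ℚ.<-dense
  }

infixl 6 _+ʳ_ _-ʳ_
infixl 7 _·ʳ_
infix  8 -ʳ_

_+ʳ_ : ℝ → ℝ → ℝ
x +ʳ y = record
  { cut       = λ p → ∃₂ λ r s → cut x r × cut y s × p ℚ.< r ℚ.+ s
  ; inhabited = let (r , xr) = inhabited x
                    (s , ys) = inhabited y
                in _ , r , s , xr , ys , p-1<p (r ℚ.+ s)
  ; proper    = let (u , ¬xu) = proper x
                    (v , ¬yv) = proper y
                in u ℚ.+ v , λ (r , s , xr , ys , u+v<r+s) →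
                     ℚ.<-asym u+v<r+s (ℚ.+-mono-< (cut⇒< x xr ¬xu) (cut⇒< y ys ¬yv))
  ; closed    = λ p<q (r , s , xr , ys , q<r+s) → r , s , xr , ys , ℚ.<-trans p<q q<r+s
  ; rounded   = λ (r , s , xr , ys , p<r+s) →
                  let (q , p<q , q<r+s) = ℚ.<-dense p<r+s
                  in q , p<q , r , s , xr , ys , q<r+s
  }

-ʳ_ : ℝ → ℝ
-ʳ x = record
  { cut       = λ p → ∃ λ r → p ℚ.< r × ¬ cut x (ℚ.- r)
  ; inhabited = let (u , ¬xu) = proper x
                in _ , ℚ.- u , p-1<p (ℚ.- u) , λ h → ¬xu (subst (cut x) (neg-involutive u) h)
  ; proper    = let (q , xq) = inhabited x
                in ℚ.- q , λ (r , -q<r , ¬x-r) →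
                     ¬x-r (closed x (subst (ℚ.- r ℚ.<_) (neg-involutive q) (ℚ.neg-antimono-< -q<r)) xq)
  ; closed    = λ p<q (r , q<r , h) → r , ℚ.<-trans p<q q<r , h
  ; rounded   = λ (r , p<r , h) →
                  let (q , p<q , q<r) = ℚ.<-dense p<r
                  in q , p<q , r , q<r , h
  }

_-ʳ_ : ℝ → ℝ → ℝ
x -ʳ y = x +ʳ (-ʳ y)

_·ʳ_ : (c : ℚ) .{{_ : Positive c}} → ℝ → ℝ
c ·ʳ x = record
  { cut       = λ p → ∃ λ r → cut x r × p ℚ.< c ℚ.* r
  ; inhabited = let (r , xr) = inhabited x in _ , r , xr , p-1<p (c ℚ.* r)
  ; proper    = let (u , ¬xu) = proper x
                in c ℚ.* u , λ (r , xr , cu<cr) →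
                     ℚ.<-asym cu<cr (ℚ.*-monoʳ-<-pos c (cut⇒< x xr ¬xu))
  ; closed    = λ p<q (r , xr , q<cr) → r , xr , ℚ.<-trans p<q q<cr
  ; rounded   = λ (r , xr , p<cr) →
                  let (q , p<q , q<cr) = ℚ.<-dense p<cr
                  in q , p<q , r , xr , q<cr
  }

fromℕ : ℕ → ℚ
fromℕ n = fromℤ (+ n)

-- r ≤ n^q for rational r and q = a / b (b ≥ 1, n ≥ 1): either r ≤ 0, or
-- r^b ≤ n^a, written without negative exponents.

infix 4 _≤[_^_]

_≤[_^_] : ℚ → ℕ → ℚ → Set
r ≤[ n ^ q ] = r ℚ.≤ 0ℚ ⊎ powers (↥ q)
  where
  powers : ℤ → Set
  powers (+ a)    = r ^ℚ ↧ₙ q ℚ.≤ fromℕ n ^ℚ a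
  powers -[1+ a ] = r ^ℚ ↧ₙ q ℚ.* fromℕ n ^ℚ suc a ℚ.≤ 1ℚ

module _ {x : ℚ} where
  ^-≥1 : 1ℚ ℚ.≤ x → ∀ k → 1ℚ ℚ.≤ x ^ℚ k
  ^-≥1 1≤x zero = ℚ.≤-refl
  ^-≥1 1≤x (suc k) = begin
    1ℚ            ≤⟨ 1≤x ⟩
    x             ≡⟨ ℚ.*-identityʳ x ⟨
    x ℚ.* 1ℚ      ≤⟨ ℚ.*-monoˡ-≤-nonNeg x {{ℚ.nonNegative (ℚ.≤-trans (ℚ.*≤* (ℤ.+≤+ ℕ.z≤n)) 1≤x)}} (^-≥1 1≤x k) ⟩
    x ℚ.* x ^ℚ k  ∎
    where open ℚ.≤-Reasoning

  ^-mono : 1ℚ ℚ.≤ x → ∀ {j k} → j ℕ.≤ k → x ^ℚ j ℚ.≤ x ^ℚ k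
  ^-mono 1≤x {j} {k} ℕ.z≤n = ^-≥1 1≤x k
  ^-mono 1≤x (ℕ.s≤s j≤k) =
    ℚ.*-monoˡ-≤-nonNeg x {{ℚ.nonNegative (ℚ.≤-trans (ℚ.*≤* (ℤ.+≤+ ℕ.z≤n)) 1≤x)}} (^-mono 1≤x j≤k)

0≤1 : 0ℚ ℚ.≤ 1ℚ
0≤1 = ℚ.*≤* (ℤ.+≤+ ℕ.z≤n)

0<1 : 0ℚ ℚ.< 1ℚ
0<1 = ℚ.*<* (ℤ.+<+ (ℕ.s≤s ℕ.z≤n))

base-mono-< : ∀ {x y} → 1ℚ ℚ.≤ x → x ℚ.< y → ∀ k → x ^ℚ suc k ℚ.< y ^ℚ suc k
base-mono-< {x} {y} 1≤x x<y k = begin-strict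
  x ℚ.* x ^ℚ k  <⟨ ℚ.*-monoˡ-<-pos (x ^ℚ k) {{ℚ.positive (ℚ.<-≤-trans 0<1 (^-≥1 1≤x k))}} x<y ⟩
  y ℚ.* x ^ℚ k  ≤⟨ ℚ.*-monoˡ-≤-nonNeg y {{ℚ.nonNegative (ℚ.≤-trans 0≤1 1≤y)}} (base-mono-≤ k) ⟩
  y ℚ.* y ^ℚ k  ∎
  where
  open ℚ.≤-Reasoning
  1≤y : 1ℚ ℚ.≤ y
  1≤y = ℚ.≤-trans 1≤x (ℚ.<⇒≤ x<y)
  base-mono-≤ : ∀ k → x ^ℚ k ℚ.≤ y ^ℚ k
  base-mono-≤ zero = ℚ.≤-refl
  base-mono-≤ (suc k) = ℚ.<⇒≤ (base-mono-< 1≤x x<y k)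

1≤fromℕ : ∀ n → .{{NonZero n}} → 1ℚ ℚ.≤ fromℕ n
1≤fromℕ (suc n) = ℚ.*≤* (ℤ.+≤+ (ℕ.s≤s ℕ.z≤n))

≤fromℕ∣↥∣ : ∀ u → u ℚ.≤ fromℕ ℤ.∣ ↥ u ∣
≤fromℕ∣↥∣ (mkℚ (+ a) b-1 _) = ℚ.*≤* (ℤ.*-monoˡ-≤-nonNeg (+ a) {+ 1} {+ suc b-1} (ℤ.+≤+ (ℕ.s≤s ℕ.z≤n)))
≤fromℕ∣↥∣ (mkℚ -[1+ a ] b-1 _) = ℚ.*≤* ℤ.-≤+

≤^⇒≤ : ∀ n .{{_ : NonZero n}} {r q} N → q ℚ.< fromℕ N → r ≤[ n ^ q ] → r ℚ.≤ fromℕ n ^ℚ N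
≤^⇒≤ n N q<N (inj₁ r≤0) = ℚ.≤-trans r≤0 (ℚ.≤-trans 0≤1 (^-≥1 (1≤fromℕ n) N))
≤^⇒≤ n {r} {mkℚ (+ a) b-1 _} N (ℚ.*<* q<N) (inj₂ h) = ℚ.≮⇒≥ λ B<r →
  ℚ.<-irrefl refl (begin-strict
    B ^ℚ suc b-1           <⟨ base-mono-< (^-≥1 1≤n N) B<r b-1 ⟩
    r ^ℚ suc b-1           ≤⟨ h ⟩
    fromℕ n ^ℚ a           ≤⟨ ^-mono 1≤n a≤Nb ⟩
    fromℕ n ^ℚ (N ℕ.* suc b-1)  ≡⟨ Exp.^-assocʳ (fromℕ n) N (suc b-1) ⟨
    B ^ℚ suc b-1           ∎)
  where
  open ℚ.≤-Reasoning
  1≤n = 1≤fromℕ n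
  B = fromℕ n ^ℚ N
  a≤Nb : a ℕ.≤ N ℕ.* suc b-1
  a≤Nb = ℤ.drop‿+≤+ (subst (+ a ℤ.≤_) (sym (ℤ.pos-* N (suc b-1))) (subst (ℤ._≤ + N ℤ.* + suc b-1) (ℤ.*-identityʳ (+ a)) (ℤ.<⇒≤ q<N)))
≤^⇒≤ n {r} {mkℚ -[1+ a ] b-1 _} N _ (inj₂ h) = ℚ.≮⇒≥ λ B<r →
  ℚ.<-irrefl refl (begin-strict
    1ℚ                                  ≤⟨ ^-≥1 (^-≥1 1≤n N) (suc b-1) ⟩
    B ^ℚ suc b-1                        <⟨ base-mono-< (^-≥1 1≤n N) B<r b-1 ⟩
    r ^ℚ suc b-1                        ≡⟨ ℚ.*-identityʳ _ ⟨
    r ^ℚ suc b-1 ℚ.* 1ℚ                 ≤⟨ ℚ.*-monoˡ-≤-nonNeg (r ^ℚ suc b-1) {{ℚ.nonNegative (ℚ.≤-trans 0≤1 (^-≥1 (ℚ.≤-trans (^-≥1 1≤n N) (ℚ.<⇒≤ B<r)) (suc b-1)))}} (^-≥1 1≤n (suc a)) ⟩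
    r ^ℚ suc b-1 ℚ.* fromℕ n ^ℚ suc a   ≤⟨ h ⟩
    1ℚ                                  ∎)
  where
  open ℚ.≤-Reasoning
  1≤n = 1≤fromℕ n
  B = fromℕ n ^ℚ N

-- n ^ʳ x = sup { n^q | q rational, q < x }.

infixr 8 _^ʳ_

_^ʳ_ : (n : ℕ) .{{_ : NonZero n}} → ℝ → ℝ
n ^ʳ x = record
  { cut       = λ p → ∃₂ λ r q → p ℚ.< r × cut x q × r ≤[ n ^ q ]
  ; inhabited = let (q , xq) = inhabited x
                in _ , 0ℚ , q , p-1<p 0ℚ , xq , inj₁ ℚ.≤-refl
  ; proper    = let (u , ¬xu) = proper x
                    N = ℤ.∣ ↥ u ∣
                in fromℕ n ^ℚ N , λ (r , q , n^N<r , xq , r≤n^q) →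
                     ℚ.<-irrefl refl (ℚ.<-≤-trans n^N<r
                       (≤^⇒≤ n {r} {q} N (ℚ.<-≤-trans (cut⇒< x xq ¬xu) (≤fromℕ∣↥∣ u)) r≤n^q))
  ; closed    = λ p<p′ (r , q , p′<r , h) → r , q , ℚ.<-trans p<p′ p′<r , h
  ; rounded   = λ (r , q , p<r , h) →
                  let (p′ , p<p′ , p′<r) = ℚ.<-dense p<r
                  in p′ , p<p′ , r , q , p′<r , h
  }

------------------------------------------------------------------------
-- Complete graphs and Hamilton cycles

-- The vertices of Kₙ are Fin n; an edge is stored with its smaller
-- endpoint first.

record Edge (n : ℕ) : Set where
  constructor edge
  field
    lo hi   : Fin n
    .lo<hi  : lo Fin.< hi

open Edge public

_≟ᴱ_ : ∀ {n} → DecidableEquality (Edge n)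
edge i j _ ≟ᴱ edge k l _ =
  map′ (λ { (refl , refl) → refl }) (λ { refl → refl , refl }) (i Fin.≟ k ×-dec j Fin.≟ l)

edges : ∀ n → List (Edge n)
edges n = mapMaybe toEdge (cartesianProduct (allFin n) (allFin n))
  where
  toEdge : Fin n × Fin n → Maybe (Edge n)
  toEdge (i , j) with i Fin.<? j
  ... | yes i<j = just (edge i j i<j)
  ... | no  _   = nothing

-- A spanning subgraph of Kₙ, as the list of its edges in the order in
-- which they occur in `edges n`; on such lists _≡_ is equality of graphs.

Subgraph : ℕ → Set
Subgraph n = List (Edge n)

_≟ᴳ_ : ∀ {n} → DecidableEquality (Subgraph n)
_≟ᴳ_ = List.≡-dec _≟ᴱ_

-- The graph with edges v₀v₁, v₁v₂, …, vₙ₋₁v₀.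

cycleGraph : ∀ {n} → Vec (Fin n) n → Subgraph n
cycleGraph {n} σ = filter onCycle? (edges n)
  where
  rotate : List (Fin n) → List (Fin n)
  rotate []       = []
  rotate (v ∷ vs) = vs ∷ʳ v

  steps : List (Fin n × Fin n)
  steps = zip (toList σ) (rotate (toList σ))

  open DecMembership (Product.≡-dec Fin._≟_ Fin._≟_) using (_∈_; _∈?_)

  onCycle? : Decidable (λ e → (lo e , hi e) ∈ steps ⊎ (hi e , lo e) ∈ steps)
  onCycle? e = (lo e , hi e) ∈? steps ⊎-dec (hi e , lo e) ∈? steps

allVecs : ∀ {A : Set} → List A → ∀ k → List (Vec A k)
allVecs xs zero    = [] ∷ []
allVecs xs (suc k) = cartesianProductWith _∷_ xs (allVecs xs k)

vertexOrders : ∀ n → List (Vec (Fin n) n)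
vertexOrders n = filter (allPairs? (λ u v → ¬? (u Fin.≟ v))) (allVecs (allFin n) n)

-- The set ℋₙ (n ≥ 3), without repetition: the 2n vertex orders that
-- trace the same undirected cycle contribute one element.

hamiltonCycles : ∀ n → List (Subgraph n)
hamiltonCycles n = deduplicate _≟ᴳ_ (map cycleGraph (vertexOrders n))

-- Probability of P for the uniform distribution on a nonempty,
-- repetition-free list.

ℙ : ∀ {A : Set} {P : A → Set} → Decidable P → List A → ℚ
ℙ P? []          = 0ℚ
ℙ P? xs@(_ ∷ _)  = + length (filter P? xs) ℚ./ length xs

record ZeroOneInstance : Set where
  field
    size   : ℕ
    size≥3 : 3 ℕ.≤ size
    w      : Edge size → Fin 2

  weight : Subgraph size → ℕ
  weight G = sum (map (λ e → toℕ (w e)) G)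

  size^ : ℝ → ℝ
  size^ x = _^ʳ_ size {{ℕ.>-nonZero (ℕ.≤-trans (ℕ.s≤s ℕ.z≤n) size≥3)}} x

open ZeroOneInstance public

-- (n , d , ε)-sparseness; d is rational because w(Kₙ) = d·C(n,2)
-- determines it.

record Sparse (I : ZeroOneInstance) (d : ℚ) (ε : ℝ) : Set where
  field
    density : fromℕ (weight I (edges (size I))) ≡ d ℚ.* fromℕ (size I C 2)
    bound   : fromℚ d ≤ʳ (+ 1 ℚ./ 4) ·ʳ size^ I (fromℚ (ℚ.- ½) -ʳ ε)

------------------------------------------------------------------------
-- Word RAM with unit cost: structured programs acting on registers and
-- an indirectly addressed memory, all holding natural numbers below a
-- word bound W.

data Op : Set where
  add sub mul : Op

⟦_⟧ : Op → ℕ → ℕ → ℕ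
⟦ add ⟧ = ℕ._+_
⟦ sub ⟧ = _∸_
⟦ mul ⟧ = ℕ._*_

Reg : Set
Reg = ℕ

data Program : Set where
  const : Reg → ℕ → Program               -- x := k
  arith : Op → Reg → Reg → Reg → Program  -- x := y op z
  load  : Reg → Reg → Program             -- x := M[y]
  store : Reg → Reg → Program             -- M[x] := y
  _⨾_   : Program → Program → Program
  ifnz  : Reg → Program → Program → Program
  while : Reg → Program → Program         -- repeat while x ≠ 0

record State : Set where
  constructor state
  field
    reg mem : ℕ → ℕ

open State public

_[_≔_] : (ℕ → ℕ) → ℕ → ℕ → ℕ → ℕ
(f [ x ≔ v ]) y with x ℕ.≟ y
... | yes _ = v
... | no  _ = f y

setReg setMem : State → ℕ → ℕ → State
setReg s x v = record s { reg = reg s [ x ≔ v ] }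
setMem s x v = record s { mem = mem s [ x ≔ v ] }

-- W ⊢ c , s ⇓[ t ] s′ : from state s, program c halts in state s′ after
-- t steps (elementary instructions and tests), and every value
-- written is below W.

infix 3 _⊢_,_⇓[_]_

data _⊢_,_⇓[_]_ (W : ℕ) : Program → State → ℕ → State → Set where
  const : ∀ {s x k} → k ℕ.< W →
          W ⊢ const x k , s ⇓[ 1 ] setReg s x k
  arith : ∀ {s o x y z} → ⟦ o ⟧ (reg s y) (reg s z) ℕ.< W →
          W ⊢ arith o x y z , s ⇓[ 1 ] setReg s x (⟦ o ⟧ (reg s y) (reg s z))
  load  : ∀ {s x y} → mem s (reg s y) ℕ.< W →
          W ⊢ load x y , s ⇓[ 1 ] setReg s x (mem s (reg s y))
  store : ∀ {s x y} → reg s y ℕ.< W →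
          W ⊢ store x y , s ⇓[ 1 ] setMem s (reg s x) (reg s y)
  _⨾_   : ∀ {s s′ s″ c d t u} →
          W ⊢ c , s ⇓[ t ] s′ → W ⊢ d , s′ ⇓[ u ] s″ →
          W ⊢ c ⨾ d , s ⇓[ t ℕ.+ u ] s″
  ifnz-true   : ∀ {s s′ x c d t} → ¬ reg s x ≡ 0 →
                W ⊢ c , s ⇓[ t ] s′ → W ⊢ ifnz x c d , s ⇓[ suc t ] s′
  ifnz-false  : ∀ {s s′ x c d t} → reg s x ≡ 0 →
                W ⊢ d , s ⇓[ t ] s′ → W ⊢ ifnz x c d , s ⇓[ suc t ] s′
  while-true  : ∀ {s s′ s″ x c t u} → ¬ reg s x ≡ 0 →
                W ⊢ c , s ⇓[ t ] s′ → W ⊢ while x c , s′ ⇓[ u ] s″ →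
                W ⊢ while x c , s ⇓[ suc (t ℕ.+ u) ] s″
  while-false : ∀ {s x c} → reg s x ≡ 0 →
                W ⊢ while x c , s ⇓[ 1 ] s

-- Input: n in register 0 and the weight matrix, row by row with zero
-- diagonal, in memory cells 0, …, n² - 1; everything else is 0.

weightMatrix : (I : ZeroOneInstance) → Fin (size I) → Fin (size I) → ℕ
weightMatrix I i j with Fin.<-cmp i j
... | tri< i<j _ _ = toℕ (w I (edge i j i<j))
... | tri≈ _ _ _   = 0
... | tri> _ _ j<i = toℕ (w I (edge j i j<i))

input : ZeroOneInstance → State
input I = state ((λ _ → 0) [ 0 ≔ n ]) memory
  where
  n = size I

  memory : ℕ → ℕ
  memory a with a ℕ.<? n ℕ.* n
  ... | yes a<n² = let (i , j) = remQuot {n} n (fromℕ< a<n²) in weightMatrix I i j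
  ... | no  _    = 0

-- Words of k·log₂ n bits. Output: the vertices of the Hamilton cycle in
-- cyclic order in memory cells 0, …, n - 1.

record Execution (c : Program) (k : ℕ) (I : ZeroOneInstance) : Set where
  field
    time       : ℕ
    final      : State
    run        : size I ℕ.^ k ⊢ c , input I ⇓[ time ] final
    order      : Vec (Fin (size I)) (size I)
    distinct   : Unique order
    output     : ∀ i → mem final (toℕ i) ≡ toℕ (lookup order i)

open Execution public

record DominationAlgorithm : Set where
  field
    program      : Program
    wordExponent : ℕ
    execute      : ∀ I → Execution program wordExponent I

  H* : ∀ I → Subgraph (size I)
  H* I = cycleGraph (order (execute I))

open DominationAlgorithm public

RunsInTimeO : DominationAlgorithm → (ℕ → ℕ) → Set
RunsInTimeO A f = ∃ λ K → ∀ I → time (execute A I) ℕ.≤ K ℕ.* f (size I)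

DominationRatioAtLeast : DominationAlgorithm → ZeroOneInstance → ℝ → Set
DominationRatioAtLeast A I ρ =
  fromℚ (ℙ (λ H → weight I H ℕ.<? weight I (H* A I)) (hamiltonCycles (size I))) ≤ʳ fromℚ 1ℚ -ʳ ρ

{-# OPTIONS --safe #-}
module Submission where

-- The algorithm is 2-opt local search for the modified edge costs
-- c(u, v) = w(u, v) (deg u + deg v), where deg counts the edges of weight 1.
-- A tour costs at most 2n², and a scan of all exchanges takes O(n²) steps.
--
-- Call a vertex heavy if its degree is at least n/3, and hard if at most
-- ℓ = #heavy edges at it have weight 0. In a locally optimal tour every edge uv of
-- weight 1 has a hard end: if u is heavy but not hard, then for some x with
-- w(u, x) = 0 the successor y of x is not heavy, and exchanging uv, xy for ux, vy
-- lowers the cost; if neither end is heavy, some exchange uses only edges of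
-- weight 0. Hence w(H*) ≤ 2k, where k = #hard.
--
-- Conversely w(H) ≥ 2k unless H uses an edge of weight 0 at a hard vertex or
-- an edge between two hard vertices. Every edge lies in H with probability
-- 2/(n - 1), and k ≤ ℓ unless d ≥ 2/9 (when 96 d² n ≥ 1 and there is nothing to
-- prove), so this happens with probability at most 4ℓ²/(n - 1).
-- As nℓ ≤ 3 d n (n - 1), this is at most 36 d² n, whereas 16 d² n ≤ n^(-2ε).

-- Local search for w itself gets stuck on plateaux: exchanging uv, xy for ux, vy may only move a
-- weight 1 from uv to vy. Charging an edge of weight 1 the degrees of its ends makes this move
-- profitable whenever deg y < deg u, so in a local optimum weight stays only where heavy vertices
-- block nearly every alternative; the notion of a hard vertex measures this. The threshold n/3
-- serves two purposes: two vertices that are not heavy have together fewer than n - 1 edges of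
-- weight 1, which leaves a free exchange, and there are at most 3 d (n - 1) heavy vertices. The
-- probability is bounded by a first moment, the expected number of edges with which H can save
-- weight at hard vertices; this takes only the probability of a single edge, found by symmetry.
-- Weights are counted over ordered pairs, which doubles both sides of an estimate and avoids
-- division. Reals are one-sided cuts, so the bound on d is accessible only through rationals d′ <
-- d, and the final estimate is proved for these.

open import Algebra.Bundles using (CommutativeRing)
import Algebra.Properties.CommutativeSemiring.Exp
open import Data.Empty using (⊥-elim)
open import Data.Fin as Fin using (Fin; zero; suc; toℕ; #_; fromℕ<; remQuot)
import Data.Fin.Permutation as Perm
import Data.Fin.Properties as Fin
open import Data.Integer as ℤ using (ℤ; -[1+_]) renaming (+_ to pos)
import Data.Integer.Properties as ℤ
import Data.Integer.Tactic.RingSolver as ℤSolver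
open import Data.List as List using (List; []; _∷_; length; _++_; map; mapMaybe; filter; allFin; cartesianProduct; zip)
import Data.List.Membership.DecPropositional as DecMembership
open import Data.List.Membership.Propositional using (_∈_)
import Data.List.Membership.Propositional.Properties as ∈
open import Data.List.Membership.Propositional.Properties.WithK using (unique∧set⇒bag)
open import Data.List.NonEmpty as List⁺ using (List⁺; _∷_)
import Data.List.Properties as List
open import Data.List.Relation.Binary.BagAndSetEquality using (∼bag⇒↭)
import Data.List.Relation.Binary.Permutation.Propositional.Properties as ↭
open import Data.List.Relation.Unary.All as All using (_∷_)
open import Data.List.Relation.Unary.AllPairs using ([]; _∷_)
open import Data.List.Relation.Unary.Any using (here; there)
import Data.List.Relation.Unary.Unique.DecPropositional.Properties as DecUnique
import Data.List.Relation.Unary.Unique.Propositional as ListUnique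
open import Data.Maybe using (Maybe; just; nothing; maybe′)
open import Data.Nat
open import Data.Nat.Combinatorics using (_C_; nC1≡n; nCk+nC[k+1]≡[n+1]C[k+1])
open import Data.Nat.ListAction using () renaming (sum to listSum)
open import Data.Nat.ListAction.Properties using (sum-++; sum-↭)
open import Data.Nat.Properties
open import Data.Nat.Tactic.RingSolver using (solve-∀)
open import Data.Product using (Σ; ∃; ∃₂; _×_; _,_; proj₁; proj₂)
open import Data.Rational as ℚ using (ℚ; 0ℚ; 1ℚ; ½; mkℚ; ↥_; ↧_; ↧ₙ_; toℚᵘ; Positive)
import Data.Rational.Properties as ℚ
open import Data.Rational.Solver using (module +-*-Solver)
import Data.Rational.Unnormalised as ℚᵘ
import Data.Rational.Unnormalised.Properties as ℚᵘ
open import Data.Sum using (_⊎_; inj₁; inj₂; [_,_]′)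
open import Data.Unit using (⊤; tt)
open import Data.Vec as Vec using (Vec; []; _∷_; lookup; toList; tabulate; _[_]≔_)
import Data.Vec.Properties as Vec
open import Data.Vec.Relation.Unary.AllPairs using (allPairs?)
open import Data.Vec.Relation.Unary.Unique.Propositional using (Unique)
import Data.Vec.Relation.Unary.Unique.Propositional.Properties as Unique
open import Function using (_∘_; id)
open import Function.Bundles using (mk⇔)
open import Relation.Binary.Definitions using (tri<; tri≈; tri>)
open import Relation.Binary.PropositionalEquality
open import Relation.Nullary using (¬_; Dec; yes; no; recompute)
open import Relation.Nullary.Decidable using (¬?)
open import Relation.Unary using (Decidable)
open import Algebra.Properties.Semiring.Sum +-*-semiring using (∑-distrib-+; ∑-comm; sum-permute; *-distribˡ-sum) renaming (sum to ∑; sum-cong-≗ to ∑-cong)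
open import Defs

-- Program logic for the word RAM

-- Abstract, so that symbolic memory contents stay folded.
abstract

  _⟨_↦_⟩ : (ℕ → ℕ) → ℕ → ℕ → ℕ → ℕ
  f ⟨ x ↦ v ⟩ = f [ x ≔ v ]

  ⟨↦⟩-same : ∀ {f x v} → (f ⟨ x ↦ v ⟩) x ≡ v
  ⟨↦⟩-same {x = x} with x ≟ x
  ... | yes _  = refl
  ... | no x≢x = ⊥-elim (x≢x refl)

  ⟨↦⟩-other : ∀ {f x v y} → x ≢ y → (f ⟨ x ↦ v ⟩) y ≡ f y
  ⟨↦⟩-other {x = x} {y = y} x≢y with x ≟ y
  ... | yes x≡y = ⊥-elim (x≢y x≡y)
  ... | no _    = refl

  [≔]-⟨↦⟩ : ∀ {f g : ℕ → ℕ} → (∀ a → f a ≡ g a) → ∀ x v a → (f [ x ≔ v ]) a ≡ (g ⟨ x ↦ v ⟩) a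
  [≔]-⟨↦⟩ f≗g x v a with x ≟ a
  ... | yes _ = refl
  ... | no _  = f≗g a

Register : Set
Register = Fin 16

-- Machine states up to pointwise equality; with the registers in a vector,
-- reading and writing a fixed register computes definitionally.
record Config : Set where
  constructor _∣_
  field
    regs : Vec ℕ 16
    mem  : ℕ → ℕ

infix 4 _∣_

data Instruction : Set where
  const : Register → ℕ → Instruction
  arith : Op → Register → Register → Register → Instruction
  load  : Register → Register → Instruction
  store : Register → Register → Instruction

⌊_⌋ : Instruction → Program
⌊ const x k ⌋     = const (toℕ x) k
⌊ arith o x y z ⌋ = arith o (toℕ x) (toℕ y) (toℕ z)
⌊ load x y ⌋      = load (toℕ x) (toℕ y)
⌊ store x y ⌋     = store (toℕ x) (toℕ y)

step : Instruction → Config → Config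
step (const x k) (v ∣ m)     = v [ x ]≔ k ∣ m
step (arith o x y z) (v ∣ m) = v [ x ]≔ ⟦ o ⟧ (lookup v y) (lookup v z) ∣ m
step (load x y) (v ∣ m)      = v [ x ]≔ m (lookup v y) ∣ m
step (store x y) (v ∣ m)     = v ∣ m ⟨ lookup v x ↦ lookup v y ⟩

written : Instruction → Config → ℕ
written (const x k) _           = k
written (arith o x y z) (v ∣ m) = ⟦ o ⟧ (lookup v y) (lookup v z)
written (load x y) (v ∣ m)      = m (lookup v y)
written (store x y) (v ∣ m)     = lookup v y

steps : List Instruction → Config → Config
steps []       σ = σ
steps (c ∷ cs) σ = steps cs (step c σ)

sequence : Instruction → List Instruction → Program
sequence c []       = ⌊ c ⌋
sequence c (d ∷ ds) = ⌊ c ⌋ ⨾ sequence d ds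

block : List⁺ Instruction → Program
block (c ∷ cs) = sequence c cs

module Machine (W : ℕ) where

  Safe : List Instruction → Config → Set
  Safe []       _ = ⊤
  Safe (c ∷ cs) σ = written c σ < W × Safe cs (step c σ)

  -- Functions on registers and memory are compared pointwise, and registers from 16 on are left
  -- unconstrained, since no `Instruction` can name them.
  record _∼_ (σ : Config) (s : State) : Set where
    field
      same-regs : ∀ (r : Register) → State.reg s (toℕ r) ≡ lookup (Config.regs σ) r
      same-mem  : ∀ a → State.mem s a ≡ Config.mem σ a

  open _∼_

  -- The start ranges over all states that `σ` represents and `b` only bounds the step count, so
  -- runs compose without exact states or times. These are extracted once, for the whole program on
  -- its actual input.
  Runs : Program → Config → ℕ → Config → Set
  Runs c σ b σ′ = ∀ s → σ ∼ s → ∃₂ λ t s′ → W ⊢ c , s ⇓[ t ] s′ × t ≤ b × σ′ ∼ s′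

  private
    setReg-∼ : ∀ {v m s} (x : Register) k → (v ∣ m) ∼ s → (v [ x ]≔ k ∣ m) ∼ setReg s (toℕ x) k
    setReg-∼ {v} {m} {s} x k sim = record { same-regs = regs′ ; same-mem = same-mem sim }
      where
      regs′ : ∀ r → (State.reg s [ toℕ x ≔ k ]) (toℕ r) ≡ lookup (v [ x ]≔ k) r
      regs′ r with x Fin.≟ r
      ... | yes refl = trans ([≔]-⟨↦⟩ (λ _ → refl) (toℕ x) k (toℕ r)) (trans ⟨↦⟩-same (sym (Vec.lookup∘updateAt x v)))
      ... | no x≢r = trans ([≔]-⟨↦⟩ (λ _ → refl) (toℕ x) k (toℕ r))
                       (trans (⟨↦⟩-other (λ eq → x≢r (Fin.toℕ-injective eq)))
                         (trans (same-regs sim r) (sym (Vec.lookup∘updateAt′ r x (λ eq → x≢r (sym eq)) v))))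

    setMem-∼ : ∀ {v m s a b} k → a ≡ b → (v ∣ m) ∼ s → (v ∣ m ⟨ b ↦ k ⟩) ∼ setMem s a k
    setMem-∼ {a = b} k refl sim = record
      { same-regs = same-regs sim
      ; same-mem  = λ a → [≔]-⟨↦⟩ (same-mem sim) b k a
      }

  runs-instruction : ∀ c σ → written c σ < W → Runs ⌊ c ⌋ σ 1 (step c σ)
  runs-instruction (const x k) (v ∣ m) k<W s sim =
    1 , _ , const k<W , ≤-refl , setReg-∼ x k sim
  runs-instruction (arith o x y z) (v ∣ m) r<W s sim
    rewrite sym (same-regs sim y) | sym (same-regs sim z) =
    1 , _ , arith r<W , ≤-refl , setReg-∼ x _ sim
  runs-instruction (load x y) (v ∣ m) r<W s sim
    rewrite sym (same-regs sim y) | sym (same-mem sim (State.reg s (toℕ y))) =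
    1 , _ , load r<W , ≤-refl , setReg-∼ x _ sim
  runs-instruction (store x y) (v ∣ m) r<W s sim
    rewrite sym (same-regs sim y) =
    1 , _ , store r<W , ≤-refl , setMem-∼ _ (same-regs sim x) sim

  runs-⨾ : ∀ {c d σ σ′ σ″ b b′} → Runs c σ b σ′ → Runs d σ′ b′ σ″ → Runs (c ⨾ d) σ (b + b′) σ″
  runs-⨾ run₁ run₂ s sim =
    let (t , s′ , d₁ , t≤b , sim′) = run₁ s sim
        (u , s″ , d₂ , u≤b′ , sim″) = run₂ s′ sim′
    in t + u , s″ , (d₁ ⨾ d₂) , +-mono-≤ t≤b u≤b′ , sim″

  private
    runs-sequence : ∀ c cs σ → Safe (c ∷ cs) σ → Runs (sequence c cs) σ (length (c ∷ cs)) (steps (c ∷ cs) σ)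
    runs-sequence c []       σ (p , _)    = runs-instruction c σ p
    runs-sequence c (d ∷ ds) σ (p , safe) = runs-⨾ (runs-instruction c σ p) (runs-sequence d ds (step c σ) safe)

  runs-block : ∀ cs σ → Safe (List⁺.toList cs) σ →
               Runs (block cs) σ (List⁺.length cs) (steps (List⁺.toList cs) σ)
  runs-block (c ∷ cs) = runs-sequence c cs

  runs-ifnz-true : ∀ {x c d σ σ′ b} → lookup (Config.regs σ) x ≢ 0 →
                   Runs c σ b σ′ → Runs (ifnz (toℕ x) c d) σ (suc b) σ′
  runs-ifnz-true {x} nz run s sim =
    let (t , s′ , d , t≤b , sim′) = run s sim
    in suc t , s′ , ifnz-true (λ z → nz (trans (sym (same-regs sim x)) z)) d , s≤s t≤b , sim′

  runs-ifnz-false : ∀ {x c d σ σ′ b} → lookup (Config.regs σ) x ≡ 0 →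
                    Runs d σ b σ′ → Runs (ifnz (toℕ x) c d) σ (suc b) σ′
  runs-ifnz-false {x} z run s sim =
    let (t , s′ , d , t≤b , sim′) = run s sim
    in suc t , s′ , ifnz-false (trans (same-regs sim x) z) d , s≤s t≤b , sim′

  runs-≤ : ∀ {c σ σ′ b b′} → b ≤ b′ → Runs c σ b σ′ → Runs c σ b′ σ′
  runs-≤ b≤b′ run s sim =
    let (t , s′ , d , t≤b , sim′) = run s sim in t , s′ , d , ≤-trans t≤b b≤b′ , sim′

  -- `budget` bounds the remaining running time, so it doubles as the
  -- termination measure.
  module _ {A : Set} (conf : A → Config) (budget : A → ℕ) (x : Register) (c : Program)
           (iterate : ∀ a → lookup (Config.regs (conf a)) x ≢ 0 →
                      ∃₂ λ b a′ → Runs c (conf a) b (conf a′) × suc b + budget a′ ≤ budget a)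
    where

    private
      loop : ∀ fuel a → budget a ≤ fuel →
             ∃ λ a′ → Runs (while (toℕ x) c) (conf a) (suc (budget a)) (conf a′) ×
                      lookup (Config.regs (conf a′)) x ≡ 0
      loop fuel a _ with lookup (Config.regs (conf a)) x ≟ 0
      loop fuel a _ | yes z =
        a , (λ s sim → 1 , s , while-false (trans (same-regs sim x) z) , s≤s z≤n , sim) , z
      loop fuel a B≤ | no nz with iterate a nz
      loop zero a B≤ | no nz | b , a′ , run , dec = ⊥-elim (1+n≰n (≤-trans (≤-trans (s≤s z≤n) dec) B≤))
      loop (suc fuel) a B≤ | no nz | b , a′ , run , dec =
        let (a″ , run′ , z) = loop fuel a′ (s≤s⁻¹ (≤-trans (≤-trans (s≤s (m≤n+m (budget a′) b)) dec) B≤))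
        in a″ , (λ s sim →
             let (t , s′ , d , t≤b , sim′) = run s sim
                 (u , s″ , d′ , u≤ , sim″) = run′ s′ sim′
             in suc (t + u) , s″
                , while-true (λ e → nz (trans (sym (same-regs sim x)) e)) d d′
                , s≤s (≤-trans (+-mono-≤ t≤b u≤) (≤-trans (≤-reflexive (+-suc b (budget a′))) dec))
                , sim″) , z

    runs-while : ∀ a → ∃ λ a′ → Runs (while (toℕ x) c) (conf a) (suc (budget a)) (conf a′) ×
                                lookup (Config.regs (conf a′)) x ≡ 0
    runs-while a = loop (budget a) a ≤-refl

-- Degrees and the initial tour

sumFrom : (ℕ → ℕ) → ℕ → ℕ → ℕ
sumFrom f a zero    = 0
sumFrom f a (suc k) = sumFrom f a k + f (a + k)

sumFrom-≤ : ∀ f a k c → (∀ x → x < k → f (a + x) ≤ c) → sumFrom f a k ≤ k * c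
sumFrom-≤ f a zero    c _ = z≤n
sumFrom-≤ f a (suc k) c h = begin
  sumFrom f a k + f (a + k) ≤⟨ +-mono-≤ (sumFrom-≤ f a k c (λ x x<k → h x (m≤n⇒m≤1+n x<k))) (h k ≤-refl) ⟩
  k * c + c                 ≡⟨ +-comm (k * c) c ⟩
  suc k * c                 ∎
  where open ≤-Reasoning

sumFrom-cong : ∀ {f g} a k → (∀ x → x < k → f (a + x) ≡ g (a + x)) → sumFrom f a k ≡ sumFrom g a k
sumFrom-cong a zero    _ = refl
sumFrom-cong a (suc k) h = cong₂ _+_ (sumFrom-cong a k (λ x x<k → h x (m≤n⇒m≤1+n x<k))) (h k ≤-refl)

≢0⇒suc : ∀ {k} → k ≢ 0 → ∃ λ l → k ≡ suc l
≢0⇒suc {zero}  k≢0 = ⊥-elim (k≢0 refl)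
≢0⇒suc {suc l} _   = l , refl

-- Memory: the weight matrix in cells 0, …, n² - 1, the degrees from n², and
-- from `tour` the n + 1 positions of a closed walk, whose last equals its first.
-- Registers: 0 holds n, 1 holds n², 2 holds 1, 3 holds `tour`, 15 holds 0;
-- 4 and 5 are loop indices, 6 is the loop condition, the others are scratch.
module Layout (n : ℕ) where

  tour : ℕ
  tour = n * n + n

  -- All addresses and all values that get written are at most `tour + n`, the address of the last
  -- cell in use, so this single estimate discharges every word bound. It comes down to n² + 2n <
  -- 3n² ≤ n⁴.
  fits : 3 ≤ n → ∀ {x} → x ≤ tour + n → x < n ^ 4
  fits 3≤n {x} x≤ = begin-strict
    x                     ≤⟨ x≤ ⟩
    n * n + n + n         ≡⟨ eq₁ n ⟩
    n * n + 2 * n         ≤⟨ +-monoʳ-≤ (n * n) (*-monoˡ-≤ n (≤-trans (s≤s (s≤s z≤n)) 3≤n)) ⟩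
    n * n + n * n         <⟨ m<m+n (n * n + n * n) (*-mono-≤ 1≤n 1≤n) ⟩
    n * n + n * n + n * n ≡⟨ eq₂ n ⟩
    3 * (n * n)           ≤⟨ *-monoˡ-≤ (n * n) (≤-trans 3≤n (≤-trans (≤-reflexive (sym (*-identityʳ n))) (*-monoʳ-≤ n 1≤n))) ⟩
    n * n * (n * n)       ≡⟨ eq₃ n ⟩
    n ^ 4                 ∎
    where
    open ≤-Reasoning
    1≤n : 1 ≤ n
    1≤n = ≤-trans (s≤s z≤n) 3≤n
    eq₁ : ∀ n → n * n + n + n ≡ n * n + 2 * n
    eq₁ = solve-∀
    eq₂ : ∀ n → n * n + n * n + n * n ≡ 3 * (n * n)
    eq₂ = solve-∀
    eq₃ : ∀ n → n * n * (n * n) ≡ n * (n * (n * (n * 1)))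
    eq₃ = solve-∀

  entry< : ∀ {i j} → i < n → j < n → n * i + j < n * n
  entry< {i} {j} i<n j<n = begin-strict
    n * i + j <⟨ +-monoʳ-< (n * i) j<n ⟩
    n * i + n ≡⟨ +-comm (n * i) n ⟩
    n + n * i ≡⟨ *-suc n i ⟨
    n * suc i ≤⟨ *-monoʳ-≤ n i<n ⟩
    n * n     ∎
    where open ≤-Reasoning

addEntry startRow finishRow setup : List⁺ Instruction
addEntry =
  load (# 9) (# 5) ∷ arith add (# 8) (# 8) (# 9) ∷ arith add (# 5) (# 5) (# 2) ∷ arith sub (# 7) (# 7) (# 2) ∷ []
startRow =
  const (# 8) 0 ∷ arith add (# 7) (# 0) (# 15) ∷ []
finishRow =
  arith add (# 9) (# 1) (# 4) ∷ store (# 9) (# 8) ∷ arith add (# 9) (# 3) (# 4) ∷ store (# 9) (# 4) ∷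
  arith add (# 4) (# 4) (# 2) ∷ arith sub (# 6) (# 0) (# 4) ∷ []
setup =
  arith mul (# 1) (# 0) (# 0) ∷ const (# 2) 1 ∷ arith add (# 3) (# 1) (# 0) ∷ arith add (# 6) (# 0) (# 15) ∷ []

processRow initialise : Program
processRow = block startRow ⨾ (while 7 (block addEntry) ⨾ block finishRow)
initialise = block setup ⨾ while 6 processRow

module Initialise (n W : ℕ) (1≤n : 1 ≤ n) (ok : ∀ {x} → x ≤ Layout.tour n + n → x < W) (m₀ : ℕ → ℕ)
                  (m₀≤1 : ∀ a → a < n * n → m₀ a ≤ 1) (m₀≡0 : ∀ a → n * n ≤ a → m₀ a ≡ 0) where

  open Layout n
  open Machine W

  n≤ : n ≤ tour + n
  n≤ = m≤n+m n tour

  record Row (i : ℕ) (m : ℕ → ℕ) : Set where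
    field
      j p k acc t : ℕ
      j+k≡n : j + k ≡ n
      p≡    : p ≡ n * i + j
      acc≡  : acc ≡ sumFrom m (n * i) j

  module _ (i f : ℕ) (i<n : i < n) (m : ℕ → ℕ) (frame : ∀ a → a < n * n → m a ≡ m₀ a) where

    rowConf : Row i m → Config
    rowConf r = n ∷ n * n ∷ 1 ∷ tour ∷ i ∷ p ∷ f ∷ k ∷ acc ∷ t ∷ 0 ∷ 0 ∷ 0 ∷ 0 ∷ 0 ∷ 0 ∷ [] ∣ m
      where open Row r

    row-≤ : ∀ j → j ≤ n → sumFrom m (n * i) j ≤ j
    row-≤ j j≤n = ≤-trans
      (sumFrom-≤ m (n * i) j 1 (λ x x<j →
        let a< = entry< i<n (<-≤-trans x<j j≤n)
        in ≤-trans (≤-reflexive (frame _ a<)) (m₀≤1 _ a<)))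
      (≤-reflexive (*-identityʳ j))

    -- Four instructions and the loop test make the five steps charged per entry.
    rowStep : ∀ r → Row.k r ≢ 0 →
              ∃₂ λ b r′ → Runs (block addEntry) (rowConf r) b (rowConf r′) × suc b + Row.k r′ * 5 ≤ Row.k r * 5
    rowStep record { j = j ; p = p ; k = k ; acc = acc ; t = t ; j+k≡n = j+k≡n ; p≡ = p≡ ; acc≡ = acc≡ } k≢0
      with k | ≢0⇒suc k≢0
    ... | .(suc l) | l , refl =
      4 , record { j = suc j ; p = p + 1 ; k = l ; acc = acc + m p ; t = m p
                 ; j+k≡n = trans (sym (+-suc j l)) j+k≡n
                 ; p≡ = trans (+-comm p 1) (trans (cong suc p≡) (sym (+-suc (n * i) j)))
                 ; acc≡ = cong₂ _+_ acc≡ (cong m p≡) }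
      , runs-block addEntry _ (ok mp≤ , ok acc≤ , ok p≤ , ok l≤ , tt)
      , ≤-refl
      where
      j<n : j < n
      j<n = ≤-trans (m≤m+n (suc j) l) (≤-reflexive (trans (sym (+-suc j l)) j+k≡n))
      p<  : p < n * n
      p< = ≤-trans (s≤s (≤-reflexive p≡)) (entry< i<n j<n)
      mp≤1 : m p ≤ 1
      mp≤1 = ≤-trans (≤-reflexive (frame p p<)) (m₀≤1 p p<)
      mp≤ : m p ≤ tour + n
      mp≤ = ≤-trans mp≤1 (≤-trans 1≤n n≤)
      acc≤ : acc + m p ≤ tour + n
      acc≤ = ≤-trans (≤-reflexive (cong₂ _+_ acc≡ (cong m p≡))) (≤-trans (row-≤ (suc j) j<n) (≤-trans j<n n≤))
      p≤ : p + 1 ≤ tour + n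
      p≤ = ≤-trans (≤-reflexive (+-comm p 1)) (≤-trans p< (≤-trans (m≤m+n (n * n) n) (m≤m+n tour n)))
      l≤ : l ≤ tour + n
      l≤ = ≤-trans (m≤n+m l (suc j)) (≤-trans (≤-reflexive (trans (sym (+-suc j l)) j+k≡n)) n≤)

    runs-row : ∀ t → ∃ λ t′ → Runs (while 7 (block addEntry))
      (n ∷ n * n ∷ 1 ∷ tour ∷ i ∷ n * i ∷ f ∷ n ∷ 0 ∷ t ∷ 0 ∷ 0 ∷ 0 ∷ 0 ∷ 0 ∷ 0 ∷ [] ∣ m) (suc (n * 5))
      (n ∷ n * n ∷ 1 ∷ tour ∷ i ∷ n * suc i ∷ f ∷ 0 ∷ sumFrom m (n * i) n ∷ t′ ∷ 0 ∷ 0 ∷ 0 ∷ 0 ∷ 0 ∷ 0 ∷ [] ∣ m)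
    runs-row t with runs-while rowConf (λ r → Row.k r * 5) (# 7) (block addEntry) rowStep
                      (record { j = 0 ; p = n * i ; k = n ; acc = 0 ; t = t
                              ; j+k≡n = refl ; p≡ = sym (+-identityʳ (n * i)) ; acc≡ = refl })
    ... | record { j = j ; p = p ; k = k ; acc = acc ; t = t′ ; j+k≡n = j+k≡n ; p≡ = p≡ ; acc≡ = acc≡ } , run , refl
      with trans (sym (+-identityʳ j)) j+k≡n
    -- The read pointer is never reset: after n entries it stands at the first entry of the next
    -- row.
    ... | refl with trans p≡ (trans (+-comm (n * i) n) (sym (*-suc n i))) | acc≡
    ... | refl | refl = t′ , run

  -- Cell `tour + n` is never written. The 0 that it holds from the start is vertex 0 once more and
  -- closes the initial walk; `last` keeps track of this.
  record Init : Set where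
    field
      i f p t₇ t₈ t₉ : ℕ
      m      : ℕ → ℕ
      i+f≡n  : i + f ≡ n
      p≡     : p ≡ n * i
      frame  : ∀ a → a < n * n → m a ≡ m₀ a
      degree : ∀ a → a < i → m (n * n + a) ≡ sumFrom m₀ (n * a) n
      start  : ∀ a → a < i → m (tour + a) ≡ a
      last   : m (tour + n) ≡ 0

  initConf : Init → Config
  initConf r = n ∷ n * n ∷ 1 ∷ tour ∷ i ∷ p ∷ f ∷ t₇ ∷ t₈ ∷ t₉ ∷ 0 ∷ 0 ∷ 0 ∷ 0 ∷ 0 ∷ 0 ∷ [] ∣ m
    where open Init r

  initStep : ∀ r → Init.f r ≢ 0 →
             ∃₂ λ b r′ → Runs processRow (initConf r) b (initConf r′) ×
                         suc b + Init.f r′ * (n * 5 + 10) ≤ Init.f r * (n * 5 + 10)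
  initStep r f≢0 with ≢0⇒suc f≢0
  ... | l , f≡1+l =
    _ , record { i = i + 1 ; f = n ∸ (i + 1) ; p = n * suc i ; t₇ = 0 ; t₈ = sumFrom m (n * i) n ; t₉ = tour + i
               ; m = m′
               ; i+f≡n = m+[n∸m]≡n (≤-trans (≤-reflexive (+-comm i 1)) i<n)
               ; p≡ = cong (n *_) (+-comm 1 i)
               ; frame = λ a a< → trans (unchanged a (<-≤-trans a< (m≤m+n (n * n) i)) (<-≤-trans a< (≤-trans (m≤m+n (n * n) n) (m≤m+n tour i)))) (frame a a<)
               ; degree = degree′ ; start = start′ ; last = last′ }
    , runs-⨾ (runs-≡p (runs-block startRow _ (ok z≤n , ok (≤-trans (≤-reflexive (+-identityʳ n)) n≤) , tt)))
        (runs-⨾ inner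
          (runs-block finishRow _
            ( ok (≤-trans (+-monoʳ-≤ (n * n) (<⇒≤ i<n)) (m≤m+n tour n))
            , ok (≤-trans (row-≤ i f i<n m frame n ≤-refl) n≤)
            , ok (+-monoʳ-≤ tour (<⇒≤ i<n))
            , ok (≤-trans (<⇒≤ i<n) n≤)
            , ok (≤-trans (≤-trans (≤-reflexive (+-comm i 1)) i<n) n≤)
            , ok (≤-trans (m∸n≤m n (i + 1)) n≤) , tt)))
    , bound
    where
    open Init r
    i<n : i < n
    i<n = ≤-trans (m≤m+n (suc i) l) (≤-reflexive (trans (sym (+-suc i l)) (trans (cong (i +_) (sym f≡1+l)) i+f≡n)))
    inner = proj₂ (runs-row i f i<n m frame t₉)
    m′ : ℕ → ℕ
    m′ = (m ⟨ n * n + i ↦ sumFrom m (n * i) n ⟩) ⟨ tour + i ↦ i ⟩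
    unchanged : ∀ a → a < n * n + i → a < tour + i → m′ a ≡ m a
    unchanged a a< a<′ = trans (⟨↦⟩-other (λ e → <⇒≢ a<′ (sym e))) (⟨↦⟩-other (λ e → <⇒≢ a< (sym e)))
    row≡ : sumFrom m (n * i) n ≡ sumFrom m₀ (n * i) n
    row≡ = sumFrom-cong (n * i) n (λ x x<n → frame _ (entry< i<n x<n))
    deg-unchanged : ∀ a → a < n → m′ (n * n + a) ≡ (m ⟨ n * n + i ↦ sumFrom m (n * i) n ⟩) (n * n + a)
    deg-unchanged a a<n = ⟨↦⟩-other λ e → <⇒≢ (<-≤-trans (+-monoʳ-< (n * n) a<n) (m≤m+n tour i)) (sym e)
    tour-unchanged : ∀ a → i < a → m′ (tour + a) ≡ m (tour + a)
    tour-unchanged a i<a = trans (⟨↦⟩-other (λ e → <⇒≢ (+-monoʳ-< tour i<a) e))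
      (⟨↦⟩-other λ e → <⇒≢ (<-≤-trans (+-monoʳ-< (n * n) i<n) (m≤m+n tour a)) e)
    degree′ : ∀ a → a < i + 1 → m′ (n * n + a) ≡ sumFrom m₀ (n * a) n
    degree′ a a<i+1 with a ≟ i
    ... | yes refl = trans (deg-unchanged a i<n) (trans (⟨↦⟩-same) row≡)
    ... | no a≢i = trans (deg-unchanged a (<-trans a<i i<n))
                     (trans (⟨↦⟩-other (λ e → a≢i (sym (+-cancelˡ-≡ (n * n) _ _ e)))) (degree a a<i))
      where
      a<i : a < i
      a<i = ≤∧≢⇒< (s≤s⁻¹ (≤-trans a<i+1 (≤-reflexive (+-comm i 1)))) a≢i
    start′ : ∀ a → a < i + 1 → m′ (tour + a) ≡ a
    start′ a a<i+1 with a ≟ i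
    ... | yes refl = ⟨↦⟩-same
    ... | no a≢i = trans (⟨↦⟩-other (λ e → a≢i (sym (+-cancelˡ-≡ tour _ _ e))))
                     (trans (⟨↦⟩-other (λ e → <⇒≢ (<-≤-trans (+-monoʳ-< (n * n) i<n) (m≤m+n tour a)) e)) (start a a<i))
      where
      a<i : a < i
      a<i = ≤∧≢⇒< (s≤s⁻¹ (≤-trans a<i+1 (≤-reflexive (+-comm i 1)))) a≢i
    last′ : m′ (tour + n) ≡ 0
    last′ = trans (tour-unchanged n i<n) last
    -- Adding register 15, which holds 0, is how a register is copied. This leaves `n + 0` behind,
    -- and `p` must become `n * i` before the lemma on the inner loop applies.
    runs-≡p : ∀ {c b t₁₀} → Runs c (initConf r) b
        (n ∷ n * n ∷ 1 ∷ tour ∷ i ∷ p ∷ f ∷ n + 0 ∷ 0 ∷ t₉ ∷ t₁₀ ∷ 0 ∷ 0 ∷ 0 ∷ 0 ∷ 0 ∷ [] ∣ m) →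
      Runs c (initConf r) b
        (n ∷ n * n ∷ 1 ∷ tour ∷ i ∷ n * i ∷ f ∷ n ∷ 0 ∷ t₉ ∷ t₁₀ ∷ 0 ∷ 0 ∷ 0 ∷ 0 ∷ 0 ∷ [] ∣ m)
    runs-≡p {c} {b} {t₁₀} = subst₂ (λ p k → Runs c (initConf r) b
        (n ∷ n * n ∷ 1 ∷ tour ∷ i ∷ p ∷ f ∷ k ∷ 0 ∷ t₉ ∷ t₁₀ ∷ 0 ∷ 0 ∷ 0 ∷ 0 ∷ 0 ∷ [] ∣ m)) p≡ (+-identityʳ n)
    -- The loop test, the 2 + 6 instructions around the inner loop and its 5n + 1 steps add up to 5n
    -- + 10.
    bound : suc (2 + (suc (n * 5) + 6)) + (n ∸ (i + 1)) * (n * 5 + 10) ≤ f * (n * 5 + 10)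
    bound = ≤-reflexive (trans (cong₂ (λ x y → x + y * (n * 5 + 10)) (eq (n * 5)) n∸≡l) (cong (_* (n * 5 + 10)) (sym f≡1+l)))
      where
      eq : ∀ x → suc (2 + (suc x + 6)) ≡ x + 10
      eq = solve-∀
      n∸≡l : n ∸ (i + 1) ≡ l
      n∸≡l = trans (cong (_∸ (i + 1)) (trans (sym i+f≡n) (trans (cong (i +_) f≡1+l) (sym (+-assoc i 1 l))))) (m+n∸m≡n (i + 1) l)

  record Initialised : Set where
    field
      p t₇ t₈ t₉ : ℕ
      m      : ℕ → ℕ
      frame  : ∀ a → a < n * n → m a ≡ m₀ a
      degree : ∀ a → a < n → m (n * n + a) ≡ sumFrom m₀ (n * a) n
      start  : ∀ a → a < n → m (tour + a) ≡ a
      last   : m (tour + n) ≡ 0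

    conf : Config
    conf = n ∷ n * n ∷ 1 ∷ tour ∷ n ∷ p ∷ 0 ∷ t₇ ∷ t₈ ∷ t₉ ∷ 0 ∷ 0 ∷ 0 ∷ 0 ∷ 0 ∷ 0 ∷ [] ∣ m

  blank : Config
  blank = n ∷ 0 ∷ 0 ∷ 0 ∷ 0 ∷ 0 ∷ 0 ∷ 0 ∷ 0 ∷ 0 ∷ 0 ∷ 0 ∷ 0 ∷ 0 ∷ 0 ∷ 0 ∷ [] ∣ m₀

  firstRow : Init
  firstRow = record
    { i = 0 ; f = n ; p = 0 ; t₇ = 0 ; t₈ = 0 ; t₉ = 0 ; m = m₀
    ; i+f≡n = refl ; p≡ = sym (*-zeroʳ n) ; frame = λ _ _ → refl
    ; degree = λ _ () ; start = λ _ () ; last = m₀≡0 _ (≤-trans (m≤m+n (n * n) n) (m≤m+n tour n)) }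

  runs-setup : Runs (block setup) blank 4 (initConf firstRow)
  runs-setup = subst (λ k → Runs (block setup) blank 4
      (n ∷ n * n ∷ 1 ∷ tour ∷ 0 ∷ 0 ∷ k ∷ 0 ∷ 0 ∷ 0 ∷ 0 ∷ 0 ∷ 0 ∷ 0 ∷ 0 ∷ 0 ∷ [] ∣ m₀)) (+-identityʳ n)
    (runs-block setup blank
      ( ok (≤-trans (m≤m+n (n * n) n) (m≤m+n tour n)) , ok (≤-trans 1≤n n≤) , ok (m≤m+n tour n)
      , ok (≤-trans (≤-reflexive (+-identityʳ n)) n≤) , tt))

  initialised : ∀ r → Init.f r ≡ 0 → ∃ λ r′ → Initialised.conf r′ ≡ initConf r
  initialised record { i = i ; p = p ; t₇ = t₇ ; t₈ = t₈ ; t₉ = t₉ ; m = m ; i+f≡n = i+0≡n ; frame = frame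
                     ; degree = degree ; start = start ; last = last } refl
    with trans (sym (+-identityʳ i)) i+0≡n
  ... | refl =
    record { p = p ; t₇ = t₇ ; t₈ = t₈ ; t₉ = t₉ ; m = m ; frame = frame ; degree = degree ; start = start ; last = last }
    , refl

  runs-initialise : ∃ λ r → Runs initialise blank (4 + suc (n * (n * 5 + 10))) (Initialised.conf r)
  runs-initialise =
    let (r , run , f≡0) = runs-while initConf (λ r → Init.f r * (n * 5 + 10)) (# 6) processRow initStep firstRow
        (r′ , eq) = initialised r f≡0
    in r′ , subst (Runs initialise blank _) (sym eq) (runs-⨾ runs-setup run)

-- Reversing a segment of a tour

sumFrom-split : ∀ f a k l → sumFrom f a (k + l) ≡ sumFrom f a k + sumFrom f (a + k) l
sumFrom-split f a k zero    = trans (cong (sumFrom f a) (+-identityʳ k)) (sym (+-identityʳ _))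
sumFrom-split f a k (suc l) = begin
  sumFrom f a (k + suc l)                               ≡⟨ cong (sumFrom f a) (+-suc k l) ⟩
  sumFrom f a (k + l) + f (a + (k + l))                 ≡⟨ cong₂ _+_ (sumFrom-split f a k l) (cong f (sym (+-assoc a k l))) ⟩
  sumFrom f a k + sumFrom f (a + k) l + f (a + k + l)   ≡⟨ +-assoc (sumFrom f a k) _ _ ⟩
  sumFrom f a k + (sumFrom f (a + k) l + f (a + k + l)) ∎
  where open ≡-Reasoning

-- The induction takes the last term off the left sum and the first term off the right one, which is
-- why `b` moves while `a` stays.
sumFrom-mirror : ∀ {f g} a b k → (∀ x y → x + suc y ≡ k → f (a + x) ≡ g (b + y)) → sumFrom f a k ≡ sumFrom g b k
sumFrom-mirror a b zero    _ = refl
sumFrom-mirror {f} {g} a b (suc k) h = begin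
  sumFrom f a k + f (a + k)             ≡⟨ cong₂ _+_ (sumFrom-mirror a (b + 1) k shifted) (h k 0 (+-comm k 1)) ⟩
  sumFrom g (b + 1) k + g (b + 0)       ≡⟨ +-comm (sumFrom g (b + 1) k) _ ⟩
  g (b + 0) + sumFrom g (b + 1) k       ≡⟨ sumFrom-split g b 1 k ⟨
  sumFrom g b (suc k)                   ∎
  where
  open ≡-Reasoning
  shifted : ∀ x y → x + suc y ≡ k → f (a + x) ≡ g (b + 1 + y)
  shifted x y eq = trans (h x (suc y) (trans (+-suc x (suc y)) (cong suc eq))) (cong g (sym (+-assoc b 1 y)))

<⇒≤-pred : ∀ {p q} → p < q → ∃ λ q₀ → q ≡ suc q₀ × p ≤ q₀
<⇒≤-pred (s≤s p≤q₀) = _ , refl , p≤q₀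

module _ (c : ℕ → ℕ → ℕ) where

  stepCost : (ℕ → ℕ) → ℕ → ℕ
  stepCost τ p = c (τ p) (τ (suc p))

  walkCost : (ℕ → ℕ) → ℕ → ℕ
  walkCost τ n = sumFrom (stepCost τ) 0 n

  private
    peel : ∀ f i l r → sumFrom f 0 (suc (suc (i + l)) + r) ≡
           sumFrom f 0 i + f i + sumFrom f (suc i) l + f (suc (i + l)) + sumFrom f (suc (suc (i + l))) r
    peel f i l r = begin
      sumFrom f 0 (suc (suc (i + l)) + r)
        ≡⟨ sumFrom-split f 0 (suc (suc (i + l))) r ⟩
      sumFrom f 0 (suc i + l) + f (suc (i + l)) + sumFrom f (suc (suc (i + l))) r
        ≡⟨ cong (λ x → x + f (suc (i + l)) + sumFrom f (suc (suc (i + l))) r) (sumFrom-split f 0 (suc i) l) ⟩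
      sumFrom f 0 i + f i + sumFrom f (suc i) l + f (suc (i + l)) + sumFrom f (suc (suc (i + l))) r ∎
      where open ≡-Reasoning

  module _ {τ τ′ : ℕ → ℕ} {i j n : ℕ} (i<j : i < j) (j<n : j < n)
           (before  : ∀ p → p ≤ i → τ′ p ≡ τ p)
           (after   : ∀ p → j < p → p ≤ n → τ′ p ≡ τ p)
           (between : ∀ x y → i < x → i < y → x + y ≡ suc i + j → τ′ x ≡ τ y)
           (c-sym   : ∀ p q → p ≤ n → q ≤ n → c (τ p) (τ q) ≡ c (τ q) (τ p)) where

    private
      g  = stepCost τ
      g′ = stepCost τ′

      g′i≡ : g′ i ≡ c (τ i) (τ j)
      g′i≡ = cong₂ c (before i ≤-refl) (between (suc i) j ≤-refl i<j refl)

      g′j≡ : g′ j ≡ c (τ (suc i)) (τ (suc j))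
      g′j≡ = cong₂ c (between j (suc i) i<j ≤-refl (+-comm j (suc i))) (after (suc j) ≤-refl j<n)

    -- The inner edges are the same, traversed backwards, so by symmetry of `c` only the edges
    -- leaving positions i and j change. Removed and new edges are added on opposite sides, since
    -- subtraction of naturals is truncated.
    walkCost-reverse : walkCost τ′ n + (stepCost τ i + stepCost τ j) ≡
                       walkCost τ n + (c (τ i) (τ j) + c (τ (suc i)) (τ (suc j)))
    walkCost-reverse with m≤n⇒∃[o]m+o≡n i<j | m≤n⇒∃[o]m+o≡n j<n
    ... | l , refl | r , refl = begin
      walkCost τ′ n + (g i + g j)
        ≡⟨ cong (_+ (g i + g j)) (peel g′ i l r) ⟩
      sumFrom g′ 0 i + g′ i + sumFrom g′ (suc i) l + g′ j + sumFrom g′ (suc j) r + (g i + g j)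
        ≡⟨ cong₂ (λ x y → x + g′ i + sumFrom g′ (suc i) l + g′ j + y + (g i + g j)) first third ⟩
      sumFrom g 0 i + g′ i + sumFrom g′ (suc i) l + g′ j + sumFrom g (suc j) r + (g i + g j)
        ≡⟨ cong (λ x → sumFrom g 0 i + g′ i + x + g′ j + sumFrom g (suc j) r + (g i + g j)) second ⟩
      sumFrom g 0 i + g′ i + sumFrom g (suc i) l + g′ j + sumFrom g (suc j) r + (g i + g j)
        ≡⟨ swap (sumFrom g 0 i) (g′ i) (sumFrom g (suc i) l) (g′ j) (sumFrom g (suc j) r) (g i) (g j) ⟩
      sumFrom g 0 i + g i + sumFrom g (suc i) l + g j + sumFrom g (suc j) r + (g′ i + g′ j)
        ≡⟨ cong₂ _+_ (sym (peel g i l r)) (cong₂ _+_ g′i≡ g′j≡) ⟩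
      walkCost τ n + (c (τ i) (τ j) + c (τ (suc i)) (τ (suc j))) ∎
      where
      open ≡-Reasoning
      swap : ∀ A x M y Z u v → A + x + M + y + Z + (u + v) ≡ A + u + M + v + Z + (x + y)
      swap = solve-∀
      first : sumFrom g′ 0 i ≡ sumFrom g 0 i
      first = sumFrom-cong 0 i λ x x<i → cong₂ c (before x (<⇒≤ x<i)) (before (suc x) x<i)
      third : sumFrom g′ (suc j) r ≡ sumFrom g (suc j) r
      third = sumFrom-cong (suc j) r λ x x<r → cong₂ c
        (after (suc j + x) (s≤s (m≤m+n j x)) (+-monoʳ-≤ (suc j) (<⇒≤ x<r)))
        (after (suc (suc j + x)) (s≤s (m≤n⇒m≤1+n (m≤m+n j x))) (≤-trans (≤-reflexive (sym (+-suc (suc j) x))) (+-monoʳ-≤ (suc j) x<r)))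
      second : sumFrom g′ (suc i) l ≡ sumFrom g (suc i) l
      second = sumFrom-mirror (suc i) (suc i) l λ x y eq → trans
        (cong₂ c (between (suc i + x) (suc (suc i + y)) (s≤s (m≤m+n i x)) (s≤s (m≤n⇒m≤1+n (m≤m+n i y)))
                   (trans (sum₁ i x y) (cong (λ z → suc (i + suc (i + z))) eq)))
                 (between (suc (suc i + x)) (suc i + y) (s≤s (m≤n⇒m≤1+n (m≤m+n i x))) (s≤s (m≤m+n i y))
                   (trans (sum₂ i x y) (cong (λ z → suc (i + suc (i + z))) eq))))
        (c-sym (suc (suc i + y)) (suc i + y) (y< x y eq) (≤-trans (n≤1+n _) (y< x y eq)))
        where
        sum₁ : ∀ i x y → suc i + x + suc (suc i + y) ≡ suc (i + suc (i + (x + suc y)))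
        sum₁ = solve-∀
        sum₂ : ∀ i x y → suc (suc i + x) + (suc i + y) ≡ suc (i + suc (i + (x + suc y)))
        sum₂ = solve-∀
        y< : ∀ x y → x + suc y ≡ l → suc (suc i + y) ≤ suc j + r
        y< x y eq = s≤s (≤-trans (s≤s (+-monoʳ-≤ i (≤-trans (n≤1+n y) (≤-trans (m≤n+m (suc y) x) (≤-reflexive eq))))) (m≤m+n j r))

swapEnds : List⁺ Instruction
swapEnds =
  arith add (# 11) (# 3) (# 7) ∷ load (# 12) (# 11) ∷ arith add (# 13) (# 3) (# 8) ∷ load (# 14) (# 13) ∷
  store (# 11) (# 14) ∷ store (# 13) (# 12) ∷
  arith add (# 7) (# 7) (# 2) ∷ arith sub (# 8) (# 8) (# 2) ∷ arith sub (# 9) (# 8) (# 7) ∷ []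

module Reverse (n W : ℕ) (ok : ∀ {x} → x ≤ Layout.tour n + n → x < W)
               (m : ℕ → ℕ) (m≤n : ∀ p → p ≤ n → m (Layout.tour n + p) ≤ n)
               (i j g t₁₀ lo hi : ℕ) (hi<n : hi < n) where

  open Layout n
  open Machine W

  -- The invariant speaks of mirror pairs x + y = lo + hi: a pair with a member below p has been
  -- exchanged, one with both members at or beyond p has not. `below` concerns addresses instead of
  -- positions, so that it protects the weights and degrees too.
  record Reversing : Set where
    field
      p q f t₁₁ t₁₂ t₁₃ t₁₄ : ℕ
      m′    : ℕ → ℕ
      p+q   : p + q ≡ lo + hi
      lo≤p  : lo ≤ p
      f≡    : f ≡ q ∸ p
      below : ∀ a → a < tour + lo → m′ a ≡ m a
      above : ∀ a → hi < a → m′ (tour + a) ≡ m (tour + a)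
      done  : ∀ x y → lo ≤ x → lo ≤ y → x + y ≡ lo + hi → x < p ⊎ y < p → m′ (tour + x) ≡ m (tour + y)
      todo  : ∀ x y → p ≤ x → p ≤ y → x + y ≡ lo + hi → m′ (tour + x) ≡ m (tour + x)

  conf : Reversing → Config
  conf r = n ∷ n * n ∷ 1 ∷ tour ∷ i ∷ j ∷ g ∷ p ∷ q ∷ f ∷ t₁₀ ∷ t₁₁ ∷ t₁₂ ∷ t₁₃ ∷ t₁₄ ∷ 0 ∷ [] ∣ m′
    where open Reversing r

  module _ (r : Reversing) (q₀ : ℕ) (q≡ : Reversing.q r ≡ suc q₀) (p≤q₀ : Reversing.p r ≤ q₀) where

    open Reversing r

    private
      p+q₀ : suc p + q₀ ≡ lo + hi
      p+q₀ = trans (sym (+-suc p q₀)) (trans (cong (p +_) (sym q≡)) p+q)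
      p<q : p < q
      p<q = ≤-trans (s≤s p≤q₀) (≤-reflexive (sym q≡))
      lo≤q : lo ≤ q
      lo≤q = ≤-trans lo≤p (<⇒≤ p<q)
      q≤hi : q ≤ hi
      q≤hi = +-cancelˡ-≤ lo q hi (≤-trans (+-monoˡ-≤ q lo≤p) (≤-reflexive p+q))
      q≤n : q ≤ n
      q≤n = ≤-trans q≤hi (<⇒≤ hi<n)
      at-q : m′ (tour + q) ≡ m (tour + q)
      at-q = todo q p (<⇒≤ p<q) ≤-refl (trans (+-comm q p) p+q)
      at-p : m′ (tour + p) ≡ m (tour + p)
      at-p = todo p q ≤-refl (<⇒≤ p<q) p+q
      m″ : ℕ → ℕ
      m″ = (m′ ⟨ tour + p ↦ m′ (tour + q) ⟩) ⟨ tour + q ↦ m′ (tour + p) ⟩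
      other : ∀ x → x ≢ p → x ≢ q → m″ (tour + x) ≡ m′ (tour + x)
      other x x≢p x≢q = trans (⟨↦⟩-other (λ e → x≢q (sym (+-cancelˡ-≡ tour _ _ e))))
                          (⟨↦⟩-other (λ e → x≢p (sym (+-cancelˡ-≡ tour _ _ e))))
      new-p : m″ (tour + p) ≡ m (tour + q)
      new-p = trans (⟨↦⟩-other (λ e → <⇒≢ p<q (sym (+-cancelˡ-≡ tour _ _ e)))) (trans ⟨↦⟩-same at-q)
      new-q : m″ (tour + q) ≡ m (tour + p)
      new-q = trans ⟨↦⟩-same at-p
      done′ : ∀ x y → lo ≤ x → lo ≤ y → x + y ≡ lo + hi → x < p + 1 ⊎ y < p + 1 → m″ (tour + x) ≡ m (tour + y)
      done′ x y lo≤x lo≤y x+y h with x ≟ p | x ≟ q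
      ... | yes refl | _ = trans new-p (cong (λ z → m (tour + z)) (+-cancelˡ-≡ x _ _ (trans p+q (sym x+y))))
      ... | no _ | yes refl = trans new-q (cong (λ z → m (tour + z)) (+-cancelˡ-≡ x _ _ (trans (trans (+-comm x p) p+q) (sym x+y))))
      ... | no x≢p | no x≢q = trans (other x x≢p x≢q) (done x y lo≤x lo≤y x+y (shrink h))
        where
        y≢p : y ≢ p
        y≢p refl = x≢q (+-cancelʳ-≡ y _ _ (trans x+y (trans (sym p+q) (+-comm p q))))
        shrink : x < p + 1 ⊎ y < p + 1 → x < p ⊎ y < p
        shrink (inj₁ x<) = inj₁ (≤∧≢⇒< (s≤s⁻¹ (≤-trans x< (≤-reflexive (+-comm p 1)))) x≢p)
        shrink (inj₂ y<) = inj₂ (≤∧≢⇒< (s≤s⁻¹ (≤-trans y< (≤-reflexive (+-comm p 1)))) y≢p)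
      todo′ : ∀ x y → p + 1 ≤ x → p + 1 ≤ y → x + y ≡ lo + hi → m″ (tour + x) ≡ m (tour + x)
      todo′ x y p<x p<y x+y = trans (other x x≢p x≢q) (todo x y (≤-trans (m≤m+n p 1) p<x) (≤-trans (m≤m+n p 1) p<y) x+y)
        where
        x≢p : x ≢ p
        x≢p refl = 1+n≰n (≤-trans (≤-reflexive (+-comm 1 p)) p<x)
        x≢q : x ≢ q
        x≢q refl = 1+n≰n (≤-trans (≤-reflexive (+-comm 1 p)) (≤-trans p<y (≤-reflexive (+-cancelˡ-≡ x _ _ (trans x+y (trans (sym p+q) (+-comm p q)))))))
      outside : ∀ a → a ≢ tour + p → a ≢ tour + q → m″ a ≡ m′ a
      outside a a≢p a≢q = trans (⟨↦⟩-other (λ e → a≢q (sym e))) (⟨↦⟩-other (λ e → a≢p (sym e)))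

    swapped : Reversing
    swapped = record
      { p = p + 1 ; q = q ∸ 1 ; f = q ∸ 1 ∸ (p + 1)
      ; t₁₁ = tour + p ; t₁₂ = m′ (tour + p) ; t₁₃ = tour + q ; t₁₄ = m′ (tour + q)
      ; m′ = m″
      ; p+q = trans (cong₂ _+_ (+-comm p 1) (cong (_∸ 1) q≡)) p+q₀
      ; lo≤p = ≤-trans lo≤p (m≤m+n p 1)
      ; f≡ = refl
      ; below = λ a a< → trans (outside a (<⇒≢ (<-≤-trans a< (+-monoʳ-≤ tour lo≤p)))
                                          (<⇒≢ (<-≤-trans a< (+-monoʳ-≤ tour lo≤q)))) (below a a<)
      ; above = λ a hi<a → trans (other a (λ e → <⇒≢ (<-≤-trans p<q (≤-trans q≤hi (<⇒≤ hi<a))) (sym e))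
                                          (λ e → <⇒≢ (≤-<-trans q≤hi hi<a) (sym e))) (above a hi<a)
      ; done = done′ ; todo = todo′
      }

    runs-swap : Runs (block swapEnds) (conf r) 9 (conf swapped)
    runs-swap = runs-block swapEnds (conf r)
      ( ok (+-monoʳ-≤ tour p≤n) , ok (≤-trans (≤-trans (≤-reflexive at-p) (m≤n p p≤n)) n≤)
      , ok (+-monoʳ-≤ tour q≤n) , ok mq≤ , ok mq≤
      , ok (≤-trans (≤-trans (≤-reflexive at-p) (m≤n p p≤n)) n≤)
      , ok (≤-trans p+1≤n n≤) , ok (≤-trans (m∸n≤m q 1) (≤-trans q≤n n≤))
      , ok (≤-trans (m∸n≤m (q ∸ 1) (p + 1)) (≤-trans (m∸n≤m q 1) (≤-trans q≤n n≤))) , tt)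
      where
      n≤ : n ≤ tour + n
      n≤ = m≤n+m n tour
      p≤n : p ≤ n
      p≤n = ≤-trans (<⇒≤ p<q) q≤n
      p+1≤n : p + 1 ≤ n
      p+1≤n = ≤-trans (≤-reflexive (+-comm p 1)) (≤-trans p<q q≤n)
      mq≤ : m′ (tour + q) ≤ tour + n
      mq≤ = ≤-trans (≤-trans (≤-reflexive at-q) (m≤n q q≤n)) n≤

    swap-budget : 10 + Reversing.f swapped * 10 ≤ f * 10
    swap-budget = *-monoˡ-≤ 10 (begin
      suc (q ∸ 1 ∸ (p + 1)) ≡⟨ cong (λ z → suc (z ∸ 1 ∸ (p + 1))) q≡ ⟩
      suc (q₀ ∸ (p + 1))    ≤⟨ s≤s (∸-monoʳ-≤ q₀ (m≤m+n p 1)) ⟩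
      suc (q₀ ∸ p)          ≡⟨ +-∸-assoc 1 p≤q₀ ⟨
      suc q₀ ∸ p            ≡⟨ cong (_∸ p) q≡ ⟨
      q ∸ p                 ≡⟨ f≡ ⟨
      f                     ∎)
      where open ≤-Reasoning

  iterate : ∀ r → Reversing.f r ≢ 0 →
            ∃₂ λ b r′ → Runs (block swapEnds) (conf r) b (conf r′) × suc b + Reversing.f r′ * 10 ≤ Reversing.f r * 10
  iterate r f≢0 with <-≤-connex (Reversing.p r) (Reversing.q r)
  ... | inj₂ q≤p = ⊥-elim (f≢0 (trans (Reversing.f≡ r) (m≤n⇒m∸n≡0 q≤p)))
  ... | inj₁ p<q with <⇒≤-pred p<q
  ... | q₀ , q≡ , p≤q₀ = 9 , swapped r q₀ q≡ p≤q₀ , runs-swap r q₀ q≡ p≤q₀ , swap-budget r q₀ q≡ p≤q₀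

  record Reversed : Set where
    field
      t₇ t₈ t₉ t₁₁ t₁₂ t₁₃ t₁₄ : ℕ
      m′      : ℕ → ℕ
      below   : ∀ a → a < tour + lo → m′ a ≡ m a
      above   : ∀ a → hi < a → m′ (tour + a) ≡ m (tour + a)
      between : ∀ x y → lo ≤ x → lo ≤ y → x + y ≡ lo + hi → m′ (tour + x) ≡ m (tour + y)

    confʳ : Config
    confʳ = n ∷ n * n ∷ 1 ∷ tour ∷ i ∷ j ∷ g ∷ t₇ ∷ t₈ ∷ t₉ ∷ t₁₀ ∷ t₁₁ ∷ t₁₂ ∷ t₁₃ ∷ t₁₄ ∷ 0 ∷ [] ∣ m′

  reversed : ∀ r → Reversing.f r ≡ 0 → Reversed
  reversed r f≡0 = record { m′ = m′ ; below = below ; above = above ; between = between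
                      ; t₇ = p ; t₈ = q ; t₉ = f ; t₁₁ = t₁₁ ; t₁₂ = t₁₂ ; t₁₃ = t₁₃ ; t₁₄ = t₁₄ }
    where
    open Reversing r
    between : ∀ x y → lo ≤ x → lo ≤ y → x + y ≡ lo + hi → m′ (tour + x) ≡ m (tour + y)
    between x y lo≤x lo≤y x+y with <-≤-connex x p | <-≤-connex y p
    ... | inj₁ x<p | _        = done x y lo≤x lo≤y x+y (inj₁ x<p)
    ... | inj₂ _   | inj₁ y<p = done x y lo≤x lo≤y x+y (inj₂ y<p)
    -- On exit q ≤ p, so a pair with no member below p can only be the midpoint x = y = p, which the
    -- reversal fixes.
    ... | inj₂ p≤x | inj₂ p≤y = trans (todo x y p≤x p≤y x+y)
      (cong (λ z → m (tour + z)) (trans (≤-antisym (pinned y x p≤y (trans (+-comm y x) x+y)) p≤x)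
                                        (≤-antisym p≤y (pinned x y p≤x x+y))))
      where
      pinned : ∀ x y → p ≤ x → x + y ≡ lo + hi → y ≤ p
      pinned x y p≤x x+y = +-cancelˡ-≤ p y p (begin
        p + y   ≤⟨ +-monoˡ-≤ y p≤x ⟩
        x + y   ≡⟨ trans x+y (sym p+q) ⟩
        p + q   ≤⟨ +-monoʳ-≤ p (m∸n≡0⇒m≤n (trans (sym f≡) f≡0)) ⟩
        p + p   ∎)
        where open ≤-Reasoning

  runs-reverse : ∀ t₁₁ t₁₂ t₁₃ t₁₄ → ∃ λ r → Runs (while 9 (block swapEnds))
    (n ∷ n * n ∷ 1 ∷ tour ∷ i ∷ j ∷ g ∷ lo ∷ hi ∷ hi ∸ lo ∷ t₁₀ ∷ t₁₁ ∷ t₁₂ ∷ t₁₃ ∷ t₁₄ ∷ 0 ∷ [] ∣ m)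
    (suc ((hi ∸ lo) * 10)) (Reversed.confʳ r)
  runs-reverse t₁₁ t₁₂ t₁₃ t₁₄ =
    let (r , run , f≡0) = runs-while conf (λ r → Reversing.f r * 10) (# 9) (block swapEnds) iterate
          (record { p = lo ; q = hi ; f = hi ∸ lo ; t₁₁ = t₁₁ ; t₁₂ = t₁₂ ; t₁₃ = t₁₃ ; t₁₄ = t₁₄ ; m′ = m
                  ; p+q = refl ; lo≤p = ≤-refl ; f≡ = refl ; below = λ _ _ → refl ; above = λ _ _ → refl
                  ; done = λ { x y lo≤x _ _ (inj₁ x<lo) → ⊥-elim (1+n≰n (≤-trans x<lo lo≤x))
                             ; x y _ lo≤y _ (inj₂ y<lo) → ⊥-elim (1+n≰n (≤-trans y<lo lo≤y)) }
                  ; todo = λ _ _ _ _ _ → refl })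
    in reversed r f≡0 , run

-- Local search

module ReversedWalk {τ τ′ : ℕ → ℕ} {i j n : ℕ} (j<n : j < n)
         (before  : ∀ p → p ≤ i → τ′ p ≡ τ p)
         (after   : ∀ p → j < p → p ≤ n → τ′ p ≡ τ p)
         (between : ∀ x y → i < x → i < y → x + y ≡ suc i + j → τ′ x ≡ τ y) where

  -- Here y is the former position of the vertex that now stands at x: mirrored beyond i and up to
  -- j, unchanged elsewhere. Range and injectivity of the new walk are read off from `where?`.
  record Source (x y : ℕ) : Set where
    field
      source : τ′ x ≡ τ y
      where? : (i < x × i < y × y ≤ j × x + y ≡ suc i + j) ⊎ (x ≡ y × (y ≤ i ⊎ j < y))

  locate : ∀ x → x ≤ n → ∃ (Source x)
  locate x x≤n with <-≤-connex i x | <-≤-connex j x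
  ... | inj₂ x≤i | _        = x , record { source = before x x≤i ; where? = inj₂ (refl , inj₁ x≤i) }
  ... | inj₁ _   | inj₁ j<x = x , record { source = after x j<x x≤n ; where? = inj₂ (refl , inj₂ j<x) }
  ... | inj₁ i<x | inj₂ x≤j = y , record { source = between x y i<x i<y x+y ; where? = inj₁ (i<x , i<y , y≤j , x+y) }
    where
    y = suc i + j ∸ x
    x+y : x + y ≡ suc i + j
    x+y = m+[n∸m]≡n (≤-trans x≤j (m≤n+m j (suc i)))
    i<y : i < y
    i<y = +-cancelˡ-≤ x (suc i) y (≤-trans (≤-trans (+-monoˡ-≤ (suc i) x≤j) (≤-reflexive (+-comm j (suc i)))) (≤-reflexive (sym x+y)))
    y≤j : y ≤ j
    y≤j = +-cancelˡ-≤ (suc i) y j (≤-trans (+-monoˡ-≤ y i<x) (≤-reflexive x+y))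

  source≤ : ∀ {x y} → Source x y → x ≤ n → y ≤ n
  source≤ s x≤n with Source.where? s
  ... | inj₁ (_ , _ , y≤j , _) = ≤-trans y≤j (<⇒≤ j<n)
  ... | inj₂ (refl , _)        = x≤n

  source< : ∀ {x y} → Source x y → x < n → y < n
  source< s x<n with Source.where? s
  ... | inj₁ (_ , _ , y≤j , _) = ≤-<-trans y≤j j<n
  ... | inj₂ (refl , _)        = x<n

  source-injective : ∀ {x x′ y} → Source x y → Source x′ y → x ≡ x′
  source-injective {y = y} s s′ with Source.where? s | Source.where? s′
  ... | inj₁ (_ , _ , _ , e)     | inj₁ (_ , _ , _ , e′)    = +-cancelʳ-≡ y _ _ (trans e (sym e′))
  ... | inj₂ (refl , _)          | inj₂ (refl , _)          = refl
  ... | inj₁ (_ , i<y , _ , _)   | inj₂ (refl , inj₁ y≤i)   = ⊥-elim (1+n≰n (≤-trans i<y y≤i))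
  ... | inj₁ (_ , _ , y≤j , _)   | inj₂ (refl , inj₂ j<y)   = ⊥-elim (1+n≰n (≤-trans j<y y≤j))
  ... | inj₂ (refl , inj₁ y≤i)   | inj₁ (_ , i<y , _ , _)   = ⊥-elim (1+n≰n (≤-trans i<y y≤i))
  ... | inj₂ (refl , inj₂ j<y)   | inj₁ (_ , _ , y≤j , _)   = ⊥-elim (1+n≰n (≤-trans j<y y≤j))

  reverse-< : (∀ p → p ≤ n → τ p < n) → ∀ p → p ≤ n → τ′ p < n
  reverse-< τ< p p≤n with locate p p≤n
  ... | q , s = ≤-trans (s≤s (≤-reflexive (Source.source s))) (τ< q (source≤ s p≤n))

  reverse-injective : (∀ p q → p < n → q < n → τ p ≡ τ q → p ≡ q) → ∀ p q → p < n → q < n → τ′ p ≡ τ′ q → p ≡ q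
  reverse-injective inj p q p<n q<n eq with locate p (<⇒≤ p<n) | locate q (<⇒≤ q<n)
  ... | p′ , s | q′ , s′
    with inj p′ q′ (source< s p<n) (source< s′ q<n) (trans (sym (Source.source s)) (trans eq (Source.source s′)))
  ... | refl = source-injective s s′

-- cost(a, b) = w(a, b) (deg a + deg b) into register x.
edgeCost : Register → Register → Register → List Instruction → List⁺ Instruction
edgeCost x a b rest =
  arith mul (# 11) (# 0) a ∷ arith add (# 11) (# 11) b ∷ load (# 11) (# 11) ∷
  arith add (# 12) (# 1) a ∷ load (# 12) (# 12) ∷ arith add (# 13) (# 1) b ∷ load (# 13) (# 13) ∷
  arith add (# 12) (# 12) (# 13) ∷ arith mul x (# 11) (# 12) ∷ rest

probe loadEnds cost₁ cost₂ cost₃ cost₄ startReverse restart advance nextRow : List⁺ Instruction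
probe = arith sub (# 6) (# 0) (# 5) ∷ []
loadEnds =
  arith add (# 11) (# 3) (# 4) ∷ load (# 7) (# 11) ∷ arith add (# 11) (# 11) (# 2) ∷ load (# 8) (# 11) ∷
  arith add (# 11) (# 3) (# 5) ∷ load (# 9) (# 11) ∷ arith add (# 11) (# 11) (# 2) ∷ load (# 10) (# 11) ∷ []
cost₁ = edgeCost (# 14) (# 7) (# 8) []
cost₂ = edgeCost (# 6) (# 9) (# 10) (arith add (# 14) (# 14) (# 6) ∷ [])
cost₃ = edgeCost (# 6) (# 7) (# 9) (arith sub (# 14) (# 14) (# 6) ∷ [])
cost₄ = edgeCost (# 6) (# 8) (# 10) (arith sub (# 6) (# 14) (# 6) ∷ [])
startReverse = arith add (# 7) (# 4) (# 2) ∷ arith sub (# 8) (# 5) (# 15) ∷ arith sub (# 9) (# 8) (# 7) ∷ []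
restart = const (# 4) 0 ∷ const (# 5) 1 ∷ arith sub (# 6) (# 0) (# 4) ∷ []
advance = arith add (# 5) (# 5) (# 2) ∷ arith sub (# 6) (# 0) (# 4) ∷ []
nextRow = arith add (# 4) (# 4) (# 2) ∷ arith add (# 5) (# 4) (# 2) ∷ arith sub (# 6) (# 0) (# 4) ∷ []

test improve searchStep search : Program
test = block loadEnds ⨾ (block cost₁ ⨾ (block cost₂ ⨾ (block cost₃ ⨾ block cost₄)))
improve = block startReverse ⨾ (while 9 (block swapEnds) ⨾ block restart)
searchStep = block probe ⨾ ifnz 6 (test ⨾ ifnz 6 improve (block advance)) (block nextRow)
search = block restart ⨾ while 6 searchStep

-- One unsuccessful test costs 53 steps; an improvement pays for its reversal
-- and for a complete new scan.
module Budget (n : ℕ) where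

  restartCost : ℕ
  restartCost = 53 * (n * (n + 2) + n) + (n * 10 + 100)

  -- Of the n + 2 units of a row, at most `suc n` go to its tests and one to the step that leaves
  -- it.
  scanBudget : ℕ → ℕ → ℕ
  scanBudget i j = 53 * ((n ∸ i) * (n + 2) + (suc n ∸ j))

  searchTime : ℕ
  searchTime = 3 + suc (n * (n + n) * restartCost + scanBudget 0 1)

module Search (n W : ℕ) (3≤n : 3 ≤ n) (ok : ∀ {x} → x ≤ Layout.tour n + n → x < W) (m₁ : ℕ → ℕ)
              (m₁≤1 : ∀ a → a < n * n → m₁ a ≤ 1)
              (degree≤n : ∀ a → a < n → m₁ (n * n + a) ≤ n)
              (m₁-sym : ∀ a b → a < n → b < n → m₁ (n * a + b) ≡ m₁ (n * b + a)) where

  open Layout n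
  open Budget n
  open Machine W

  -- The machine computes costs from its current memory; `cost` evaluates them in the memory `m₁`
  -- from which the search starts, and `frame` reduces the former to the latter.
  costOf : (ℕ → ℕ) → ℕ → ℕ → ℕ
  costOf m a b = m (n * a + b) * (m (n * n + a) + m (n * n + b))

  cost : ℕ → ℕ → ℕ
  cost = costOf m₁

  cost-sym : ∀ {a b} → a < n → b < n → cost a b ≡ cost b a
  cost-sym {a} {b} a<n b<n = cong₂ _*_ (m₁-sym a b a<n b<n) (+-comm (m₁ (n * n + a)) _)

  cost-≤ : ∀ {a b} → a < n → b < n → cost a b ≤ n + n
  cost-≤ {a} {b} a<n b<n = ≤-trans (*-mono-≤ (m₁≤1 _ (entry< a<n b<n)) (+-mono-≤ (degree≤n a a<n) (degree≤n b b<n)))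
                             (≤-reflexive (*-identityˡ (n + n)))

  1≤n : 1 ≤ n
  1≤n = ≤-trans (s≤s z≤n) 3≤n

  n≤ : n ≤ tour + n
  n≤ = m≤n+m n tour

  walk : (ℕ → ℕ) → ℕ → ℕ
  walk m p = m (tour + p)

  Stable : (ℕ → ℕ) → ℕ → ℕ → Set
  Stable τ p q = cost (τ p) (τ (suc p)) + cost (τ q) (τ (suc q)) ≤ cost (τ p) (τ q) + cost (τ (suc p)) (τ (suc q))

  record Tour (m : ℕ → ℕ) : Set where
    field
      frame     : ∀ a → a < tour → m a ≡ m₁ a
      inRange   : ∀ p → p ≤ n → walk m p < n
      injective : ∀ p q → p < n → q < n → walk m p ≡ walk m q → p ≡ q
      isClosed  : walk m n ≡ walk m 0

  -- Every pair lexicographically before (i, j) is stable on the current tour. A reversal voids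
  -- this, which is why the search restarts at (0, 1), where `scanned` is vacuous.
  record Searching : Set where
    field
      i j f t₇ t₈ t₉ t₁₀ t₁₁ t₁₂ t₁₃ t₁₄ : ℕ
      m       : ℕ → ℕ
      f≡      : f ≡ n ∸ i
      i<j     : i < j
      i≤n     : i ≤ n
      isTour  : Tour m
      scanned : ∀ p q → p < q → q < n → p < i ⊎ (p ≡ i × q < j) → Stable (walk m) p q

    open Tour isTour public

  conf : Searching → Config
  conf s = n ∷ n * n ∷ 1 ∷ tour ∷ i ∷ j ∷ f ∷ t₇ ∷ t₈ ∷ t₉ ∷ t₁₀ ∷ t₁₁ ∷ t₁₂ ∷ t₁₃ ∷ t₁₄ ∷ 0 ∷ [] ∣ m
    where open Searching s

  potential : (ℕ → ℕ) → ℕ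
  potential m = walkCost cost (walk m) n

  budget : Searching → ℕ
  budget s = potential m * restartCost + scanBudget i j
    where open Searching s

  module _ (s : Searching) (f≢0 : Searching.f s ≢ 0) where

    open Searching s

    i<n : i < n
    i<n with <-≤-connex i n
    ... | inj₁ i<n = i<n
    ... | inj₂ n≤i = ⊥-elim (f≢0 (trans f≡ (m≤n⇒m∸n≡0 n≤i)))

    i+1≤n : i + 1 ≤ n
    i+1≤n = ≤-trans (≤-reflexive (+-comm i 1)) i<n

    runs-probe : Runs (block probe) (conf s) 1
      (n ∷ n * n ∷ 1 ∷ tour ∷ i ∷ j ∷ n ∸ j ∷ t₇ ∷ t₈ ∷ t₉ ∷ t₁₀ ∷ t₁₁ ∷ t₁₂ ∷ t₁₃ ∷ t₁₄ ∷ 0 ∷ [] ∣ m)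
    runs-probe = runs-block probe (conf s) (ok (≤-trans (m∸n≤m n j) n≤) , tt)

    module RowDone (n∸j≡0 : n ∸ j ≡ 0) where

      next : Searching
      next = record
        { i = i + 1 ; j = i + 1 + 1 ; f = n ∸ (i + 1)
        ; t₇ = t₇ ; t₈ = t₈ ; t₉ = t₉ ; t₁₀ = t₁₀ ; t₁₁ = t₁₁ ; t₁₂ = t₁₂ ; t₁₃ = t₁₃ ; t₁₄ = t₁₄
        ; m = m ; f≡ = refl ; i<j = ≤-reflexive (+-comm 1 (i + 1)) ; i≤n = i+1≤n ; isTour = isTour
        ; scanned = λ p q p<q q<n h → scanned p q p<q q<n (earlier p q p<q q<n h) }
        where
        earlier : ∀ p q → p < q → q < n → p < i + 1 ⊎ (p ≡ i + 1 × q < i + 1 + 1) → p < i ⊎ (p ≡ i × q < j)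
        earlier p q p<q q<n (inj₁ p<i+1) with p ≟ i
        ... | yes p≡i = inj₂ (p≡i , <-≤-trans q<n (m∸n≡0⇒m≤n n∸j≡0))
        ... | no p≢i  = inj₁ (≤∧≢⇒< (s≤s⁻¹ (≤-trans p<i+1 (≤-reflexive (+-comm i 1)))) p≢i)
        earlier p q p<q q<n (inj₂ (refl , q<)) = ⊥-elim (1+n≰n (≤-trans (s≤s p<q) (≤-trans q< (≤-reflexive (+-comm (i + 1) 1)))))

      runs-next : Runs searchStep (conf s) (1 + suc 3) (conf next)
      runs-next = runs-⨾ runs-probe (runs-ifnz-false {x = # 6} n∸j≡0 (runs-block nextRow _
        ( ok (≤-trans i+1≤n n≤)
        , ok (≤-trans (+-mono-≤ i+1≤n 1≤n) (+-monoˡ-≤ n (m≤n+m n (n * n))))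
        , ok (≤-trans (m∸n≤m n (i + 1)) n≤) , tt)))

      budget-next : suc (1 + suc 3) + budget next ≤ budget s
      budget-next = begin
        6 + (potential m * restartCost + scanBudget (i + 1) (i + 1 + 1))
          ≡⟨ shuffle 6 (potential m * restartCost) _ ⟩
        potential m * restartCost + (6 + scanBudget (i + 1) (i + 1 + 1))
          ≤⟨ +-monoʳ-≤ (potential m * restartCost) scan ⟩
        potential m * restartCost + scanBudget i j ∎
        where
        open ≤-Reasoning
        shuffle : ∀ x y z → x + (y + z) ≡ y + (x + z)
        shuffle = solve-∀
        n∸i : n ∸ i ≡ suc (n ∸ (i + 1))
        n∸i = trans (+-∸-assoc 1 i<n) (cong (λ z → suc (n ∸ z)) (+-comm 1 i))
        collect : ∀ a n → 53 * suc (a * (n + 2) + suc n) ≡ 53 * ((suc a) * (n + 2) + 0)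
        collect = solve-∀
        scan : 6 + scanBudget (i + 1) (i + 1 + 1) ≤ scanBudget i j
        scan = begin
          6 + scanBudget (i + 1) (i + 1 + 1)
            ≤⟨ +-mono-≤ {6} {53} (s≤s (s≤s (s≤s (s≤s (s≤s (s≤s z≤n)))))) (*-monoʳ-≤ 53 (+-monoʳ-≤ ((n ∸ (i + 1)) * (n + 2)) (m∸n≤m (suc n) (i + 1 + 1)))) ⟩
          53 + 53 * ((n ∸ (i + 1)) * (n + 2) + suc n)
            ≡⟨ *-suc 53 ((n ∸ (i + 1)) * (n + 2) + suc n) ⟨
          53 * suc ((n ∸ (i + 1)) * (n + 2) + suc n)
            ≡⟨ collect (n ∸ (i + 1)) n ⟩
          53 * (suc (n ∸ (i + 1)) * (n + 2) + 0)
            ≡⟨ cong (λ z → 53 * (z * (n + 2) + 0)) n∸i ⟨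
          53 * ((n ∸ i) * (n + 2) + 0)
            ≤⟨ *-monoʳ-≤ 53 (+-monoʳ-≤ ((n ∸ i) * (n + 2)) z≤n) ⟩
          scanBudget i j ∎

    module Testing (n∸j≢0 : n ∸ j ≢ 0) where

      j<n : j < n
      j<n with <-≤-connex j n
      ... | inj₁ j<n = j<n
      ... | inj₂ n≤j = ⊥-elim (n∸j≢0 (m≤n⇒m∸n≡0 n≤j))

      j≤n : j ≤ n
      j≤n = <⇒≤ j<n

      u₀ u₁ v₀ v₁ gain : ℕ
      u₀ = m (tour + i)
      u₁ = m (tour + i + 1)
      v₀ = m (tour + j)
      v₁ = m (tour + j + 1)
      -- Words are naturals, so the subtraction is truncated: `gain` vanishes exactly when the
      -- exchange does not lower the cost.
      gain = costOf m u₀ u₁ + costOf m v₀ v₁ ∸ costOf m u₀ v₀ ∸ costOf m u₁ v₁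

      private
        address-suc : ∀ p → tour + p + 1 ≡ tour + suc p
        address-suc p = trans (+-assoc tour p 1) (cong (tour +_) (+-comm p 1))

      u₀< : u₀ < n
      u₀< = inRange i i≤n
      u₁< : u₁ < n
      u₁< = ≤-trans (s≤s (≤-reflexive (cong m (address-suc i)))) (inRange (suc i) i<n)
      v₀< : v₀ < n
      v₀< = inRange j j≤n
      v₁< : v₁ < n
      v₁< = ≤-trans (s≤s (≤-reflexive (cong m (address-suc j)))) (inRange (suc j) j<n)

      tested : Config
      tested = n ∷ n * n ∷ 1 ∷ tour ∷ i ∷ j ∷ gain ∷ u₀ ∷ u₁ ∷ v₀ ∷ v₁ ∷ m (n * u₁ + v₁) ∷
        m (n * n + u₁) + m (n * n + v₁) ∷ m (n * n + v₁) ∷ costOf m u₀ u₁ + costOf m v₀ v₁ ∸ costOf m u₀ v₀ ∷ 0 ∷ [] ∣ m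

      private
        entry≡ : ∀ {a b} → a < n → b < n → m (n * a + b) ≡ m₁ (n * a + b)
        entry≡ a<n b<n = frame _ (<-≤-trans (entry< a<n b<n) (m≤m+n (n * n) n))
        degree≡ : ∀ {a} → a < n → m (n * n + a) ≡ m₁ (n * n + a)
        degree≡ a<n = frame _ (+-monoʳ-< (n * n) a<n)

      costOf≡ : ∀ {a b} → a < n → b < n → costOf m a b ≡ cost a b
      costOf≡ a<n b<n = cong₂ _*_ (entry≡ a<n b<n) (cong₂ _+_ (degree≡ a<n) (degree≡ b<n))

      private
        k₀ : ∀ {p} → p ≤ n → tour + p < W
        k₀ p≤n = ok (+-monoʳ-≤ tour p≤n)
        kv : ∀ {p} → p ≤ n → m (tour + p) < W
        kv {p} p≤n = ok (≤-trans (<⇒≤ (inRange p p≤n)) n≤)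
        kn : ∀ {p} → p < n → tour + p + 1 < W
        kn {p} p<n = ok (≤-trans (≤-reflexive (address-suc p)) (+-monoʳ-≤ tour p<n))
        kv₁ : ∀ {p} → p < n → m (tour + p + 1) < W
        kv₁ {p} p<n = ok (≤-trans (≤-reflexive (cong m (address-suc p))) (≤-trans (<⇒≤ (inRange (suc p) p<n)) n≤))
        n²≤ : n * n ≤ tour + n
        n²≤ = ≤-trans (m≤m+n (n * n) n) (m≤m+n tour n)
        2n≤ : n + n ≤ tour + n
        2n≤ = +-monoˡ-≤ n (m≤n+m n (n * n))
        k₁ : ∀ {a} → a < n → n * a < W
        k₁ a<n = ok (≤-trans (*-monoʳ-≤ n (<⇒≤ a<n)) n²≤)
        k₂ : ∀ {a b} → a < n → b < n → n * a + b < W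
        k₂ a<n b<n = ok (≤-trans (<⇒≤ (entry< a<n b<n)) n²≤)
        k₃ : ∀ {a b} → a < n → b < n → m (n * a + b) < W
        k₃ a<n b<n = ok (≤-trans (≤-reflexive (entry≡ a<n b<n)) (≤-trans (m₁≤1 _ (entry< a<n b<n)) (≤-trans 1≤n n≤)))
        k₄ : ∀ {a} → a < n → n * n + a < W
        k₄ a<n = ok (≤-trans (+-monoʳ-≤ (n * n) (<⇒≤ a<n)) (m≤m+n tour n))
        k₅ : ∀ {a} → a < n → m (n * n + a) < W
        k₅ {a} a<n = ok (≤-trans (≤-reflexive (degree≡ a<n)) (≤-trans (degree≤n a a<n) n≤))
        k₆ : ∀ {a b} → a < n → b < n → m (n * n + a) + m (n * n + b) < W
        k₆ {a} {b} a<n b<n = ok (≤-trans (≤-reflexive (cong₂ _+_ (degree≡ a<n) (degree≡ b<n)))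
                           (≤-trans (+-mono-≤ (degree≤n a a<n) (degree≤n b b<n)) 2n≤))
        cost≤ : ∀ {a b} → a < n → b < n → costOf m a b ≤ n + n
        cost≤ a<n b<n = ≤-trans (≤-reflexive (costOf≡ a<n b<n)) (cost-≤ a<n b<n)
        k₇ : ∀ {a b} → a < n → b < n → costOf m a b < W
        k₇ a<n b<n = ok (≤-trans (cost≤ a<n b<n) 2n≤)
        both : ∀ {a b c d} → a < n → b < n → c < n → d < n → costOf m a b + costOf m c d ≤ tour + n
        both a<n b<n c<n d<n = ≤-trans (+-mono-≤ (cost≤ a<n b<n) (cost≤ c<n d<n))
          (≤-trans (≤-reflexive (4n n)) (+-monoˡ-≤ n (+-monoˡ-≤ n (*-monoˡ-≤ n (≤-trans (s≤s (s≤s z≤n)) 3≤n)))))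
          where
          4n : ∀ n → n + n + (n + n) ≡ 2 * n + n + n
          4n = solve-∀

      private
        conf₀ conf₁ conf₂ conf₃ conf₄ : Config
        conf₀ = n ∷ n * n ∷ 1 ∷ tour ∷ i ∷ j ∷ n ∸ j ∷ t₇ ∷ t₈ ∷ t₉ ∷ t₁₀ ∷ t₁₁ ∷ t₁₂ ∷ t₁₃ ∷ t₁₄ ∷ 0 ∷ [] ∣ m
        conf₁ = n ∷ n * n ∷ 1 ∷ tour ∷ i ∷ j ∷ n ∸ j ∷ u₀ ∷ u₁ ∷ v₀ ∷ v₁ ∷ tour + j + 1 ∷ t₁₂ ∷ t₁₃ ∷ t₁₄ ∷ 0 ∷ [] ∣ m
        conf₂ = n ∷ n * n ∷ 1 ∷ tour ∷ i ∷ j ∷ n ∸ j ∷ u₀ ∷ u₁ ∷ v₀ ∷ v₁ ∷ m (n * u₀ + u₁) ∷ m (n * n + u₀) + m (n * n + u₁) ∷ m (n * n + u₁) ∷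
          costOf m u₀ u₁ ∷ 0 ∷ [] ∣ m
        conf₃ = n ∷ n * n ∷ 1 ∷ tour ∷ i ∷ j ∷ costOf m v₀ v₁ ∷ u₀ ∷ u₁ ∷ v₀ ∷ v₁ ∷ m (n * v₀ + v₁) ∷ m (n * n + v₀) + m (n * n + v₁) ∷ m (n * n + v₁) ∷
          costOf m u₀ u₁ + costOf m v₀ v₁ ∷ 0 ∷ [] ∣ m
        conf₄ = n ∷ n * n ∷ 1 ∷ tour ∷ i ∷ j ∷ costOf m u₀ v₀ ∷ u₀ ∷ u₁ ∷ v₀ ∷ v₁ ∷ m (n * u₀ + v₀) ∷ m (n * n + u₀) + m (n * n + v₀) ∷ m (n * n + v₀) ∷
          costOf m u₀ u₁ + costOf m v₀ v₁ ∸ costOf m u₀ v₀ ∷ 0 ∷ [] ∣ m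

        run₀ : Runs (block loadEnds) conf₀ 8 conf₁
        run₀ = runs-block loadEnds conf₀ (k₀ i≤n , kv i≤n , kn i<n , kv₁ i<n , k₀ j≤n , kv j≤n , kn j<n , kv₁ j<n , tt)
        run₁ : Runs (block cost₁) conf₁ 9 conf₂
        run₁ = runs-block cost₁ conf₁ (k₁ u₀< , k₂ u₀< u₁< , k₃ u₀< u₁< , k₄ u₀< , k₅ u₀< , k₄ u₁< , k₅ u₁< , k₆ u₀< u₁< , k₇ u₀< u₁< , tt)
        run₂ : Runs (block cost₂) conf₂ 10 conf₃
        run₂ = runs-block cost₂ conf₂ (k₁ v₀< , k₂ v₀< v₁< , k₃ v₀< v₁< , k₄ v₀< , k₅ v₀< , k₄ v₁< , k₅ v₁< , k₆ v₀< v₁< , k₇ v₀< v₁< , ok (both u₀< u₁< v₀< v₁<) , tt)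
        run₃ : Runs (block cost₃) conf₃ 10 conf₄
        run₃ = runs-block cost₃ conf₃ (k₁ u₀< , k₂ u₀< v₀< , k₃ u₀< v₀< , k₄ u₀< , k₅ u₀< , k₄ v₀< , k₅ v₀< , k₆ u₀< v₀< , k₇ u₀< v₀<
          , ok (≤-trans (m∸n≤m _ (costOf m u₀ v₀)) (both u₀< u₁< v₀< v₁<)) , tt)
        run₄ : Runs (block cost₄) conf₄ 10 tested
        run₄ = runs-block cost₄ conf₄ (k₁ u₁< , k₂ u₁< v₁< , k₃ u₁< v₁< , k₄ u₁< , k₅ u₁< , k₄ v₁< , k₅ v₁< , k₆ u₁< v₁< , k₇ u₁< v₁<
          , ok (≤-trans (m∸n≤m _ (costOf m u₁ v₁)) (≤-trans (m∸n≤m _ (costOf m u₀ v₀)) (both u₀< u₁< v₀< v₁<))) , tt)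

      runs-test : Runs test conf₀ 47 tested
      runs-test = runs-⨾ run₀ (runs-⨾ run₁ (runs-⨾ run₂ (runs-⨾ run₃ run₄)))

      private
        u₁≡ : u₁ ≡ walk m (suc i)
        u₁≡ = cong m (address-suc i)
        v₁≡ : v₁ ≡ walk m (suc j)
        v₁≡ = cong m (address-suc j)

        old≡ : costOf m u₀ u₁ + costOf m v₀ v₁ ≡ stepCost cost (walk m) i + stepCost cost (walk m) j
        old≡ = cong₂ _+_ (trans (costOf≡ u₀< u₁<) (cong (cost u₀) u₁≡)) (trans (costOf≡ v₀< v₁<) (cong (cost v₀) v₁≡))
        new≡ : costOf m u₀ v₀ + costOf m u₁ v₁ ≡ cost (walk m i) (walk m j) + cost (walk m (suc i)) (walk m (suc j))
        new≡ = cong₂ _+_ (costOf≡ u₀< v₀<) (trans (costOf≡ u₁< v₁<) (cong₂ cost u₁≡ v₁≡))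

        gain≡ : gain ≡ (stepCost cost (walk m) i + stepCost cost (walk m) j) ∸
                       (cost (walk m i) (walk m j) + cost (walk m (suc i)) (walk m (suc j)))
        gain≡ = trans (∸-+-assoc _ (costOf m u₀ v₀) (costOf m u₁ v₁)) (cong₂ _∸_ old≡ new≡)

      module NoGain (gain≡0 : gain ≡ 0) where

        next : Searching
        next = record
          { i = i ; j = j + 1 ; f = n ∸ i
          ; t₇ = u₀ ; t₈ = u₁ ; t₉ = v₀ ; t₁₀ = v₁ ; t₁₁ = m (n * u₁ + v₁) ; t₁₂ = m (n * n + u₁) + m (n * n + v₁)
          ; t₁₃ = m (n * n + v₁) ; t₁₄ = costOf m u₀ u₁ + costOf m v₀ v₁ ∸ costOf m u₀ v₀
          ; m = m ; f≡ = refl ; i<j = ≤-trans i<j (m≤m+n j 1) ; i≤n = i≤n ; isTour = isTour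
          ; scanned = scanned′ }
          where
          scanned′ : ∀ p q → p < q → q < n → p < i ⊎ (p ≡ i × q < j + 1) → Stable (walk m) p q
          scanned′ p q p<q q<n (inj₁ p<i) = scanned p q p<q q<n (inj₁ p<i)
          scanned′ p q p<q q<n (inj₂ (p≡i , q<)) with q ≟ j
          ... | no q≢j = scanned p q p<q q<n (inj₂ (p≡i , ≤∧≢⇒< (s≤s⁻¹ (≤-trans q< (≤-reflexive (+-comm j 1)))) q≢j))
          ... | yes q≡j with p≡i | q≡j
          ... | refl | refl = m∸n≡0⇒m≤n (trans (sym gain≡) gain≡0)

        runs-next : Runs searchStep (conf s) 52 (conf next)
        runs-next = runs-⨾ runs-probe (runs-ifnz-true {x = # 6} n∸j≢0
          (runs-⨾ runs-test (runs-ifnz-false {x = # 6} gain≡0 (runs-block advance tested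
            ( ok (≤-trans (≤-trans (≤-reflexive (+-comm j 1)) j<n) n≤)
            , ok (≤-trans (m∸n≤m n i) n≤) , tt)))))

        budget-next : 53 + budget next ≤ budget s
        budget-next = ≤-reflexive (trans (collect (potential m * restartCost) ((n ∸ i) * (n + 2)) (suc n ∸ (j + 1)))
          (cong (λ z → potential m * restartCost + 53 * ((n ∸ i) * (n + 2) + z))
            (trans (cong (λ z → suc (suc n ∸ z)) (+-comm j 1)) (sym (+-∸-assoc 1 j≤n)))))
          where
          collect : ∀ x y z → 53 + (x + 53 * (y + z)) ≡ x + 53 * (y + suc z)
          collect = solve-∀

      module Gain (gain≢0 : gain ≢ 0) where

        open Reverse n W ok m (λ p p≤n → <⇒≤ (inRange p p≤n)) i j gain v₁ (i + 1) j j<n using (runs-reverse; module Reversed)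

        private
          reversal = runs-reverse (m (n * u₁ + v₁)) (m (n * n + u₁) + m (n * n + v₁)) (m (n * n + v₁))
                       (costOf m u₀ u₁ + costOf m v₀ v₁ ∸ costOf m u₀ v₀)

        open Reversed (proj₁ reversal) public using (m′; below; above; between)

        private
          i+1≡ : i + 1 ≡ suc i
          i+1≡ = +-comm i 1
          before′ : ∀ p → p ≤ i → walk m′ p ≡ walk m p
          before′ p p≤i = below (tour + p) (+-monoʳ-< tour (≤-trans (s≤s p≤i) (≤-reflexive (sym i+1≡))))
          after′ : ∀ p → j < p → p ≤ n → walk m′ p ≡ walk m p
          after′ p j<p _ = above p j<p
          between′ : ∀ x y → i < x → i < y → x + y ≡ suc i + j → walk m′ x ≡ walk m y
          between′ x y i<x i<y x+y = between x y (≤-trans (≤-reflexive i+1≡) i<x) (≤-trans (≤-reflexive i+1≡) i<y)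
                                       (trans x+y (cong (_+ j) (sym i+1≡)))

        open ReversedWalk {walk m} {walk m′} {i} {j} {n} j<n before′ after′ between′

        isTour′ : Tour m′
        isTour′ = record
          { frame = λ a a< → trans (below a (<-≤-trans a< (m≤m+n tour (i + 1)))) (frame a a<)
          ; inRange = reverse-< inRange
          ; injective = reverse-injective injective
          -- The reversed positions lie between 1 and n - 1, so both ends of the closed walk keep
          -- their vertex.
          ; isClosed = trans (after′ n j<n ≤-refl) (trans isClosed (sym (before′ 0 z≤n)))
          }

        potential-< : potential m′ < potential m
        potential-< = +-cancelʳ-< _ (potential m′) (potential m) (begin-strict
          potential m′ + (stepCost cost (walk m) i + stepCost cost (walk m) j)
            ≡⟨ walkCost-reverse cost {walk m} {walk m′} i<j j<n before′ after′ between′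
                 (λ p q p≤n q≤n → cost-sym (inRange p p≤n) (inRange q q≤n)) ⟩
          potential m + (cost (walk m i) (walk m j) + cost (walk m (suc i)) (walk m (suc j)))
            <⟨ +-monoʳ-< (potential m) (≰⇒> λ le → gain≢0 (trans gain≡ (m≤n⇒m∸n≡0 le))) ⟩
          potential m + (stepCost cost (walk m) i + stepCost cost (walk m) j) ∎)
          where open ≤-Reasoning

        next : Searching
        next = record
          { i = 0 ; j = 1 ; f = n ; t₇ = t₇ʳ ; t₈ = t₈ʳ ; t₉ = t₉ʳ ; t₁₀ = v₁ ; t₁₁ = t₁₁ʳ ; t₁₂ = t₁₂ʳ ; t₁₃ = t₁₃ʳ ; t₁₄ = t₁₄ʳ
          ; m = m′ ; f≡ = refl ; i<j = s≤s z≤n ; i≤n = z≤n ; isTour = isTour′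
          ; scanned = λ { p q p<q q<n (inj₁ ()) ; p q p<q q<n (inj₂ (refl , q<1)) → ⊥-elim (1+n≰n (≤-trans p<q (s≤s⁻¹ q<1))) } }
          where open Reversed (proj₁ reversal) using () renaming (t₇ to t₇ʳ; t₈ to t₈ʳ; t₉ to t₉ʳ; t₁₁ to t₁₁ʳ; t₁₂ to t₁₂ʳ; t₁₃ to t₁₃ʳ; t₁₄ to t₁₄ʳ)

        steps-next : ℕ
        steps-next = 1 + suc (47 + suc (3 + (suc ((j ∸ (i + 1)) * 10) + 3)))

        runs-next : Runs searchStep (conf s) steps-next (conf next)
        runs-next = runs-⨾ runs-probe (runs-ifnz-true {x = # 6} n∸j≢0
          (runs-⨾ runs-test (runs-ifnz-true {x = # 6} gain≢0
            (runs-⨾ (runs-block startReverse tested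
                ( ok (≤-trans i+1≤n n≤) , ok (≤-trans j≤n n≤) , ok (≤-trans (m∸n≤m j (i + 1)) (≤-trans j≤n n≤)) , tt))
              (runs-⨾ (proj₂ reversal) (runs-block restart (Reversed.confʳ (proj₁ reversal))
                ( ok z≤n , ok (≤-trans 1≤n n≤) , ok n≤ , tt)))))))

        budget-next : suc steps-next + budget next ≤ budget s
        budget-next = begin
          suc steps-next + (potential m′ * restartCost + scanBudget 0 1)
            ≡⟨ shuffle (suc steps-next) (potential m′ * restartCost) _ ⟩
          potential m′ * restartCost + (suc steps-next + scanBudget 0 1)
            ≤⟨ +-monoʳ-≤ (potential m′ * restartCost) small ⟩
          potential m′ * restartCost + restartCost
            ≡⟨ +-comm (potential m′ * restartCost) restartCost ⟩
          suc (potential m′) * restartCost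
            ≤⟨ *-monoˡ-≤ restartCost potential-< ⟩
          potential m * restartCost
            ≤⟨ m≤m+n _ _ ⟩
          budget s ∎
          where
          open ≤-Reasoning
          shuffle : ∀ x y z → x + (y + z) ≡ y + (x + z)
          shuffle = solve-∀
          collect : ∀ x y → suc (1 + suc (47 + suc (3 + (suc x + 3)))) + y + 42 ≡ y + (x + 100)
          collect = solve-∀
          small : suc steps-next + scanBudget 0 1 ≤ restartCost
          small = begin
            -- Apart from ten steps for each possible swap, an improvement takes 58 steps; 42 fills
            -- them up to the 100 in `restartCost`.
            suc steps-next + scanBudget 0 1      ≤⟨ m≤m+n _ 42 ⟩
            suc steps-next + scanBudget 0 1 + 42 ≡⟨ collect ((j ∸ (i + 1)) * 10) (scanBudget 0 1) ⟩
            scanBudget 0 1 + ((j ∸ (i + 1)) * 10 + 100)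
              ≤⟨ +-monoʳ-≤ (scanBudget 0 1) (+-monoˡ-≤ 100 (*-monoˡ-≤ 10 (≤-trans (m∸n≤m j (i + 1)) j≤n))) ⟩
            restartCost ∎

    iterate : ∃₂ λ b s′ → Runs searchStep (conf s) b (conf s′) × suc b + budget s′ ≤ budget s
    iterate with n ∸ j ≟ 0
    ... | yes z = _ , RowDone.next z , RowDone.runs-next z , RowDone.budget-next z
    ... | no nz with Testing.gain nz ≟ 0
    ... | yes z = _ , Testing.NoGain.next nz z , Testing.NoGain.runs-next nz z , Testing.NoGain.budget-next nz z
    ... | no gain≢0 = _ , Testing.Gain.next nz gain≢0 , Testing.Gain.runs-next nz gain≢0 , Testing.Gain.budget-next nz gain≢0

  record LocalOptimum : Set where
    field
      j t₇ t₈ t₉ t₁₀ t₁₁ t₁₂ t₁₃ t₁₄ : ℕ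
      m      : ℕ → ℕ
      isTour : Tour m
      stable : ∀ p q → p < q → q < n → Stable (walk m) p q

    open Tour isTour public

    confˡ : Config
    confˡ = n ∷ n * n ∷ 1 ∷ tour ∷ n ∷ j ∷ 0 ∷ t₇ ∷ t₈ ∷ t₉ ∷ t₁₀ ∷ t₁₁ ∷ t₁₂ ∷ t₁₃ ∷ t₁₄ ∷ 0 ∷ [] ∣ m

  localOptimum : ∀ s → Searching.f s ≡ 0 → ∃ λ r → LocalOptimum.confˡ r ≡ conf s
  localOptimum record { i = i ; f≡ = f≡ ; i≤n = i≤n ; isTour = isTour ; scanned = scanned } refl
    with ≤-antisym i≤n (m∸n≡0⇒m≤n (sym f≡))
  ... | refl = record { isTour = isTour ; stable = λ p q p<q q<n → scanned p q p<q q<n (inj₁ (<-trans p<q q<n)) } , refl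

  runs-search : ∀ {t₄ t₅ t₆ t₇ t₈ t₉ t₁₀ t₁₁ t₁₂ t₁₃ t₁₄} → Tour m₁ → ∃ λ r → Runs search
    (n ∷ n * n ∷ 1 ∷ tour ∷ t₄ ∷ t₅ ∷ t₆ ∷ t₇ ∷ t₈ ∷ t₉ ∷ t₁₀ ∷ t₁₁ ∷ t₁₂ ∷ t₁₃ ∷ t₁₄ ∷ 0 ∷ [] ∣ m₁)
    searchTime (LocalOptimum.confˡ r)
  runs-search {t₄} {t₅} {t₆} {t₇} {t₈} {t₉} {t₁₀} {t₁₁} {t₁₂} {t₁₃} {t₁₄} isTour =
    let (s , run , f≡0) = runs-while conf budget (# 6) searchStep iterate begin
        (r , eq) = localOptimum s f≡0
    in r , runs-≤ (+-monoʳ-≤ 3 (s≤s (+-monoˡ-≤ (scanBudget 0 1) (*-monoˡ-≤ restartCost potential-≤))))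
             (subst (Runs search start _) (sym eq) (runs-⨾ (runs-block restart start (ok z≤n , ok (≤-trans 1≤n n≤) , ok n≤ , tt)) run))
    where
    start : Config
    start = n ∷ n * n ∷ 1 ∷ tour ∷ t₄ ∷ t₅ ∷ t₆ ∷ t₇ ∷ t₈ ∷ t₉ ∷ t₁₀ ∷ t₁₁ ∷ t₁₂ ∷ t₁₃ ∷ t₁₄ ∷ 0 ∷ [] ∣ m₁
    begin : Searching
    begin = record
      { i = 0 ; j = 1 ; f = n ; t₇ = t₇ ; t₈ = t₈ ; t₉ = t₉ ; t₁₀ = t₁₀ ; t₁₁ = t₁₁ ; t₁₂ = t₁₂ ; t₁₃ = t₁₃ ; t₁₄ = t₁₄
      ; m = m₁ ; f≡ = refl ; i<j = s≤s z≤n ; i≤n = z≤n ; isTour = isTour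
      ; scanned = λ { p q p<q q<n (inj₁ ()) ; p q p<q q<n (inj₂ (refl , q<1)) → ⊥-elim (1+n≰n (≤-trans p<q (s≤s⁻¹ q<1))) } }
    potential-≤ : potential m₁ ≤ n * (n + n)
    potential-≤ = sumFrom-≤ (stepCost cost (walk m₁)) 0 n (n + n)
      (λ x x<n → cost-≤ (Tour.inRange isTour x (<⇒≤ x<n)) (Tour.inRange isTour (suc x) x<n))

-- The algorithm

copyCell : List⁺ Instruction
copyCell =
  arith add (# 7) (# 3) (# 4) ∷ load (# 8) (# 7) ∷ store (# 4) (# 8) ∷
  arith add (# 4) (# 4) (# 2) ∷ arith sub (# 6) (# 0) (# 4) ∷ []

startCopy : List⁺ Instruction
startCopy = const (# 4) 0 ∷ arith sub (# 6) (# 0) (# 4) ∷ []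

copyOut : Program
copyOut = block startCopy ⨾ while 6 (block copyCell)

module CopyOut (n W : ℕ) (ok : ∀ {x} → x ≤ Layout.tour n + n → x < W)
               (m : ℕ → ℕ) (m<n : ∀ p → p ≤ n → m (Layout.tour n + p) < n)
               (t₅ t₉ t₁₀ t₁₁ t₁₂ t₁₃ t₁₄ : ℕ) where

  open Layout n
  open Machine W

  private
    n≤ : n ≤ tour + n
    n≤ = m≤n+m n tour

  -- The output overwrites the weight matrix from cell 0 on. Cell `tour + i` is not below i, so by
  -- `rest` it is still intact when it is read.
  record Copying : Set where
    field
      i f t₇ t₈ : ℕ
      m′     : ℕ → ℕ
      f≡     : f ≡ n ∸ i
      i≤n    : i ≤ n
      copied : ∀ a → a < i → m′ a ≡ m (tour + a)
      rest   : ∀ a → i ≤ a → m′ a ≡ m a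

  conf : Copying → Config
  conf c = n ∷ n * n ∷ 1 ∷ tour ∷ i ∷ t₅ ∷ f ∷ t₇ ∷ t₈ ∷ t₉ ∷ t₁₀ ∷ t₁₁ ∷ t₁₂ ∷ t₁₃ ∷ t₁₄ ∷ 0 ∷ [] ∣ m′
    where open Copying c

  copyStep : ∀ c → Copying.f c ≢ 0 →
             ∃₂ λ b c′ → Runs (block copyCell) (conf c) b (conf c′) × suc b + Copying.f c′ * 6 ≤ Copying.f c * 6
  copyStep c f≢0 =
    5 , record { i = i + 1 ; f = n ∸ (i + 1) ; t₇ = tour + i ; t₈ = m′ (tour + i)
               ; m′ = m′ ⟨ i ↦ m′ (tour + i) ⟩ ; f≡ = refl ; i≤n = i+1≤n ; copied = copied′
               ; rest = λ a i<a → trans (⟨↦⟩-other (<⇒≢ (≤-trans (≤-reflexive (+-comm 1 i)) i<a))) (rest a (≤-trans (m≤m+n i 1) i<a)) }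
    , runs-block copyCell (conf c)
        ( ok (+-monoʳ-≤ tour i≤n) , ok value≤ , ok value≤ , ok (≤-trans i+1≤n n≤) , ok (≤-trans (m∸n≤m n (i + 1)) n≤) , tt)
    , *-monoˡ-≤ 6 (≤-reflexive (trans (sym n∸i) (sym f≡)))
    where
    open Copying c
    i<n : i < n
    i<n with <-≤-connex i n
    ... | inj₁ i<n = i<n
    ... | inj₂ n≤i = ⊥-elim (f≢0 (trans f≡ (m≤n⇒m∸n≡0 n≤i)))
    i+1≤n : i + 1 ≤ n
    i+1≤n = ≤-trans (≤-reflexive (+-comm i 1)) i<n
    n∸i : n ∸ i ≡ suc (n ∸ (i + 1))
    n∸i = trans (+-∸-assoc 1 i<n) (cong (λ z → suc (n ∸ z)) (+-comm 1 i))
    source : m′ (tour + i) ≡ m (tour + i)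
    source = rest (tour + i) (m≤n+m i tour)
    value≤ : m′ (tour + i) ≤ tour + n
    value≤ = ≤-trans (≤-reflexive source) (≤-trans (<⇒≤ (m<n i i≤n)) n≤)
    copied′ : ∀ a → a < i + 1 → (m′ ⟨ i ↦ m′ (tour + i) ⟩) a ≡ m (tour + a)
    copied′ a a< with a ≟ i
    ... | yes refl = trans ⟨↦⟩-same source
    ... | no a≢i = trans (⟨↦⟩-other (λ e → a≢i (sym e)))
                     (copied a (≤∧≢⇒< (s≤s⁻¹ (≤-trans a< (≤-reflexive (+-comm i 1)))) a≢i))

  runs-copy : ∀ t₄ t₆ t₇ t₈ → ∃ λ σ → Runs copyOut
    (n ∷ n * n ∷ 1 ∷ tour ∷ t₄ ∷ t₅ ∷ t₆ ∷ t₇ ∷ t₈ ∷ t₉ ∷ t₁₀ ∷ t₁₁ ∷ t₁₂ ∷ t₁₃ ∷ t₁₄ ∷ 0 ∷ [] ∣ m)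
    (2 + suc (n * 6)) σ × (∀ a → a < n → Config.mem σ a ≡ m (tour + a))
  runs-copy t₄ t₆ t₇ t₈ =
    let (c , run , f≡0) = runs-while conf (λ c → Copying.f c * 6) (# 6) (block copyCell) copyStep
          (record { i = 0 ; f = n ; t₇ = t₇ ; t₈ = t₈ ; m′ = m ; f≡ = refl ; i≤n = z≤n
                  ; copied = λ _ () ; rest = λ _ _ → refl })
    in conf c , runs-⨾ (runs-block startCopy _ (ok z≤n , ok n≤ , tt)) run
       , λ a a<n → Copying.copied c a (≤-trans a<n (m∸n≡0⇒m≤n (trans (sym (Copying.f≡ c)) f≡0)))

initTime copyTime : ℕ → ℕ
initTime n = 4 + suc (n * (n * 5 + 10))
copyTime n = 2 + suc (n * 6)

localSearch : Program
localSearch = initialise ⨾ (search ⨾ copyOut)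

next : ∀ {n} → Fin n → Fin n
next {n} p with suc (toℕ p) <? n
... | yes p+1<n = fromℕ< p+1<n
... | no _      = fromℕ< (≤-<-trans z≤n (Fin.toℕ<n p))

toℕ-next : ∀ {n} (p : Fin n) → (suc (toℕ p) < n × toℕ (next p) ≡ suc (toℕ p)) ⊎ (suc (toℕ p) ≡ n × toℕ (next p) ≡ 0)
toℕ-next {n} p with suc (toℕ p) <? n
... | yes p+1<n = inj₁ (p+1<n , Fin.toℕ-fromℕ< p+1<n)
... | no p+1≮n  = inj₂ (≤-antisym (Fin.toℕ<n p) (≮⇒≥ p+1≮n) , Fin.toℕ-fromℕ< _)

localSearchTime : ℕ → ℕ
localSearchTime n = initTime n + (Budget.searchTime n + copyTime n)

-- The added polynomial in k is 2000 n⁴ minus the running time at n = k + 1.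
localSearchTime-≤ : ∀ n → 1 ≤ n → localSearchTime n ≤ 2000 * n ^ 4
localSearchTime-≤ (suc k) _ = ≤-trans (m≤m+n _ (1111 + 5871 * k + 10092 * (k * k) + 7238 * (k * k * k) + 1894 * (k * k * k * k))) (≤-reflexive (expand k))
  where
  expand : ∀ k → let n = suc k in
    4 + suc (n * (n * 5 + 10)) +
      (3 + suc (n * (n + n) * (53 * (n * (n + 2) + n) + (n * 10 + 100)) + 53 * (n * (n + 2) + n)) + (2 + suc (n * 6))) +
      (1111 + 5871 * k + 10092 * (k * k) + 7238 * (k * k * k) + 1894 * (k * k * k * k)) ≡ 2000 * (n * (n * (n * (n * 1))))
  expand = solve-∀

-- The machine's output as a locally optimal vertex order

module Weighted (I : ZeroOneInstance) where

  private
    n = size I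
    wt = weightMatrix I

  degree : Fin n → ℕ
  degree u = ∑ (wt u)

  costᶠ : Fin n → Fin n → ℕ
  costᶠ u v = wt u v * (degree u + degree v)

  wt-sym : ∀ u v → wt u v ≡ wt v u
  wt-sym u v with Fin.<-cmp u v | Fin.<-cmp v u
  ... | tri< _ _ _   | tri> _ _ _   = refl
  ... | tri≈ _ _ _   | tri≈ _ _ _   = refl
  ... | tri> _ _ _   | tri< _ _ _   = refl
  ... | tri< u<v _ _ | tri≈ _ _ u≮v = ⊥-elim (u≮v u<v)
  ... | tri< u<v _ _ | tri< _ _ u≮v = ⊥-elim (u≮v u<v)
  ... | tri≈ _ e _   | tri< _ ¬e _  = ⊥-elim (¬e (sym e))
  ... | tri≈ _ e _   | tri> _ ¬e _  = ⊥-elim (¬e (sym e))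
  ... | tri> _ ¬e _  | tri≈ _ e _   = ⊥-elim (¬e (sym e))
  ... | tri> v≮u _ _ | tri> _ _ v<u = ⊥-elim (v≮u v<u)

  wt-diag : ∀ u → wt u u ≡ 0
  wt-diag u with Fin.<-cmp u u
  ... | tri< _ ¬e _ = ⊥-elim (¬e refl)
  ... | tri≈ _ _ _  = refl
  ... | tri> _ ¬e _ = ⊥-elim (¬e refl)

  wt≤1 : ∀ u v → wt u v ≤ 1
  wt≤1 u v with Fin.<-cmp u v
  ... | tri< u<v _ _ = s≤s⁻¹ (Fin.toℕ<n (w I (edge u v u<v)))
  ... | tri≈ _ _ _   = z≤n
  ... | tri> _ _ v<u = s≤s⁻¹ (Fin.toℕ<n (w I (edge v u v<u)))

  private
    m₀ = State.mem (input I)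

  input-entry : ∀ u v → m₀ (n * toℕ u + toℕ v) ≡ wt u v
  input-entry u v with n * toℕ u + toℕ v <? n * n
  ... | no ≮ = ⊥-elim (≮ (Layout.entry< n (Fin.toℕ<n u) (Fin.toℕ<n v)))
  ... | yes a< = cong (λ (i , j) → wt i j) (trans (cong (remQuot {n} n)
    (Fin.toℕ-injective (trans (Fin.toℕ-fromℕ< a<) (sym (Fin.toℕ-combine u v))))) (Fin.remQuot-combine u v))

  input≤1 : ∀ a → a < n * n → m₀ a ≤ 1
  input≤1 a _ with a <? n * n
  ... | no _   = z≤n
  ... | yes a< = wt≤1 (proj₁ (remQuot {n} n (fromℕ< a<))) (proj₂ (remQuot {n} n (fromℕ< a<)))

  input≡0 : ∀ a → n * n ≤ a → m₀ a ≡ 0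
  input≡0 a n²≤a with a <? n * n
  ... | no _   = refl
  ... | yes a< = ⊥-elim (1+n≰n (≤-trans a< n²≤a))

  input-row : ∀ u → sumFrom m₀ (n * toℕ u) n ≡ degree u
  input-row u = trans (sumFrom-∑ m₀ (n * toℕ u) n) (∑-cong (λ v → input-entry u v))
    where
    sumFrom-∑ : ∀ f a k → sumFrom f a k ≡ ∑ (λ (x : Fin k) → f (a + toℕ x))
    sumFrom-∑ f a zero    = refl
    sumFrom-∑ f a (suc k) = trans (sumFrom-split f a 1 k) (cong (f (a + 0) +_)
      (trans (sumFrom-∑ f (a + 1) k) (∑-cong {k} {λ x → f (a + 1 + toℕ x)} {λ x → f (a + suc (toℕ x))} (λ x → cong f (+-assoc a 1 (toℕ x))))))

  -- The interface between the two halves of the proof: the counting below knows the output only as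
  -- a vertex order in which no exchange of two tour edges lowers the cost. Positions are cyclic, so
  -- the closing edge takes part in exchanges.
  record Solution : Set where
    field
      execution : Execution localSearch 4 I
      stableᶠ   : ∀ p q → p ≢ q → let σ = lookup (order execution) in
                  costᶠ (σ p) (σ (next p)) + costᶠ (σ q) (σ (next q)) ≤ costᶠ (σ p) (σ q) + costᶠ (σ (next p)) (σ (next q))
      fast      : time execution ≤ localSearchTime n

  private
    3≤n = size≥3 I
    1≤n = ≤-trans (s≤s z≤n) 3≤n
    W = n ^ 4

    ok : ∀ {x} → x ≤ Layout.tour n + n → x < W
    ok = Layout.fits n 3≤n

  open Layout n
  open Machine W

  open Initialise n W 1≤n ok m₀ input≤1 input≡0 using (Initialised; runs-initialise; blank)

  blank∼input : blank ∼ input I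
  blank∼input = record { same-regs = regs ; same-mem = λ _ → refl }
    where
    regs : ∀ r → State.reg (input I) (toℕ r) ≡ lookup (Config.regs blank) r
    regs zero    = refl
    regs (suc r) = sym (Vec.lookup-replicate r 0)

  module AfterInit (init : Initialised) (runᵢ : Runs initialise blank (initTime n) (Initialised.conf init)) where

    open Initialised init using (frame; start; last) renaming (m to m₁; degree to degree₁)

    private

      m₁≤1 : ∀ a → a < n * n → m₁ a ≤ 1
      m₁≤1 a a< = ≤-trans (≤-reflexive (frame a a<)) (input≤1 a a<)

      m₁-entry : ∀ u v → m₁ (n * toℕ u + toℕ v) ≡ wt u v
      m₁-entry u v = trans (frame _ (entry< (Fin.toℕ<n u) (Fin.toℕ<n v))) (input-entry u v)

      m₁-degree : ∀ u → m₁ (n * n + toℕ u) ≡ degree u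
      m₁-degree u = trans (degree₁ (toℕ u) (Fin.toℕ<n u)) (input-row u)

      degree≤n : ∀ a → a < n → m₁ (n * n + a) ≤ n
      degree≤n a a<n = ≤-trans (≤-reflexive (degree₁ a a<n)) (≤-trans
        (sumFrom-≤ m₀ (n * a) n 1 (λ x x<n → input≤1 _ (entry< a<n x<n))) (≤-reflexive (*-identityʳ n)))

      m₁-sym : ∀ a b → a < n → b < n → m₁ (n * a + b) ≡ m₁ (n * b + a)
      m₁-sym a b a<n b<n = subst₂ (λ a b → m₁ (n * a + b) ≡ m₁ (n * b + a)) (Fin.toℕ-fromℕ< a<n) (Fin.toℕ-fromℕ< b<n)
        (trans (m₁-entry _ _) (trans (wt-sym (fromℕ< a<n) (fromℕ< b<n)) (sym (m₁-entry _ _))))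

    open Search n W 3≤n ok m₁ m₁≤1 degree≤n m₁-sym using (Tour; runs-search; LocalOptimum; cost; walk)

    private
      identityTour : Tour m₁
      identityTour = record
        { frame = λ _ _ → refl
        ; inRange = inRange
        ; injective = λ p q p<n q<n e → trans (sym (start p p<n)) (trans e (start q q<n))
        ; isClosed = trans last (sym (start 0 1≤n)) }
        where
        inRange : ∀ p → p ≤ n → m₁ (tour + p) < n
        inRange p p≤n with p ≟ n
        ... | yes refl = ≤-trans (s≤s (≤-reflexive last)) 1≤n
        ... | no p≢n = let p<n = ≤∧≢⇒< p≤n p≢n in ≤-trans (s≤s (≤-reflexive (start p p<n))) p<n

    module AfterSearch (opt : LocalOptimum)
                       (runₛ : Runs search (Initialised.conf init) (Budget.searchTime n) (LocalOptimum.confˡ opt)) where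
      open LocalOptimum opt using (m; inRange; injective; isClosed; stable)

      module AfterCopy (t : ℕ) (s : State) (derivation : W ⊢ localSearch , input I ⇓[ t ] s) (t≤ : t ≤ localSearchTime n)
                       (copied : ∀ a → a < n → State.mem s a ≡ walk m a) where
        private

          vertex : Fin n → Fin n
          vertex p = fromℕ< (inRange (toℕ p) (<⇒≤ (Fin.toℕ<n p)))

          toℕ-vertex : ∀ p → toℕ (vertex p) ≡ walk m (toℕ p)
          toℕ-vertex p = Fin.toℕ-fromℕ< _

          vertex-injective : ∀ {p q} → vertex p ≡ vertex q → p ≡ q
          vertex-injective {p} {q} e = Fin.toℕ-injective (injective _ _ (Fin.toℕ<n p) (Fin.toℕ<n q)
            (trans (sym (toℕ-vertex p)) (trans (cong toℕ e) (toℕ-vertex q))))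

          -- At the last position, the closing cell of the walk supplies the vertex that `next`
          -- finds at position 0.
          vertex-next : ∀ p → toℕ (vertex (next p)) ≡ walk m (suc (toℕ p))
          vertex-next p = trans (toℕ-vertex (next p)) (position p)
            where
            position : ∀ p → walk m (toℕ (next p)) ≡ walk m (suc (toℕ p))
            position p with toℕ-next p
            ... | inj₁ (_ , e)     = cong (walk m) e
            ... | inj₂ (p+1≡n , e) = trans (cong (walk m) e) (trans (sym isClosed) (cong (walk m) (sym p+1≡n)))

          cost-toℕ : ∀ u v → cost (toℕ u) (toℕ v) ≡ costᶠ u v
          cost-toℕ u v = cong₂ _*_ (m₁-entry u v) (cong₂ _+_ (m₁-degree u) (m₁-degree v))

          cost≡ : ∀ {a b} u v → toℕ u ≡ a → toℕ v ≡ b → cost a b ≡ costᶠ u v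
          cost≡ u v refl refl = cost-toℕ u v

          Stableᶠ : Fin n → Fin n → Set
          Stableᶠ p q = costᶠ (vertex p) (vertex (next p)) + costᶠ (vertex q) (vertex (next q)) ≤
                        costᶠ (vertex p) (vertex q) + costᶠ (vertex (next p)) (vertex (next q))

          stable-< : ∀ p q → toℕ p < toℕ q → Stableᶠ p q
          stable-< p q p<q = subst₂ _≤_
            (cong₂ _+_ (cost≡ _ _ (toℕ-vertex p) (vertex-next p)) (cost≡ _ _ (toℕ-vertex q) (vertex-next q)))
            (cong₂ _+_ (cost≡ _ _ (toℕ-vertex p) (toℕ-vertex q)) (cost≡ _ _ (vertex-next p) (vertex-next q)))
            (stable (toℕ p) (toℕ q) p<q (Fin.toℕ<n q))

          costᶠ-sym : ∀ u v → costᶠ u v ≡ costᶠ v u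
          costᶠ-sym u v = cong₂ _*_ (wt-sym u v) (+-comm (degree u) (degree v))

          stable-≢ : ∀ p q → p ≢ q → Stableᶠ p q
          stable-≢ p q p≢q with Fin.<-cmp p q
          ... | tri< p<q _ _ = stable-< p q p<q
          ... | tri≈ _ p≡q _ = ⊥-elim (p≢q p≡q)
          ... | tri> _ _ q<p = subst₂ _≤_ (+-comm (costᶠ (vertex q) (vertex (next q))) _)
            (cong₂ _+_ (costᶠ-sym (vertex q) (vertex p)) (costᶠ-sym (vertex (next q)) (vertex (next p)))) (stable-< q p q<p)

          vertices : Vec (Fin n) n
          vertices = tabulate vertex

          lookup-vertices : ∀ p → lookup vertices p ≡ vertex p
          lookup-vertices = Vec.lookup∘tabulate vertex

        solve : Solution
        solve = record
          { execution = record
              { time = t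
              ; final = s
              ; run = derivation
              ; order = vertices
              ; distinct = Unique.tabulate⁺ vertex-injective
              ; output = λ i → trans (copied (toℕ i) (Fin.toℕ<n i))
                           (trans (sym (toℕ-vertex i)) (cong toℕ (sym (lookup-vertices i))))
              }
          ; stableᶠ = λ p q p≢q → subst₂ _≤_
              (cong₂ _+_ (cong₂ costᶠ (l p) (l (next p))) (cong₂ costᶠ (l q) (l (next q))))
              (cong₂ _+_ (cong₂ costᶠ (l p) (l q)) (cong₂ costᶠ (l (next p)) (l (next q))))
              (stable-≢ p q p≢q)
          ; fast = t≤
          }
          where
          l : ∀ p → vertex p ≡ lookup vertices p
          l p = sym (lookup-vertices p)

      afterCopy : (∃ λ σ → Runs copyOut (LocalOptimum.confˡ opt) (copyTime n) σ ×
                             (∀ a → a < n → Config.mem σ a ≡ walk m a)) → Solution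
      afterCopy (σ , runᶜ , copied) with runs-⨾ runᵢ (runs-⨾ runₛ runᶜ) (input I) blank∼input
      ... | t , s , derivation , t≤ , sim =
        AfterCopy.solve t s derivation t≤ (λ a a<n → trans (_∼_.same-mem sim a) (copied a a<n))

      solve : Solution
      solve = afterCopy (runs-copy n 0 t₇ t₈)
        where
        open LocalOptimum opt using (j; t₇; t₈; t₉; t₁₀; t₁₁; t₁₂; t₁₃; t₁₄)
        open CopyOut n W ok m inRange j t₉ t₁₀ t₁₁ t₁₂ t₁₃ t₁₄

    afterSearch : (∃ λ opt → Runs search (Initialised.conf init) (Budget.searchTime n) (LocalOptimum.confˡ opt)) → Solution
    afterSearch (opt , runₛ) = AfterSearch.solve opt runₛ

    solve : Solution
    solve = afterSearch (runs-search identityTour)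

  afterInit : (∃ λ init → Runs initialise blank (initTime n) (Initialised.conf init)) → Solution
  afterInit (init , runᵢ) = AfterInit.solve init runᵢ

  abstract
    -- Abstract, so that the analysis never unfolds the run of the machine.
    solution : Solution
    solution = afterInit runs-initialise

-- Finite sums, subgraphs and cycles

∑-mono : ∀ {n} {f g : Fin n → ℕ} → (∀ i → f i ≤ g i) → ∑ f ≤ ∑ g
∑-mono {zero}  _   = z≤n
∑-mono {suc n} f≤g = +-mono-≤ (f≤g zero) (∑-mono (f≤g ∘ suc))

∑-const : ∀ n c → ∑ {n} (λ _ → c) ≡ n * c
∑-const zero    c = refl
∑-const (suc n) c = cong (c +_) (∑-const n c)

𝟙 : ∀ {P : Set} → Dec P → ℕ
𝟙 (yes _) = 1
𝟙 (no _)  = 0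

𝟙-yes : ∀ {P : Set} (P? : Dec P) → P → 𝟙 P? ≡ 1
𝟙-yes (yes _) _ = refl
𝟙-yes (no ¬p) p = ⊥-elim (¬p p)

𝟙-no : ∀ {P : Set} (P? : Dec P) → ¬ P → 𝟙 P? ≡ 0
𝟙-no (yes p) ¬p = ⊥-elim (¬p p)
𝟙-no (no _)  _  = refl

𝟙-cong : ∀ {P Q : Set} (P? : Dec P) (Q? : Dec Q) → (P → Q) → (Q → P) → 𝟙 P? ≡ 𝟙 Q?
𝟙-cong P? (yes q) to from = 𝟙-yes P? (from q)
𝟙-cong P? (no ¬q) to from = 𝟙-no P? (¬q ∘ to)

𝟙≤1 : ∀ {P : Set} (P? : Dec P) → 𝟙 P? ≤ 1
𝟙≤1 (yes _) = ≤-refl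
𝟙≤1 (no _)  = z≤n

∑-point : ∀ {n} (i : Fin n) → ∑ (λ j → 𝟙 (i Fin.≟ j)) ≡ 1
∑-point {suc n} zero    = cong suc (trans (∑-const n 0) (*-zeroʳ n))
∑-point {suc n} (suc i) = trans (∑-cong (λ j → 𝟙-cong (suc i Fin.≟ suc j) (i Fin.≟ j) Fin.suc-injective (cong suc))) (∑-point i)

-- A missed value could be punched out of the codomain, leaving an injection of `Fin (suc n)` into
-- `Fin n`.
injective⇒surjective : ∀ {n} {f : Fin n → Fin n} → (∀ {x y} → f x ≡ f y → x ≡ y) → ∀ y → ∃ λ x → f x ≡ y
injective⇒surjective {suc n} {f} inj y with Fin.any? (λ x → f x Fin.≟ y)
... | yes found = found
... | no none = ⊥-elim (1+n≰n (Fin.injective⇒≤ {f = λ x → Fin.punchOut (λ e → none (x , sym e))}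
                  (λ {x} {x′} e → inj (Fin.punchOut-injective (λ e → none (x , sym e)) (λ e → none (x′ , sym e)) e))))

∑-injective : ∀ {n} (f : Fin n → ℕ) {g : Fin n → Fin n} → (∀ {x y} → g x ≡ g y → x ≡ y) → ∑ (f ∘ g) ≡ ∑ f
∑-injective f {g} inj = sym (sum-permute f (Perm.permutation g (λ y → proj₁ (surj y)) (λ y → proj₂ (surj y)) (λ x → inj (proj₂ (surj (g x))))))
  where surj = injective⇒surjective inj

module _ {A : Set} where

  ∑ˡ : (A → ℕ) → List A → ℕ
  ∑ˡ f xs = listSum (map f xs)

  ∑ˡ-cong : ∀ {f g : A → ℕ} xs → (∀ x → x ∈ xs → f x ≡ g x) → ∑ˡ f xs ≡ ∑ˡ g xs
  ∑ˡ-cong []       _ = refl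
  ∑ˡ-cong (x ∷ xs) h = cong₂ _+_ (h x (here refl)) (∑ˡ-cong xs (λ y y∈ → h y (there y∈)))

  ∑ˡ-mono : ∀ {f g : A → ℕ} xs → (∀ x → x ∈ xs → f x ≤ g x) → ∑ˡ f xs ≤ ∑ˡ g xs
  ∑ˡ-mono []       _ = z≤n
  ∑ˡ-mono (x ∷ xs) h = +-mono-≤ (h x (here refl)) (∑ˡ-mono xs (λ y y∈ → h y (there y∈)))

  ∑ˡ-const : ∀ c xs → ∑ˡ (λ _ → c) xs ≡ length xs * c
  ∑ˡ-const c []       = refl
  ∑ˡ-const c (x ∷ xs) = cong (c +_) (∑ˡ-const c xs)

  ∑ˡ-∑ : ∀ {n} (f : Fin n → A → ℕ) xs → ∑ˡ (λ x → ∑ (λ i → f i x)) xs ≡ ∑ (λ i → ∑ˡ (f i) xs)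
  ∑ˡ-∑ {n} f []       = sym (trans (∑-const n 0) (*-zeroʳ n))
  ∑ˡ-∑ f (x ∷ xs) = trans (cong (∑ (λ i → f i x) +_) (∑ˡ-∑ f xs)) (sym (∑-distrib-+ (λ i → f i x) (λ i → ∑ˡ (f i) xs)))

  ∑ˡ-* : ∀ c (f : A → ℕ) xs → ∑ˡ (λ x → c * f x) xs ≡ c * ∑ˡ f xs
  ∑ˡ-* c f []       = sym (*-zeroʳ c)
  ∑ˡ-* c f (x ∷ xs) = trans (cong (c * f x +_) (∑ˡ-* c f xs)) (sym (*-distribˡ-+ c (f x) _))

  ∑ˡ-filter : ∀ {P : A → Set} (P? : Decidable P) (f : A → ℕ) xs → ∑ˡ f (filter P? xs) ≡ ∑ˡ (λ x → 𝟙 (P? x) * f x) xs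
  ∑ˡ-filter P? f []       = refl
  ∑ˡ-filter P? f (x ∷ xs) with P? x
  ... | yes _ = cong₂ _+_ (sym (+-identityʳ (f x))) (∑ˡ-filter P? f xs)
  ... | no _  = ∑ˡ-filter P? f xs

  length-filter : ∀ {P : A → Set} (P? : Decidable P) xs → length (filter P? xs) ≡ ∑ˡ (λ x → 𝟙 (P? x)) xs
  length-filter P? []       = refl
  length-filter P? (x ∷ xs) with P? x
  ... | yes _ = cong suc (length-filter P? xs)
  ... | no _  = length-filter P? xs

  ∑ˡ-mapMaybe : ∀ {B : Set} (g : B → Maybe A) (f : A → ℕ) xs → ∑ˡ f (mapMaybe g xs) ≡ listSum (map (λ x → maybe′ f 0 (g x)) xs)
  ∑ˡ-mapMaybe g f []       = refl
  ∑ˡ-mapMaybe g f (x ∷ xs) with g x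
  ... | just y  = cong (f y +_) (∑ˡ-mapMaybe g f xs)
  ... | nothing = ∑ˡ-mapMaybe g f xs

  ∈-mapMaybe : ∀ {B : Set} (g : B → Maybe A) {x y} xs → x ∈ xs → g x ≡ just y → y ∈ mapMaybe g xs
  ∈-mapMaybe g (x ∷ xs) (here refl) eq with g x
  ∈-mapMaybe g (x ∷ xs) (here refl) refl | just _ = here refl
  ∈-mapMaybe g (x ∷ xs) (there x∈) eq with g x
  ... | just _  = there (∈-mapMaybe g xs x∈ eq)
  ... | nothing = ∈-mapMaybe g xs x∈ eq

  -- As `xs` is free of repetitions, so is `map φ xs`; having the same members, the two are
  -- permutations of each other. The conditions on `φ` are limited to members of `xs`, since
  -- relabelling is shown to be an involution only on Hamilton cycles.
  ∑ˡ-involution : ∀ (φ : A → A) (f : A → ℕ) xs → ListUnique.Unique xs →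
                  (∀ x → x ∈ xs → φ x ∈ xs) → (∀ x → x ∈ xs → φ (φ x) ≡ x) →
                  ∑ˡ (f ∘ φ) xs ≡ ∑ˡ f xs
  ∑ˡ-involution φ f xs xs! closed invol = trans (cong listSum (List.map-∘ {g = f} {f = φ} xs))
    (sum-↭ (↭.map⁺ f (∼bag⇒↭ (unique∧set⇒bag (φ-unique xs xs! (λ _ → id)) xs! (mk⇔ to from)))))
    where
    φ-injective : ∀ {x y} → x ∈ xs → y ∈ xs → φ x ≡ φ y → x ≡ y
    φ-injective x∈ y∈ e = trans (sym (invol _ x∈)) (trans (cong φ e) (invol _ y∈))
    φ-unique : ∀ ys → ListUnique.Unique ys → (∀ y → y ∈ ys → y ∈ xs) → ListUnique.Unique (map φ ys)
    φ-unique []       _          _  = []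
    φ-unique (y ∷ ys) (y∉ ∷ ys!) ys⊆ = All.tabulate fresh ∷ φ-unique ys ys! (λ z z∈ → ys⊆ z (there z∈))
      where
      fresh : ∀ {z} → z ∈ map φ ys → φ y ≢ z
      fresh z∈ e with ∈.∈-map⁻ φ z∈
      ... | z′ , z′∈ , refl = All.lookup y∉ z′∈ (φ-injective (ys⊆ y (here refl)) (ys⊆ z′ (there z′∈)) e)
    to : ∀ {z} → z ∈ map φ xs → z ∈ xs
    to z∈ with ∈.∈-map⁻ φ z∈
    ... | x , x∈ , refl = closed x x∈
    from : ∀ {z} → z ∈ xs → z ∈ map φ xs
    from {z} z∈ = subst (_∈ map φ xs) (invol z z∈) (∈.∈-map⁺ φ (closed z z∈))

∑ˡ-allFin : ∀ {n} (f : Fin n → ℕ) → ∑ˡ f (allFin n) ≡ ∑ f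
∑ˡ-allFin f = trans (cong listSum (List.map-tabulate id f)) (go f)
  where
  go : ∀ {n} (f : Fin n → ℕ) → listSum (List.tabulate f) ≡ ∑ f
  go {zero}  f = refl
  go {suc n} f = cong (f zero +_) (go (f ∘ suc))

∑ˡ-cartesianProduct : ∀ {A B : Set} (f : A × B → ℕ) xs ys →
                      ∑ˡ f (cartesianProduct xs ys) ≡ ∑ˡ (λ x → ∑ˡ (λ y → f (x , y)) ys) xs
∑ˡ-cartesianProduct f []       ys = refl
∑ˡ-cartesianProduct f (x ∷ xs) ys = begin
  listSum (map f (map (x ,_) ys ++ cartesianProduct xs ys))
    ≡⟨ cong listSum (List.map-++ f (map (x ,_) ys) _) ⟩
  listSum (map f (map (x ,_) ys) ++ map f (cartesianProduct xs ys))
    ≡⟨ sum-++ (map f (map (x ,_) ys)) _ ⟩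
  listSum (map f (map (x ,_) ys)) + ∑ˡ f (cartesianProduct xs ys)
    ≡⟨ cong₂ _+_ (cong listSum (sym (List.map-∘ ys))) (∑ˡ-cartesianProduct f xs ys) ⟩
  ∑ˡ (λ y → f (x , y)) ys + ∑ˡ (λ x → ∑ˡ (λ y → f (x , y)) ys) xs ∎
  where open ≡-Reasoning

-- The map from pairs to edges is local to the definition of `edges`;
-- unification recovers it.
private
  edges-mapMaybe : ∀ n → Σ (Fin n × Fin n → Maybe (Edge n)) λ g → edges n ≡ mapMaybe g (cartesianProduct (allFin n) (allFin n))
  edges-mapMaybe n = _ , refl

  toEdge : ∀ n → Fin n × Fin n → Maybe (Edge n)
  toEdge n = proj₁ (edges-mapMaybe n)

  upper : ∀ {n} → (Edge n → ℕ) → Fin n → Fin n → ℕ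
  upper {n} f u v = maybe′ f 0 (toEdge n (u , v))

  toEdge-just : ∀ {n} (u v : Fin n) (u<v : u Fin.< v) → toEdge n (u , v) ≡ just (edge u v u<v)
  toEdge-just u v u<v with u Fin.<? v
  ... | yes _  = refl
  ... | no u≮v = ⊥-elim (u≮v u<v)

  toEdge-nothing : ∀ {n} (u v : Fin n) → ¬ u Fin.< v → toEdge n (u , v) ≡ nothing
  toEdge-nothing u v u≮v with u Fin.<? v
  ... | yes u<v = ⊥-elim (u≮v u<v)
  ... | no _    = refl

∑ˡ-edges : ∀ {n} (f : Edge n → ℕ) → ∑ˡ f (edges n) ≡ ∑ (λ u → ∑ (λ v → upper f u v))
∑ˡ-edges {n} f = begin
  ∑ˡ f (edges n)                                                ≡⟨ ∑ˡ-mapMaybe (toEdge n) f (cartesianProduct (allFin n) (allFin n)) ⟩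
  ∑ˡ (λ (u , v) → upper f u v) (cartesianProduct (allFin n) (allFin n)) ≡⟨ ∑ˡ-cartesianProduct _ (allFin n) (allFin n) ⟩
  ∑ˡ (λ u → ∑ˡ (upper f u) (allFin n)) (allFin n)               ≡⟨ ∑ˡ-allFin (λ u → ∑ˡ (upper f u) (allFin n)) ⟩
  ∑ (λ u → ∑ˡ (upper f u) (allFin n))                           ≡⟨ ∑-cong (λ u → ∑ˡ-allFin (upper f u)) ⟩
  ∑ (λ u → ∑ (λ v → upper f u v))                               ∎
  where open ≡-Reasoning

∈-edges : ∀ {n} (e : Edge n) → e ∈ edges n
∈-edges {n} (edge u v u<v) = ∈-mapMaybe (toEdge n) (cartesianProduct (allFin n) (allFin n))
  (∈.∈-cartesianProduct⁺ (∈.∈-allFin u) (∈.∈-allFin v)) (toEdge-just u v (recompute (u Fin.<? v) u<v))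

-- A function on edges as a symmetric matrix with zero diagonal. Sums over vertices then need no
-- orientation of the edges; the price is the factor 2 in `∑∑-symmetric`.
symmetric : ∀ {n} → (Edge n → ℕ) → Fin n → Fin n → ℕ
symmetric f u v with Fin.<-cmp u v
... | tri< u<v _ _ = f (edge u v u<v)
... | tri≈ _ _ _   = 0
... | tri> _ _ v<u = f (edge v u v<u)

symmetric-upper : ∀ {n} (f : Edge n → ℕ) u v → symmetric f u v ≡ upper f u v + upper f v u
symmetric-upper f u v with Fin.<-cmp u v
... | tri< u<v _ v≮u rewrite toEdge-just u v u<v | toEdge-nothing v u v≮u = sym (+-identityʳ _)
... | tri≈ u≮v _ v≮u rewrite toEdge-nothing u v u≮v | toEdge-nothing v u v≮u = refl
... | tri> u≮v _ v<u rewrite toEdge-nothing u v u≮v | toEdge-just v u v<u = refl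

symmetric-sym : ∀ {n} (f : Edge n → ℕ) u v → symmetric f u v ≡ symmetric f v u
symmetric-sym f u v = trans (symmetric-upper f u v) (trans (+-comm (upper f u v) _) (sym (symmetric-upper f v u)))

symmetric-diagonal : ∀ {n} (f : Edge n → ℕ) u → symmetric f u u ≡ 0
symmetric-diagonal f u with Fin.<-cmp u u
... | tri< _ ¬e _ = ⊥-elim (¬e refl)
... | tri≈ _ _ _  = refl
... | tri> _ ¬e _ = ⊥-elim (¬e refl)

symmetric-* : ∀ {n} (f g : Edge n → ℕ) u v → symmetric (λ e → f e * g e) u v ≡ symmetric f u v * symmetric g u v
symmetric-* f g u v with Fin.<-cmp u v
... | tri< _ _ _ = refl
... | tri≈ _ _ _ = refl
... | tri> _ _ _ = refl

symmetric-cong : ∀ {n} {f g : Edge n → ℕ} → (∀ e → f e ≡ g e) → ∀ u v → symmetric f u v ≡ symmetric g u v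
symmetric-cong h u v with Fin.<-cmp u v
... | tri< _ _ _ = h _
... | tri≈ _ _ _ = refl
... | tri> _ _ _ = h _

symmetric-weight : ∀ I u v → symmetric (λ e → toℕ (w I e)) u v ≡ weightMatrix I u v
symmetric-weight I u v with Fin.<-cmp u v
... | tri< _ _ _ = refl
... | tri≈ _ _ _ = refl
... | tri> _ _ _ = refl

∑∑-symmetric : ∀ {n} (f : Edge n → ℕ) → ∑ (λ u → ∑ (λ v → symmetric f u v)) ≡ ∑ˡ f (edges n) + ∑ˡ f (edges n)
∑∑-symmetric {n} f = begin
  ∑ (λ u → ∑ (λ v → symmetric f u v))
    ≡⟨ ∑-cong (λ u → trans (∑-cong (symmetric-upper f u)) (∑-distrib-+ (upper f u) (λ v → upper f v u))) ⟩
  ∑ (λ u → ∑ (λ v → upper f u v) + ∑ (λ v → upper f v u))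
    ≡⟨ ∑-distrib-+ (λ u → ∑ (upper f u)) (λ u → ∑ (λ v → upper f v u)) ⟩
  ∑ (λ u → ∑ (λ v → upper f u v)) + ∑ (λ u → ∑ (λ v → upper f v u))
    ≡⟨ cong (∑ (λ u → ∑ (upper f u)) +_) (∑-comm (λ u v → upper f v u)) ⟩
  ∑ (λ u → ∑ (λ v → upper f u v)) + ∑ (λ u → ∑ (λ v → upper f u v))
    ≡⟨ cong₂ _+_ (sym (∑ˡ-edges f)) (sym (∑ˡ-edges f)) ⟩
  ∑ˡ f (edges n) + ∑ˡ f (edges n) ∎
  where open ≡-Reasoning

module _ {n : ℕ} where

  open DecMembership (_≟ᴱ_ {n}) using (_∈?_)

  adjacency : Subgraph n → Fin n → Fin n → ℕ
  adjacency G = symmetric (λ e → 𝟙 (e ∈? G))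

  adjacency-filter : ∀ {P : Edge n → Set} (P? : Decidable P) u v →
                     adjacency (filter P? (edges n)) u v ≡ symmetric (λ e → 𝟙 (P? e)) u v
  adjacency-filter P? = symmetric-cong (λ e → 𝟙-cong (e ∈? filter P? (edges n)) (P? e)
    (λ e∈ → proj₂ (∈.∈-filter⁻ P? {xs = edges n} e∈)) (λ p → ∈.∈-filter⁺ P? (∈-edges e) p))

twice-weight : ∀ I {P : Edge (size I) → Set} (P? : Decidable P) → let G = filter P? (edges (size I)) in
               weight I G + weight I G ≡ ∑ (λ u → ∑ (λ v → adjacency G u v * weightMatrix I u v))
twice-weight I P? = sym (begin
  ∑ (λ u → ∑ (λ v → adjacency G u v * weightMatrix I u v))
    ≡⟨ ∑-cong (λ u → ∑-cong (λ v → trans (cong₂ _*_ (adjacency-filter P? u v) (sym (symmetric-weight I u v)))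
         (sym (symmetric-* (λ e → 𝟙 (P? e)) (λ e → toℕ (w I e)) u v)))) ⟩
  ∑ (λ u → ∑ (λ v → symmetric (λ e → 𝟙 (P? e) * toℕ (w I e)) u v))
    ≡⟨ ∑∑-symmetric (λ e → 𝟙 (P? e) * toℕ (w I e)) ⟩
  ∑ˡ (λ e → 𝟙 (P? e) * toℕ (w I e)) (edges (size I)) + ∑ˡ (λ e → 𝟙 (P? e) * toℕ (w I e)) (edges (size I))
    ≡⟨ cong₂ _+_ (sym (∑ˡ-filter P? (λ e → toℕ (w I e)) (edges (size I)))) (sym (∑ˡ-filter P? (λ e → toℕ (w I e)) (edges (size I)))) ⟩
  weight I G + weight I G ∎)
  where
  open ≡-Reasoning
  G = filter P? (edges (size I))

∑-degree : ∀ I → ∑ (Weighted.degree I) ≡ weight I (edges (size I)) + weight I (edges (size I))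
∑-degree I = trans (∑-cong (λ u → ∑-cong (λ v → sym (symmetric-weight I u v)))) (∑∑-symmetric (λ e → toℕ (w I e)))

-- The cycle traced by a vertex order

Follows : ∀ {n} → Vec (Fin n) n → Fin n → Fin n → Set
Follows {n} σ u v = ∃ λ p → lookup σ p ≡ u × lookup σ (next p) ≡ v

module _ {A : Set} where

  lookup-∷ʳ-init : ∀ {m} (xs : Vec A m) x p q → toℕ p ≡ toℕ q → lookup (xs Vec.∷ʳ x) p ≡ lookup xs q
  lookup-∷ʳ-init (y ∷ xs) x zero    zero    _ = refl
  lookup-∷ʳ-init (y ∷ xs) x (suc p) (suc q) e = lookup-∷ʳ-init xs x p q (suc-injective e)

  lookup-∷ʳ-last : ∀ {m} (xs : Vec A m) x p → toℕ p ≡ m → lookup (xs Vec.∷ʳ x) p ≡ x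
  lookup-∷ʳ-last []       x zero    _ = refl
  lookup-∷ʳ-last (y ∷ xs) x (suc p) e = lookup-∷ʳ-last xs x p (suc-injective e)

  -- Moving the head to the end shifts the other entries by one position, and the head lands at the
  -- last position, where `next` wraps around to 0.
  lookup-next : ∀ {m} x (xs : Vec A m) p → lookup (xs Vec.∷ʳ x) p ≡ lookup (x ∷ xs) (next p)
  lookup-next {m} x xs p with next p | toℕ-next p
  ... | zero  | inj₂ (p+1≡ , _) = lookup-∷ʳ-last xs x p (suc-injective p+1≡)
  ... | suc q | inj₁ (_ , e)    = lookup-∷ʳ-init xs x p q (sym (suc-injective e))

  ∈-zip⁻ : ∀ {k} (ys zs : Vec A k) {a b} → (a , b) ∈ zip (toList ys) (toList zs) → ∃ λ p → lookup ys p ≡ a × lookup zs p ≡ b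
  ∈-zip⁻ (y ∷ ys) (z ∷ zs) (here refl) = zero , refl , refl
  ∈-zip⁻ (y ∷ ys) (z ∷ zs) (there h) with ∈-zip⁻ ys zs h
  ... | p , e , e′ = suc p , e , e′

  ∈-zip⁺ : ∀ {k} (ys zs : Vec A k) p → (lookup ys p , lookup zs p) ∈ zip (toList ys) (toList zs)
  ∈-zip⁺ (y ∷ ys) (z ∷ zs) zero    = here refl
  ∈-zip⁺ (y ∷ ys) (z ∷ zs) (suc p) = there (∈-zip⁺ ys zs p)

steps⇔Follows : ∀ {m} (x : Fin (suc m)) xs {u v} →
  ((u , v) ∈ zip (x ∷ toList xs) (toList xs List.∷ʳ x) → Follows (x ∷ xs) u v) ×
  (Follows (x ∷ xs) u v → (u , v) ∈ zip (x ∷ toList xs) (toList xs List.∷ʳ x))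
steps⇔Follows x xs rewrite sym (Vec.toList-∷ʳ x xs) = to , from
  where
  to : ∀ {u v} → (u , v) ∈ zip (toList (x ∷ xs)) (toList (xs Vec.∷ʳ x)) → Follows (x ∷ xs) u v
  to h with ∈-zip⁻ (x ∷ xs) (xs Vec.∷ʳ x) h
  ... | p , e , e′ = p , e , trans (sym (lookup-next x xs p)) e′
  from : ∀ {u v} → Follows (x ∷ xs) u v → (u , v) ∈ zip (toList (x ∷ xs)) (toList (xs Vec.∷ʳ x))
  from (p , refl , refl) = subst (λ z → (lookup (x ∷ xs) p , z) ∈ zip (toList (x ∷ xs)) (toList (xs Vec.∷ʳ x)))
    (lookup-next x xs p) (∈-zip⁺ (x ∷ xs) (xs Vec.∷ʳ x) p)

-- The predicate filtering the edges is local to `cycleGraph`, hence existential here.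
record CycleSpec {n} (σ : Vec (Fin n) n) : Set₁ where
  field
    OnCycle   : Edge n → Set
    onCycle?  : Decidable OnCycle
    isFilter  : cycleGraph σ ≡ filter onCycle? (edges n)
    to        : ∀ e → OnCycle e → Follows σ (lo e) (hi e) ⊎ Follows σ (hi e) (lo e)
    from      : ∀ e → Follows σ (lo e) (hi e) ⊎ Follows σ (hi e) (lo e) → OnCycle e

cycleSpec : ∀ {n} (σ : Vec (Fin n) n) → CycleSpec σ
cycleSpec [] = record
  { OnCycle = λ _ → ⊤ ; onCycle? = λ _ → yes tt ; isFilter = refl
  ; to = λ { (edge () _ _) _ } ; from = λ { (edge () _ _) _ } }
cycleSpec (x ∷ xs) = record
  { OnCycle = _ ; onCycle? = _ ; isFilter = refl
  ; to = λ { e (inj₁ h) → inj₁ (proj₁ (steps⇔Follows x xs) h) ; e (inj₂ h) → inj₂ (proj₁ (steps⇔Follows x xs) h) }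
  ; from = λ { e (inj₁ h) → inj₁ (proj₂ (steps⇔Follows x xs) h) ; e (inj₂ h) → inj₂ (proj₂ (steps⇔Follows x xs) h) } }

-- Hamilton cycles through an edge

next-injective : ∀ {n} {p q : Fin n} → next p ≡ next q → p ≡ q
next-injective {n} {p} {q} e with toℕ-next p | toℕ-next q
... | inj₁ (_ , ep) | inj₁ (_ , eq) = Fin.toℕ-injective (suc-injective (trans (sym ep) (trans (cong toℕ e) eq)))
... | inj₂ (ep , _) | inj₂ (eq , _) = Fin.toℕ-injective (suc-injective (trans ep (sym eq)))
... | inj₁ (_ , ep) | inj₂ (_ , eq) = ⊥-elim (1+n≢0 (trans (sym ep) (trans (cong toℕ e) eq)))
... | inj₂ (_ , ep) | inj₁ (_ , eq) = ⊥-elim (1+n≢0 (trans (sym eq) (trans (cong toℕ (sym e)) ep)))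

next-≢ : ∀ {n} → 3 ≤ n → (p : Fin n) → next p ≢ p
next-≢ 3≤n p e with toℕ-next p
... | inj₁ (_ , ep)  = 1+n≢n (trans (sym ep) (cong toℕ e))
... | inj₂ (ep , ep′) with trans (sym ep) (cong suc (trans (cong toℕ (sym e)) ep′))
... | refl = 1+n≰n {1} (≤-trans (s≤s (s≤s z≤n)) 3≤n)

next²-≢ : ∀ {n} → 3 ≤ n → (p : Fin n) → next (next p) ≢ p
next²-≢ {n} 3≤n p e with toℕ-next p | toℕ-next (next p)
... | inj₁ (_ , ep) | inj₁ (_ , eq) = <⇒≢ (s≤s (n≤1+n (toℕ p))) (trans (cong toℕ (sym e)) (trans eq (cong suc ep)))
... | inj₁ (_ , ep) | inj₂ (n≡ , eq) = 1+n≰n {2} (≤-trans 3≤n (≤-reflexive (trans (sym n≡) (cong suc (trans ep (cong suc (trans (cong toℕ (sym e)) eq)))))))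
... | inj₂ (n≡ , ep) | inj₁ (_ , eq) = 1+n≰n {2} (≤-trans 3≤n (≤-reflexive (trans (sym n≡) (cong suc (trans (cong toℕ (sym e)) (trans eq (cong suc ep)))))))
... | inj₂ (n≡ , ep) | inj₂ (n≡′ , eq) = 1+n≰n {1} (≤-trans (≤-trans (s≤s (s≤s z≤n)) 3≤n) (≤-reflexive (trans (sym n≡′) (cong suc ep))))

𝟙-⊎ : ∀ {P Q R : Set} (P? : Dec P) (Q? : Dec Q) (R? : Dec R) → (R → P ⊎ Q) → (P → R) → (Q → R) → ¬ (P × Q) →
      𝟙 R? ≡ 𝟙 P? + 𝟙 Q?
𝟙-⊎ (yes p) (yes q) _ _ _ _ ¬pq = ⊥-elim (¬pq (p , q))
𝟙-⊎ (yes p) (no _) R? _ p⇒r _ _ = 𝟙-yes R? (p⇒r p)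
𝟙-⊎ (no _) (yes q) R? _ _ q⇒r _ = 𝟙-yes R? (q⇒r q)
𝟙-⊎ (no ¬p) (no ¬q) R? r⇒ _ _ _ = 𝟙-no R? (λ r → [ ¬p , ¬q ]′ (r⇒ r))

module Cycle {n} (3≤n : 3 ≤ n) (σ : Vec (Fin n) n) (σ! : Unique σ) where

  open CycleSpec (cycleSpec σ)

  private
    σ-injective : ∀ {p q} → lookup σ p ≡ lookup σ q → p ≡ q
    σ-injective = Unique.lookup-injective σ! _ _

    position : ∀ u → ∃ λ p → lookup σ p ≡ u
    position = injective⇒surjective σ-injective

  successor : Fin n → Fin n
  successor u = lookup σ (next (proj₁ (position u)))

  successor-lookup : ∀ p → successor (lookup σ p) ≡ lookup σ (next p)
  successor-lookup p = cong (lookup σ ∘ next) (σ-injective (proj₂ (position (lookup σ p))))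

  follows⇒successor : ∀ {u v} → Follows σ u v → successor u ≡ v
  follows⇒successor (p , refl , refl) = successor-lookup p

  successor⇒follows : ∀ {u v} → successor u ≡ v → Follows σ u v
  successor⇒follows {u} e = proj₁ (position u) , proj₂ (position u) , e

  successor-injective : ∀ {u v} → successor u ≡ successor v → u ≡ v
  successor-injective {u} {v} e = trans (sym (proj₂ (position u)))
    (trans (cong (lookup σ) (next-injective (σ-injective e))) (proj₂ (position v)))

  successor-≢ : ∀ u → successor u ≢ u
  successor-≢ u e = next-≢ 3≤n (proj₁ (position u)) (σ-injective (trans e (sym (proj₂ (position u)))))

  -- Here 3 ≤ n matters: with two vertices an edge would be followed in both directions, and the two
  -- indicators in `onCycle` would overlap.
  successor²-≢ : ∀ u → successor (successor u) ≢ u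
  successor²-≢ u e = next²-≢ 3≤n (proj₁ (position u))
    (σ-injective (trans (sym (successor-lookup (next (proj₁ (position u))))) (trans e (sym (proj₂ (position u))))))

  private
    onCycle : ∀ e → 𝟙 (onCycle? e) ≡ 𝟙 (successor (lo e) Fin.≟ hi e) + 𝟙 (successor (hi e) Fin.≟ lo e)
    onCycle e = 𝟙-⊎ (successor (lo e) Fin.≟ hi e) (successor (hi e) Fin.≟ lo e) (onCycle? e) split
      (λ p → from e (inj₁ (successor⇒follows p))) (λ q → from e (inj₂ (successor⇒follows q)))
      (λ (p , q) → successor²-≢ (lo e) (trans (cong successor p) q))
      where
      split : OnCycle e → successor (lo e) ≡ hi e ⊎ successor (hi e) ≡ lo e
      split h with to e h
      ... | inj₁ f = inj₁ (follows⇒successor f)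
      ... | inj₂ f = inj₂ (follows⇒successor f)

    matrix : ∀ u v → symmetric (λ e → 𝟙 (onCycle? e)) u v ≡ 𝟙 (successor u Fin.≟ v) + 𝟙 (successor v Fin.≟ u)
    matrix u v with Fin.<-cmp u v
    ... | tri< u<v _ _  = onCycle (edge u v u<v)
    ... | tri≈ _ refl _ = sym (cong₂ _+_ (𝟙-no (successor u Fin.≟ u) (successor-≢ u)) (𝟙-no (successor u Fin.≟ u) (successor-≢ u)))
    ... | tri> _ _ v<u  = trans (onCycle (edge v u v<u)) (+-comm (𝟙 (successor v Fin.≟ u)) _)

  adjacency-cycle : ∀ u v → adjacency (cycleGraph σ) u v ≡ 𝟙 (successor u Fin.≟ v) + 𝟙 (successor v Fin.≟ u)
  adjacency-cycle u v = trans (cong (λ G → adjacency G u v) isFilter) (trans (adjacency-filter onCycle? u v) (matrix u v))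

  -- The neighbours of u are its successor and its predecessor; the sum for the latter is reindexed
  -- along the injective `successor`.
  ∑-adjacency : ∀ u → ∑ (adjacency (cycleGraph σ) u) ≡ 2
  ∑-adjacency u = begin
    ∑ (adjacency (cycleGraph σ) u)
      ≡⟨ ∑-cong (adjacency-cycle u) ⟩
    ∑ (λ v → 𝟙 (successor u Fin.≟ v) + 𝟙 (successor v Fin.≟ u))
      ≡⟨ ∑-distrib-+ (λ v → 𝟙 (successor u Fin.≟ v)) (λ v → 𝟙 (successor v Fin.≟ u)) ⟩
    ∑ (λ v → 𝟙 (successor u Fin.≟ v)) + ∑ (λ v → 𝟙 (successor v Fin.≟ u))
      ≡⟨ cong₂ _+_ (∑-point (successor u)) (∑-cong (λ v → 𝟙-cong (successor v Fin.≟ u) (u Fin.≟ successor v) sym sym)) ⟩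
    1 + ∑ (λ v → 𝟙 (u Fin.≟ successor v))
      ≡⟨ cong (1 +_) (trans (∑-injective (λ v → 𝟙 (u Fin.≟ v)) successor-injective) (∑-point u)) ⟩
    2 ∎
    where open ≡-Reasoning

  adjacent⇒follows : ∀ u v → adjacency (cycleGraph σ) u v ≡ 1 → Follows σ u v ⊎ Follows σ v u
  adjacent⇒follows u v e with successor u Fin.≟ v | successor v Fin.≟ u | trans (sym (adjacency-cycle u v)) e
  ... | yes p | _     | _ = inj₁ (successor⇒follows p)
  ... | no _  | yes q | _ = inj₂ (successor⇒follows q)

  follows⇒adjacent : ∀ u v → Follows σ u v ⊎ Follows σ v u → adjacency (cycleGraph σ) u v ≡ 1
  follows⇒adjacent u v (inj₁ f) = trans (adjacency-cycle u v) (cong₂ _+_ (𝟙-yes (successor u Fin.≟ v) e)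
    (𝟙-no (successor v Fin.≟ u) λ e′ → successor²-≢ u (trans (cong successor e) e′)))
    where e = follows⇒successor f
  follows⇒adjacent u v (inj₂ f) = trans (adjacency-cycle u v) (cong₂ _+_
    (𝟙-no (successor u Fin.≟ v) λ e′ → successor²-≢ v (trans (cong successor e) e′)) (𝟙-yes (successor v Fin.≟ u) e))
    where e = follows⇒successor f

-- Relabelling the vertices of a graph

adjacency≤1 : ∀ {n} (G : Subgraph n) u v → adjacency G u v ≤ 1
adjacency≤1 G u v with Fin.<-cmp u v
... | tri< _ _ _ = 𝟙≤1 _
... | tri≈ _ _ _ = z≤n
... | tri> _ _ _ = 𝟙≤1 _

𝟙-≟1 : ∀ {a} → a ≤ 1 → 𝟙 (a ≟ 1) ≡ a
𝟙-≟1 {zero}        _ = refl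
𝟙-≟1 {suc zero}    _ = refl
𝟙-≟1 {suc (suc a)} (s≤s ())

module _ {n} (π : Fin n → Fin n) where

  -- Filtering `edges n` puts the result into canonical order, so that relabelled cycles can be
  -- compared by `_≡_`. This is the pull-back of `G` along `π`; for an involution it is also the
  -- image.
  relabel : Subgraph n → Subgraph n
  relabel G = filter (λ e → adjacency G (π (lo e)) (π (hi e)) ≟ 1) (edges n)

  adjacency-relabel : ∀ G u v → u ≢ v → adjacency (relabel G) u v ≡ adjacency G (π u) (π v)
  adjacency-relabel G u v u≢v = trans (adjacency-filter (λ e → adjacency G (π (lo e)) (π (hi e)) ≟ 1) u v) cases
    where
    cases : symmetric (λ e → 𝟙 (adjacency G (π (lo e)) (π (hi e)) ≟ 1)) u v ≡ adjacency G (π u) (π v)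
    cases with Fin.<-cmp u v
    ... | tri< _ _ _ = 𝟙-≟1 (adjacency≤1 G (π u) (π v))
    ... | tri≈ _ e _ = ⊥-elim (u≢v e)
    ... | tri> _ _ _ = trans (𝟙-≟1 (adjacency≤1 G (π v) (π u))) (symmetric-sym _ (π v) (π u))

  module _ (π-involutive : ∀ u → π (π u) ≡ u) where

    private
      π-injective : ∀ {u v} → π u ≡ π v → u ≡ v
      π-injective {u} {v} e = trans (sym (π-involutive u)) (trans (cong π e) (π-involutive v))

    follows-map⁺ : ∀ (σ : Vec (Fin n) n) {u v} → Follows σ (π u) (π v) → Follows (Vec.map π σ) u v
    follows-map⁺ σ {u} {v} (p , e , e′) = p
      , trans (Vec.lookup-map p π σ) (trans (cong π e) (π-involutive u))
      , trans (Vec.lookup-map (next p) π σ) (trans (cong π e′) (π-involutive v))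

    follows-map⁻ : ∀ (σ : Vec (Fin n) n) {u v} → Follows (Vec.map π σ) u v → Follows σ (π u) (π v)
    follows-map⁻ σ {u} {v} (p , e , e′) = p
      , trans (sym (π-involutive _)) (cong π (trans (sym (Vec.lookup-map p π σ)) e))
      , trans (sym (π-involutive _)) (cong π (trans (sym (Vec.lookup-map (next p) π σ)) e′))

    map-unique : ∀ {σ : Vec (Fin n) n} → Unique σ → Unique (Vec.map π σ)
    map-unique = Unique.map⁺ π-injective

    -- As `π` is its own inverse, u and v are consecutive in `map π σ` exactly when π u and π v are
    -- consecutive in `σ`.
    relabel-cycle : 3 ≤ n → ∀ (σ : Vec (Fin n) n) → Unique σ → relabel (cycleGraph σ) ≡ cycleGraph (Vec.map π σ)
    relabel-cycle 3≤n σ σ! = trans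
      (List.filter-≐ (λ e → adjacency (cycleGraph σ) (π (lo e)) (π (hi e)) ≟ 1) onCycle? ((λ {e} → forth e) , (λ {e} → back e)) (edges n))
      (sym isFilter)
      where
      open CycleSpec (cycleSpec (Vec.map π σ))
      open Cycle 3≤n σ σ!
      forth : ∀ e → adjacency (cycleGraph σ) (π (lo e)) (π (hi e)) ≡ 1 → OnCycle e
      forth e a≡1 with adjacent⇒follows (π (lo e)) (π (hi e)) a≡1
      ... | inj₁ f = from e (inj₁ (follows-map⁺ σ f))
      ... | inj₂ f = from e (inj₂ (follows-map⁺ σ f))
      back : ∀ e → OnCycle e → adjacency (cycleGraph σ) (π (lo e)) (π (hi e)) ≡ 1
      back e h with to e h
      ... | inj₁ f = follows⇒adjacent _ _ (inj₁ (follows-map⁻ σ f))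
      ... | inj₂ f = follows⇒adjacent _ _ (inj₂ (follows-map⁻ σ f))

∈-allVecs : ∀ {A : Set} {xs : List A} → (∀ x → x ∈ xs) → ∀ {k} (v : Vec A k) → v ∈ allVecs xs k
∈-allVecs all []      = here refl
∈-allVecs all (x ∷ v) = ∈.∈-cartesianProductWith⁺ _∷_ (all x) (∈-allVecs all v)

module _ {n : ℕ} where

  ∈-hamiltonCycles⁺ : ∀ (σ : Vec (Fin n) n) → Unique σ → cycleGraph σ ∈ hamiltonCycles n
  ∈-hamiltonCycles⁺ σ σ! = ∈.∈-deduplicate⁺ _≟ᴳ_ (∈.∈-map⁺ cycleGraph
    (∈.∈-filter⁺ (allPairs? (λ u v → ¬? (u Fin.≟ v))) (∈-allVecs ∈.∈-allFin σ) σ!))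

  ∈-hamiltonCycles⁻ : ∀ {H} → H ∈ hamiltonCycles n → ∃ λ (σ : Vec (Fin n) n) → Unique σ × H ≡ cycleGraph σ
  ∈-hamiltonCycles⁻ {H} H∈ with ∈.∈-map⁻ cycleGraph (∈.∈-deduplicate⁻ _≟ᴳ_ (map cycleGraph (vertexOrders n)) H∈)
  ... | σ , σ∈ , H≡ = σ , proj₂ (∈.∈-filter⁻ (allPairs? (λ u v → ¬? (u Fin.≟ v))) {xs = allVecs (allFin n) n} σ∈) , H≡

  hamiltonCycles-unique : ListUnique.Unique (hamiltonCycles n)
  hamiltonCycles-unique = DecUnique.deduplicate-! _≟ᴳ_ (map cycleGraph (vertexOrders n))

swap : ∀ {n} → Fin n → Fin n → Fin n → Fin n
swap i j k with k Fin.≟ i | k Fin.≟ j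
... | yes _ | _     = j
... | no _  | yes _ = i
... | no _  | no _  = k

swap-fst : ∀ {n} (i j : Fin n) → swap i j i ≡ j
swap-fst i j with i Fin.≟ i | i Fin.≟ j
... | yes _  | _ = refl
... | no i≢i | _ = ⊥-elim (i≢i refl)

swap-snd : ∀ {n} (i j : Fin n) → swap i j j ≡ i
swap-snd i j with j Fin.≟ i | j Fin.≟ j
... | yes e | _      = e
... | no _  | yes _  = refl
... | no _  | no j≢j = ⊥-elim (j≢j refl)

swap-other : ∀ {n} {i j k : Fin n} → k ≢ i → k ≢ j → swap i j k ≡ k
swap-other {i = i} {j} {k} k≢i k≢j with k Fin.≟ i | k Fin.≟ j
... | yes e | _     = ⊥-elim (k≢i e)
... | no _  | yes e = ⊥-elim (k≢j e)
... | no _  | no _  = refl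

swap-involutive : ∀ {n} (i j k : Fin n) → swap i j (swap i j k) ≡ k
swap-involutive i j k with k Fin.≟ i | k Fin.≟ j
... | yes refl | _        = swap-snd i j
... | no _     | yes refl = swap-fst i j
... | no k≢i   | no k≢j   = swap-other k≢i k≢j

module EdgeCount {n} (3≤n : 3 ≤ n) where

  private
    ℋ = hamiltonCycles n

  through : Fin n → Fin n → ℕ
  through u v = ∑ˡ (λ H → adjacency H u v) ℋ

  ∑-hamiltonian : ∀ {H} → H ∈ ℋ → ∀ u → ∑ (adjacency H u) ≡ 2
  ∑-hamiltonian H∈ u with ∈-hamiltonCycles⁻ H∈
  ... | σ , σ! , refl = Cycle.∑-adjacency 3≤n σ σ! u

  ∑-through : ∀ u → ∑ (through u) ≡ length ℋ * 2
  ∑-through u = trans (sym (∑ˡ-∑ (λ v H → adjacency H u v) ℋ))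
    (trans (∑ˡ-cong ℋ (λ H H∈ → ∑-hamiltonian H∈ u)) (∑ˡ-const 2 ℋ))

  through-diagonal : ∀ u → through u u ≡ 0
  through-diagonal u = trans (∑ˡ-cong ℋ (λ H _ → symmetric-diagonal _ u)) (trans (∑ˡ-const 0 ℋ) (*-zeroʳ (length ℋ)))

  module _ (u v v′ : Fin n) (u≢v : u ≢ v) (u≢v′ : u ≢ v′) where

    private
      π = swap v v′
      π-invol : ∀ x → π (π x) ≡ x
      π-invol = swap-involutive v v′
      π-u : π u ≡ u
      π-u = swap-other u≢v u≢v′
      π-v : π v ≡ v′
      π-v = swap-fst v v′

      closed′ : ∀ H → H ∈ ℋ → relabel π H ∈ ℋ
      closed′ H H∈ with ∈-hamiltonCycles⁻ H∈
      ... | σ , σ! , refl = subst (_∈ ℋ) (sym (relabel-cycle π π-invol 3≤n σ σ!))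
                              (∈-hamiltonCycles⁺ (Vec.map π σ) (map-unique π π-invol σ!))

      invol : ∀ H → H ∈ ℋ → relabel π (relabel π H) ≡ H
      invol H H∈ with ∈-hamiltonCycles⁻ H∈
      ... | σ , σ! , refl = trans (cong (relabel π) (relabel-cycle π π-invol 3≤n σ σ!))
        (trans (relabel-cycle π π-invol 3≤n (Vec.map π σ) (map-unique π π-invol σ!))
          (cong cycleGraph (trans (sym (Vec.map-∘ π π σ)) (trans (Vec.map-cong π-invol σ) (Vec.map-id σ)))))

    -- The transposition of v and v′ fixes u and acts on ℋ as an involution, which exchanges the
    -- cycles through uv with those through uv′.
    through-const : through u v ≡ through u v′
    through-const = sym (trans (∑ˡ-cong ℋ (λ H _ → sym (trans (adjacency-relabel π H u v u≢v) (cong₂ (adjacency H) π-u π-v))))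
      (∑ˡ-involution (relabel π) (λ H → adjacency H u v) ℋ hamiltonCycles-unique closed′ invol))

  -- Row u has n - 1 equal entries off the diagonal and total 2 |ℋ|; one more copy replaces the zero
  -- on the diagonal, so that no subtraction occurs. Hence a random cycle uses the edge uv with
  -- probability 2 / (n - 1).
  through-value : ∀ u v → u ≢ v → length ℋ * 2 + through u v ≡ n * through u v
  through-value u v u≢v = begin
    length ℋ * 2 + through u v
      ≡⟨ cong₂ _+_ (sym (∑-through u)) (sym (trans (cong (through u v *_) (∑-point u)) (*-identityʳ _))) ⟩
    ∑ (through u) + through u v * ∑ (λ x → 𝟙 (u Fin.≟ x))
      ≡⟨ cong (∑ (through u) +_) (*-distribˡ-sum (through u v) (λ x → 𝟙 (u Fin.≟ x))) ⟩
    ∑ (through u) + ∑ (λ x → through u v * 𝟙 (u Fin.≟ x))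
      ≡⟨ ∑-distrib-+ (through u) (λ x → through u v * 𝟙 (u Fin.≟ x)) ⟨
    ∑ (λ x → through u x + through u v * 𝟙 (u Fin.≟ x))
      ≡⟨ ∑-cong {n} {λ x → through u x + through u v * 𝟙 (u Fin.≟ x)} {λ _ → through u v} pointwise ⟩
    ∑ {n} (λ _ → through u v)
      ≡⟨ ∑-const n (through u v) ⟩
    n * through u v ∎
    where
    open ≡-Reasoning
    pointwise : ∀ x → through u x + through u v * 𝟙 (u Fin.≟ x) ≡ through u v
    pointwise x with u Fin.≟ x
    ... | yes refl = trans (cong (_+ through u v * 1) (through-diagonal u)) (*-identityʳ _)
    ... | no u≢x = trans (cong (through u x +_) (*-zeroʳ (through u v))) (trans (+-identityʳ _) (through-const u x v u≢x u≢v))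

  through-≤ : ∀ u v → pred n * through u v ≤ length ℋ * 2
  through-≤ u v with u Fin.≟ v
  ... | yes refl = ≤-trans (≤-reflexive (trans (cong (pred n *_) (through-diagonal u)) (*-zeroʳ (pred n)))) z≤n
  ... | no u≢v = +-cancelʳ-≤ (through u v) _ _ (≤-reflexive (trans (lemma n (≤-trans (s≤s z≤n) 3≤n)) (sym (through-value u v u≢v))))
    where
    lemma : ∀ k → 1 ≤ k → pred k * through u v + through u v ≡ k * through u v
    lemma (suc k) _ = +-comm (k * through u v) _

-- Hard vertices

∑-component : ∀ {n} (f : Fin n → ℕ) i → f i ≤ ∑ f
∑-component f zero    = m≤m+n _ _
∑-component f (suc i) = ≤-trans (∑-component (f ∘ suc) i) (m≤n+m _ (f zero))

-- Used for a tour edge of weight 1: each position q is charged to one of three reasons why its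
-- exchange with that edge does not pay, the last being that q is the position of the edge itself.
∑-cover : ∀ {n} (f g h : Fin n → ℕ) → (∀ i → 1 ≤ f i + (g i + h i)) → n ≤ ∑ f + (∑ g + ∑ h)
∑-cover {n} f g h cover = begin
  n                              ≡⟨ *-identityʳ n ⟨
  n * 1                          ≡⟨ ∑-const n 1 ⟨
  ∑ {n} (λ _ → 1)                ≤⟨ ∑-mono {n} {λ _ → 1} cover ⟩
  ∑ (λ i → f i + (g i + h i))    ≡⟨ ∑-distrib-+ f (λ i → g i + h i) ⟩
  ∑ f + ∑ (λ i → g i + h i)      ≡⟨ cong (∑ f +_) (∑-distrib-+ g h) ⟩
  ∑ f + (∑ g + ∑ h)              ∎
  where open ≤-Reasoning

module _ {n} (a : Fin n → Fin n → ℕ) (a-sym : ∀ u v → a u v ≡ a v u) (a-row : ∀ u → ∑ (a u) ≡ 2) (h : Fin n → ℕ) where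

  private
    rows : ∑ (λ u → ∑ (λ v → a u v * h u)) ≡ 2 * ∑ h
    rows = trans (∑-cong row) (sym (*-distribˡ-sum 2 h))
      where
      row : ∀ u → ∑ (λ v → a u v * h u) ≡ 2 * h u
      row u = trans (∑-cong (λ v → *-comm (a u v) (h u)))
        (trans (sym (*-distribˡ-sum (h u) (a u))) (trans (cong (h u *_) (a-row u)) (*-comm (h u) 2)))

  -- Every row and, by symmetry, every column of `a` has sum 2, so each value of `h` is counted
  -- twice as h u and twice as h v.
  ∑∑-endpoints : ∑ (λ u → ∑ (λ v → a u v * (h u + h v))) ≡ 2 * ∑ h + 2 * ∑ h
  ∑∑-endpoints = begin
    ∑ (λ u → ∑ (λ v → a u v * (h u + h v)))
      ≡⟨ ∑-cong (λ u → trans (∑-cong (λ v → *-distribˡ-+ (a u v) (h u) (h v))) (∑-distrib-+ (λ v → a u v * h u) (λ v → a u v * h v))) ⟩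
    ∑ (λ u → ∑ (λ v → a u v * h u) + ∑ (λ v → a u v * h v))
      ≡⟨ ∑-distrib-+ (λ u → ∑ (λ v → a u v * h u)) (λ u → ∑ (λ v → a u v * h v)) ⟩
    ∑ (λ u → ∑ (λ v → a u v * h u)) + ∑ (λ u → ∑ (λ v → a u v * h v))
      ≡⟨ cong₂ _+_ rows (trans (∑-comm (λ u v → a u v * h v)) (trans (∑-cong (λ v → ∑-cong (λ u → cong (_* h v) (a-sym u v)))) rows)) ⟩
    2 * ∑ h + 2 * ∑ h ∎
    where open ≡-Reasoning

module Analysis (I : ZeroOneInstance) (S : Weighted.Solution I) where

  open Weighted I
  open Solution S

  n : ℕ
  n = size I

  private
    3≤n = size≥3 I
    wt = weightMatrix I
    σ : Fin n → Fin n
    σ = lookup (Execution.order execution)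
    σ! = Execution.distinct execution

    σ-injective : ∀ {p q} → σ p ≡ σ q → p ≡ q
    σ-injective = Unique.lookup-injective σ! _ _

    σ-next-injective : ∀ {p q} → σ (next p) ≡ σ (next q) → p ≡ q
    σ-next-injective e = next-injective (σ-injective e)

  heavy : Fin n → ℕ
  heavy u = 𝟙 (n ≤? 3 * degree u)

  #heavy : ℕ
  #heavy = ∑ heavy

  -- u is hard if at most #heavy edges at u have weight 0.
  hard : Fin n → ℕ
  hard u = 𝟙 (n ≤? degree u + (#heavy + 1))

  #hard : ℕ
  #hard = ∑ hard

  private
    costᶠ-≤ : ∀ u v → costᶠ u v ≤ degree u + degree v
    costᶠ-≤ u v = ≤-trans (*-monoˡ-≤ (degree u + degree v) (wt≤1 u v)) (≤-reflexive (*-identityˡ _))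

    module _ (p : Fin n) (wt≡1 : wt (σ p) (σ (next p)) ≡ 1) where

      u v : Fin n
      u = σ p
      v = σ (next p)

      -- The edge uv costs exactly deg u + deg v because its weight is 1; the cost of the other
      -- removed edge is dropped.
      exchange : ∀ q → p ≢ q → degree u + degree v ≤ costᶠ u (σ q) + costᶠ v (σ (next q))
      exchange q p≢q = ≤-trans (≤-trans (≤-reflexive (sym (trans (cong (_* (degree u + degree v)) wt≡1) (*-identityˡ _)))) (m≤m+n _ _))
        (stableᶠ p q p≢q)

      -- If q is not p and w(u, σ q) = 0, then only the new edge from v to y = σ (next q) can cost
      -- anything, so deg u + deg v ≤ deg v + deg y and y is heavy along with u. Thus each position
      -- holds a weight 1 neighbour of u, precedes a heavy vertex, or is p.
      heavy-u : n ≤ 3 * degree u → n ≤ degree u + (#heavy + 1)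
      heavy-u big = ≤-trans (∑-cover (wt u ∘ σ) (heavy ∘ σ ∘ next) (λ q → 𝟙 (p Fin.≟ q)) cover)
        (≤-reflexive (cong₂ _+_ (∑-injective (wt u) σ-injective) (cong₂ _+_ (∑-injective heavy σ-next-injective) (∑-point p))))
        where
        cover : ∀ q → 1 ≤ wt u (σ q) + (heavy (σ (next q)) + 𝟙 (p Fin.≟ q))
        cover q with p Fin.≟ q
        ... | yes _  = ≤-trans (m≤n+m 1 (heavy (σ (next q)))) (m≤n+m _ (wt u (σ q)))
        ... | no p≢q with wt u (σ q) in x≡
        ... | suc _ = s≤s z≤n
        ... | zero = ≤-reflexive (sym (trans (+-identityʳ _) (𝟙-yes (n ≤? 3 * degree (σ (next q))) (≤-trans big (*-monoʳ-≤ 3 smaller)))))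
          where
          smaller : degree u ≤ degree (σ (next q))
          smaller = +-cancelʳ-≤ (degree v) _ _ (≤-trans (exchange q p≢q)
            (≤-trans (+-mono-≤ (≤-reflexive (cong (_* (degree u + degree (σ q))) x≡)) (costᶠ-≤ v (σ (next q))))
              (≤-reflexive (+-comm (degree v) _))))

      -- The mirror image of `heavy-u`: now the new edge at v is free, and the vertex σ q, to which
      -- u gets joined, must be heavy.
      heavy-v : n ≤ 3 * degree v → n ≤ degree v + (#heavy + 1)
      heavy-v big = ≤-trans (∑-cover (wt v ∘ σ ∘ next) (heavy ∘ σ) (λ q → 𝟙 (p Fin.≟ q)) cover)
        (≤-reflexive (cong₂ _+_ (∑-injective (wt v) σ-next-injective) (cong₂ _+_ (∑-injective heavy σ-injective) (∑-point p))))
        where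
        cover : ∀ q → 1 ≤ wt v (σ (next q)) + (heavy (σ q) + 𝟙 (p Fin.≟ q))
        cover q with p Fin.≟ q
        ... | yes _  = ≤-trans (m≤n+m 1 (heavy (σ q))) (m≤n+m _ (wt v (σ (next q))))
        ... | no p≢q with wt v (σ (next q)) in x≡
        ... | suc _ = s≤s z≤n
        ... | zero = ≤-reflexive (sym (trans (+-identityʳ _) (𝟙-yes (n ≤? 3 * degree (σ q)) (≤-trans big (*-monoʳ-≤ 3 smaller)))))
          where
          smaller : degree v ≤ degree (σ q)
          smaller = +-cancelˡ-≤ (degree u) _ _ (≤-trans (exchange q p≢q)
            (≤-trans (+-mono-≤ (costᶠ-≤ u (σ q)) (≤-reflexive (cong (_* (degree v + degree (σ (next q)))) x≡)))
              (≤-reflexive (+-identityʳ _))))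

      -- Every position other than p yields a new edge of weight 1, for otherwise uv, whose cost is
      -- positive, could be exchanged for free. So n ≤ deg u + deg v + 1, whereas 3 deg ≤ n - 1 at
      -- both ends; together they give n ≤ 1.
      light-impossible : ¬ n ≤ 3 * degree u → ¬ ¬ n ≤ 3 * degree v
      light-impossible light-u light-v = 1+n≰n {1} (≤-trans (≤-trans (s≤s (s≤s z≤n)) 3≤n) n≤1)
        where
        cover : ∀ q → 1 ≤ wt u (σ q) + (wt v (σ (next q)) + 𝟙 (p Fin.≟ q))
        cover q with p Fin.≟ q
        ... | yes _  = ≤-trans (m≤n+m 1 (wt v (σ (next q)))) (m≤n+m _ (wt u (σ q)))
        ... | no p≢q with wt u (σ q) in x≡ | wt v (σ (next q)) in y≡
        ... | suc _ | _     = s≤s z≤n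
        ... | zero  | suc _ = s≤s z≤n
        ... | zero  | zero  = ⊥-elim (1+n≰n (≤-trans (≤-trans (≤-reflexive (sym wt≡1)) (≤-trans (∑-component (wt u) v) (m≤m+n _ (degree v))))
          (≤-trans (exchange q p≢q) (≤-reflexive (cong₂ _+_ (cong (_* (degree u + degree (σ q))) x≡) (cong (_* (degree v + degree (σ (next q)))) y≡))))))
        n≤ : n ≤ degree u + (degree v + 1)
        n≤ = ≤-trans (∑-cover (wt u ∘ σ) (wt v ∘ σ ∘ next) (λ q → 𝟙 (p Fin.≟ q)) cover)
          (≤-reflexive (cong₂ _+_ (∑-injective (wt u) σ-injective) (cong₂ _+_ (∑-injective (wt v) σ-next-injective) (∑-point p))))
        expand : ∀ x y → 2 + 3 * (x + (y + 1)) ≡ suc (3 * x) + suc (3 * y) + 3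
        expand = solve-∀
        regroup : ∀ n → n + n + 3 ≡ (1 + n + n) + 2
        regroup = solve-∀
        triple : ∀ n → 2 + 3 * n ≡ n + (n + n) + 2
        triple = solve-∀
        n≤1 : n ≤ 1
        n≤1 = +-cancelʳ-≤ (n + n) n 1 (+-cancelʳ-≤ 2 _ _ (begin
          n + (n + n) + 2                              ≡⟨ triple n ⟨
          2 + 3 * n                                    ≤⟨ +-monoʳ-≤ 2 (*-monoʳ-≤ 3 n≤) ⟩
          2 + 3 * (degree u + (degree v + 1))          ≡⟨ expand (degree u) (degree v) ⟩
          suc (3 * degree u) + suc (3 * degree v) + 3  ≤⟨ +-monoˡ-≤ 3 (+-mono-≤ (≰⇒> light-u) (≰⇒> light-v)) ⟩
          n + n + 3                                    ≡⟨ regroup n ⟩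
          1 + n + n + 2                                ≡⟨ cong (_+ 2) (+-assoc 1 n n) ⟩
          1 + (n + n) + 2                              ∎))
          where open ≤-Reasoning

      touches-hard : 1 ≤ hard u + hard v
      touches-hard with n ≤? 3 * degree u | n ≤? 3 * degree v
      ... | yes big | _       = ≤-trans (≤-reflexive (sym (𝟙-yes (n ≤? degree u + (#heavy + 1)) (heavy-u big)))) (m≤m+n _ _)
      ... | no _    | yes big = ≤-trans (≤-reflexive (sym (𝟙-yes (n ≤? degree v + (#heavy + 1)) (heavy-v big)))) (m≤n+m _ (hard u))
      ... | no lu   | no lv   = ⊥-elim (light-impossible lu lv)

  H° : Subgraph n
  H° = cycleGraph (Execution.order execution)

  private
    twice-cycle : ∀ (τ : Vec (Fin n) n) → let G = cycleGraph τ in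
                  weight I G + weight I G ≡ ∑ (λ u → ∑ (λ v → adjacency G u v * wt u v))
    twice-cycle τ = subst (λ G → weight I G + weight I G ≡ ∑ (λ u → ∑ (λ v → adjacency G u v * wt u v)))
      (sym (CycleSpec.isFilter (cycleSpec τ))) (twice-weight I (CycleSpec.onCycle? (cycleSpec τ)))

    cycle-endpoints : ∀ (τ : Vec (Fin n) n) → Unique τ →
      ∑ (λ u → ∑ (λ v → adjacency (cycleGraph τ) u v * (hard u + hard v))) ≡ 2 * #hard + 2 * #hard
    cycle-endpoints τ τ! = ∑∑-endpoints (adjacency (cycleGraph τ)) (symmetric-sym _) (Cycle.∑-adjacency 3≤n τ τ!) hard

  weight-H° : weight I H° + weight I H° ≤ 2 * #hard + 2 * #hard
  weight-H° = begin
    weight I H° + weight I H°                                         ≡⟨ twice-cycle (Execution.order execution) ⟩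
    ∑ (λ u → ∑ (λ v → adjacency H° u v * wt u v))                     ≤⟨ ∑-mono (λ u → ∑-mono (λ v → pointwise u v)) ⟩
    ∑ (λ u → ∑ (λ v → adjacency H° u v * (hard u + hard v)))          ≡⟨ cycle-endpoints (Execution.order execution) σ! ⟩
    2 * #hard + 2 * #hard                                             ∎
    where
    open ≤-Reasoning
    oriented : ∀ {u v} → Follows (Execution.order execution) u v → wt u v ≡ 1 → 1 ≤ hard u + hard v
    oriented (p , refl , refl) = touches-hard p
    covered : ∀ u v → adjacency H° u v ≡ 1 → wt u v ≡ 1 → 1 ≤ hard u + hard v
    covered u v a≡1 x≡1 with Cycle.adjacent⇒follows 3≤n (Execution.order execution) σ! u v a≡1
    ... | inj₁ f = oriented f x≡1
    ... | inj₂ f = ≤-trans (oriented f (trans (wt-sym v u) x≡1)) (≤-reflexive (+-comm (hard v) (hard u)))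
    pointwise : ∀ u v → adjacency H° u v * wt u v ≤ adjacency H° u v * (hard u + hard v)
    pointwise u v with adjacency H° u v in a≡ | adjacency≤1 H° u v
    ... | zero        | _ = z≤n
    ... | suc (suc _) | s≤s ()
    ... | suc zero    | _ with wt u v in x≡ | wt≤1 u v
    ...   | zero        | _ = z≤n
    ...   | suc (suc _) | s≤s ()
    ...   | suc zero    | _ = ≤-trans (covered u v a≡ x≡) (≤-reflexive (sym (+-identityʳ _)))

  -- The diagonal is removed because `weightMatrix` vanishes there although there is no edge; what
  -- remains marks the edges of weight 0.
  light : Fin n → Fin n → ℕ
  light u v = 1 ∸ (wt u v + 𝟙 (u Fin.≟ v))

  -- For hard u, the edges by which a cycle can save weight at u: those of
  -- weight 0 and those leading to another hard vertex.
  conflict : Fin n → Fin n → ℕ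
  conflict u v = hard u * (light u v + hard v)

  conflicts : Subgraph n → ℕ
  conflicts H = ∑ (λ u → ∑ (λ v → conflict u v * adjacency H u v))

  private
    light-sum : ∀ u v → wt u v + 𝟙 (u Fin.≟ v) + light u v ≡ 1
    light-sum u v = m+[n∸m]≡n bound
      where
      bound : wt u v + 𝟙 (u Fin.≟ v) ≤ 1
      bound with u Fin.≟ v
      ... | yes refl = ≤-reflexive (cong (_+ 1) (wt-diag u))
      ... | no _     = ≤-trans (≤-reflexive (+-identityʳ _)) (wt≤1 u v)

    light-edge : ∀ u v → u ≢ v → wt u v + light u v ≡ 1
    light-edge u v u≢v = trans (cong (_+ light u v) (sym (trans (cong (wt u v +_) (𝟙-no (u Fin.≟ v) u≢v)) (+-identityʳ _)))) (light-sum u v)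

    ∑-light : ∀ u → degree u + 1 + ∑ (light u) ≡ n
    ∑-light u = begin
      degree u + 1 + ∑ (light u)
        ≡⟨ cong (λ x → degree u + x + ∑ (light u)) (sym (∑-point u)) ⟩
      degree u + ∑ (λ v → 𝟙 (u Fin.≟ v)) + ∑ (light u)
        ≡⟨ cong (_+ ∑ (light u)) (∑-distrib-+ (wt u) (λ v → 𝟙 (u Fin.≟ v))) ⟨
      ∑ (λ v → wt u v + 𝟙 (u Fin.≟ v)) + ∑ (light u)
        ≡⟨ ∑-distrib-+ (λ v → wt u v + 𝟙 (u Fin.≟ v)) (light u) ⟨
      ∑ (λ v → wt u v + 𝟙 (u Fin.≟ v) + light u v)
        ≡⟨ ∑-cong (light-sum u) ⟩
      ∑ {n} (λ _ → 1)
        ≡⟨ trans (∑-const n 1) (*-identityʳ n) ⟩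
      n ∎
      where open ≡-Reasoning

    -- On an edge z = z′ = 1 - x, which leaves eight cases of zeros and ones: an edge of weight 0
    -- with a hard end is itself a conflict, and for weight 1 the left side exceeds the weight only
    -- if both ends are hard, again a conflict. The equations for z and z′ are conditional on a = 1
    -- because they fail on the diagonal.
    local : ∀ a x p q z z′ → a ≤ 1 → x ≤ 1 → p ≤ 1 → q ≤ 1 → (a ≡ 1 → x + z ≡ 1) → (a ≡ 1 → x + z′ ≡ 1) →
            a * (p + q) ≤ a * x + (p * (z + q) * a + q * (z′ + p) * a)
    local _ _ _ _ _ _ z≤n _ _ _ _ _ = z≤n
    local _ _ _ _ _ _ (s≤s z≤n) z≤n p≤1 q≤1 e e′ with e refl | e′ refl | p≤1 | q≤1
    ... | refl | refl | z≤n     | z≤n     = z≤n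
    ... | refl | refl | z≤n     | s≤s z≤n = ≤ᵇ⇒≤ 1 1 tt
    ... | refl | refl | s≤s z≤n | z≤n     = ≤ᵇ⇒≤ 1 1 tt
    ... | refl | refl | s≤s z≤n | s≤s z≤n = ≤ᵇ⇒≤ 2 4 tt
    local _ _ _ _ _ _ (s≤s z≤n) (s≤s z≤n) p≤1 q≤1 e e′ with e refl | e′ refl | p≤1 | q≤1
    ... | refl | refl | z≤n     | z≤n     = z≤n
    ... | refl | refl | z≤n     | s≤s z≤n = ≤ᵇ⇒≤ 1 1 tt
    ... | refl | refl | s≤s z≤n | z≤n     = ≤ᵇ⇒≤ 1 1 tt
    ... | refl | refl | s≤s z≤n | s≤s z≤n = ≤ᵇ⇒≤ 2 3 tt

  -- `local` is summed over all ordered pairs, and the transposed term contributes a second copy of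
  -- `conflicts H`. A cycle free of conflicts therefore weighs at least twice `#hard`.
  weight-lower : ∀ (τ : Vec (Fin n) n) → Unique τ → let H = cycleGraph τ in
                 2 * #hard + 2 * #hard ≤ weight I H + weight I H + (conflicts H + conflicts H)
  weight-lower τ τ! = begin
    2 * #hard + 2 * #hard
      ≡⟨ cycle-endpoints τ τ! ⟨
    ∑ (λ u → ∑ (λ v → a u v * (hard u + hard v)))
      ≤⟨ ∑-mono (λ u → ∑-mono (λ v → pointwise u v)) ⟩
    ∑ (λ u → ∑ (λ v → a u v * wt u v + (t u v + t v u)))
      ≡⟨ ∑-cong (λ u → trans (∑-distrib-+ (λ v → a u v * wt u v) (λ v → t u v + t v u))
           (cong (∑ (λ v → a u v * wt u v) +_) (∑-distrib-+ (t u) (λ v → t v u)))) ⟩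
    ∑ (λ u → ∑ (λ v → a u v * wt u v) + (∑ (t u) + ∑ (λ v → t v u)))
      ≡⟨ ∑-distrib-+ (λ u → ∑ (λ v → a u v * wt u v)) (λ u → ∑ (t u) + ∑ (λ v → t v u)) ⟩
    ∑ (λ u → ∑ (λ v → a u v * wt u v)) + ∑ (λ u → ∑ (t u) + ∑ (λ v → t v u))
      ≡⟨ cong₂ _+_ (sym (twice-cycle τ)) (trans (∑-distrib-+ (λ u → ∑ (t u)) (λ u → ∑ (λ v → t v u)))
           (cong (∑ (λ u → ∑ (t u)) +_) (∑-comm (λ u v → t v u)))) ⟩
    weight I H + weight I H + (conflicts H + conflicts H) ∎
    where
    open ≤-Reasoning
    H = cycleGraph τ
    a = adjacency H
    t : Fin n → Fin n → ℕ
    t u v = conflict u v * a u v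
    distinct-ends : ∀ u v → a u v ≡ 1 → u ≢ v
    distinct-ends u .u e refl = 0≢1+n (trans (sym (symmetric-diagonal _ u)) e)
    pointwise : ∀ u v → a u v * (hard u + hard v) ≤ a u v * wt u v + (t u v + t v u)
    pointwise u v = ≤-trans
      (local (a u v) (wt u v) (hard u) (hard v) (light u v) (light v u)
        (adjacency≤1 H u v) (wt≤1 u v) (𝟙≤1 _) (𝟙≤1 _)
        (λ e → light-edge u v (distinct-ends u v e))
        (λ e → trans (cong (_+ light v u) (wt-sym u v)) (light-edge v u (λ e′ → distinct-ends u v e (sym e′)))))
      (≤-reflexive (cong (λ x → a u v * wt u v + (t u v + conflict v u * x)) (symmetric-sym _ u v)))

  beats : ℕ
  beats = length (filter (λ H → weight I H <? weight I H°) (hamiltonCycles n))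

  private
    ℋ = hamiltonCycles n

    -- A cycle without conflicts weighs at least 2 `#hard`, and `H°` at most that. The indicator is
    -- bounded by the number of conflicts because that number, summed over ℋ, splits into counts for
    -- single edges.
    beats⇒conflict : ∀ H → H ∈ ℋ → 𝟙 (weight I H <? weight I H°) ≤ conflicts H
    beats⇒conflict H H∈ with weight I H <? weight I H°
    ... | no _ = z≤n
    ... | yes lt with ∈-hamiltonCycles⁻ H∈
    ... | τ , τ! , refl with conflicts (cycleGraph τ) in c≡
    ... | suc _ = s≤s z≤n
    ... | zero = ⊥-elim (<⇒≱ (+-mono-< lt lt) (≤-trans weight-H° (≤-trans (weight-lower τ τ!)
      (≤-reflexive (trans (cong (λ c → weight I (cycleGraph τ) + weight I (cycleGraph τ) + (c + c)) c≡) (+-identityʳ _))))))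

  beats-≤ : beats ≤ ∑ (λ u → ∑ (λ v → conflict u v * EdgeCount.through 3≤n u v))
  beats-≤ = begin
    beats
      ≡⟨ length-filter (λ H → weight I H <? weight I H°) ℋ ⟩
    ∑ˡ (λ H → 𝟙 (weight I H <? weight I H°)) ℋ
      ≤⟨ ∑ˡ-mono ℋ beats⇒conflict ⟩
    ∑ˡ conflicts ℋ
      ≡⟨ ∑ˡ-∑ (λ u H → ∑ (λ v → conflict u v * adjacency H u v)) ℋ ⟩
    ∑ (λ u → ∑ˡ (λ H → ∑ (λ v → conflict u v * adjacency H u v)) ℋ)
      ≡⟨ ∑-cong (λ u → trans (∑ˡ-∑ (λ v H → conflict u v * adjacency H u v) ℋ)
           (∑-cong (λ v → ∑ˡ-* (conflict u v) (λ H → adjacency H u v) ℋ))) ⟩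
    ∑ (λ u → ∑ (λ v → conflict u v * EdgeCount.through 3≤n u v)) ∎
    where open ≤-Reasoning

  private
    -- At a hard u at most `#heavy` edges have weight 0: together with u and the `degree u` others
    -- they exhaust the n vertices. The ends that are hard add at most `#hard`. With `hard u` also
    -- on the right, only hard rows contribute to the total.
    hard-row : ∀ u → ∑ (conflict u) ≤ (#heavy + #hard) * hard u
    hard-row u = ≤-trans (≤-reflexive (trans (sym (*-distribˡ-sum (hard u) (λ v → light u v + hard v)))
                   (cong (hard u *_) (∑-distrib-+ (light u) hard)))) (bound (n ≤? degree u + (#heavy + 1)))
      where
      light≤ : n ≤ degree u + (#heavy + 1) → ∑ (light u) ≤ #heavy
      light≤ n≤ = +-cancelˡ-≤ (degree u + 1) _ _ (≤-trans (≤-reflexive (∑-light u)) (≤-trans n≤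
        (≤-reflexive (trans (cong (degree u +_) (+-comm #heavy 1)) (sym (+-assoc (degree u) 1 #heavy))))))
      -- The test is abstracted to `d`, since `hard u` is its indicator; on `no` both sides vanish.
      bound : ∀ (d : Dec (n ≤ degree u + (#heavy + 1))) → 𝟙 d * (∑ (light u) + #hard) ≤ (#heavy + #hard) * 𝟙 d
      bound (no _)   = z≤n
      bound (yes n≤) = ≤-trans (≤-reflexive (+-identityʳ _)) (≤-trans (+-monoˡ-≤ #hard (light≤ n≤)) (≤-reflexive (sym (*-identityʳ _))))

  -- Divided by (n - 1) |ℋ|, this is the union bound: `#hard` vertices, conflicts of total at most
  -- `#heavy` + `#hard` at each, and probability at most 2 / (n - 1) for every edge.
  count-bound : pred n * beats ≤ (#heavy + #hard) * #hard * (length ℋ * 2)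
  count-bound = begin
    pred n * beats
      ≤⟨ *-monoʳ-≤ (pred n) beats-≤ ⟩
    pred n * ∑ (λ u → ∑ (λ v → conflict u v * through u v))
      ≡⟨ trans (*-distribˡ-sum (pred n) (λ u → ∑ (λ v → conflict u v * through u v)))
           (∑-cong (λ u → *-distribˡ-sum (pred n) (λ v → conflict u v * through u v))) ⟩
    ∑ (λ u → ∑ (λ v → pred n * (conflict u v * through u v)))
      ≤⟨ ∑-mono (λ u → ∑-mono (λ v → ≤-trans (≤-reflexive (rearrange (pred n) (conflict u v) (through u v)))
           (*-monoˡ-≤ (conflict u v) (through-≤ u v)))) ⟩
    ∑ (λ u → ∑ (λ v → M * conflict u v))
      ≡⟨ trans (∑-cong (λ u → sym (*-distribˡ-sum M (conflict u)))) (sym (*-distribˡ-sum M (λ u → ∑ (conflict u)))) ⟩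
    M * ∑ (λ u → ∑ (conflict u))
      ≤⟨ *-monoʳ-≤ M (∑-mono hard-row) ⟩
    M * ∑ (λ u → (#heavy + #hard) * hard u)
      ≡⟨ cong (M *_) (sym (*-distribˡ-sum (#heavy + #hard) hard)) ⟩
    M * ((#heavy + #hard) * #hard)
      ≡⟨ *-comm M _ ⟩
    (#heavy + #hard) * #hard * M ∎
    where
    open ≤-Reasoning
    open EdgeCount 3≤n
    M = length ℋ * 2
    rearrange : ∀ x y z → x * (y * z) ≡ x * z * y
    rearrange = solve-∀

  -- Markov's inequality: each heavy vertex contributes at least n/3 to the degree sum.
  heavy-bound : n * #heavy ≤ 3 * ∑ degree
  heavy-bound = ≤-trans (≤-reflexive (*-distribˡ-sum n heavy))
    (≤-trans (∑-mono pointwise) (≤-reflexive (sym (*-distribˡ-sum 3 degree))))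
    where
    pointwise : ∀ u → n * heavy u ≤ 3 * degree u
    pointwise u with n ≤? 3 * degree u
    ... | yes le = ≤-trans (≤-reflexive (*-identityʳ n)) le
    ... | no _   = ≤-trans (≤-reflexive (*-zeroʳ n)) z≤n

  -- A hard vertex has degree at least n - (`#heavy` + 1), and this is at least n/3 as long as
  -- `#heavy` + 1 is at most 2n/3.
  hard≤heavy : 3 * (#heavy + 1) ≤ 2 * n → #hard ≤ #heavy
  hard≤heavy few = ∑-mono pointwise
    where
    pointwise : ∀ u → hard u ≤ heavy u
    pointwise u with n ≤? degree u + (#heavy + 1)
    ... | no _   = z≤n
    ... | yes n≤ = ≤-reflexive (sym (𝟙-yes (n ≤? 3 * degree u) (+-cancelʳ-≤ (2 * n) _ _ (begin
      n + 2 * n                           ≤⟨ *-monoʳ-≤ 3 n≤ ⟩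
      3 * (degree u + (#heavy + 1))       ≡⟨ *-distribˡ-+ 3 (degree u) (#heavy + 1) ⟩
      3 * degree u + 3 * (#heavy + 1)     ≤⟨ +-monoʳ-≤ (3 * degree u) few ⟩
      3 * degree u + 2 * n                ∎))))
      where open ≤-Reasoning

-- Rational and real bounds

private
  module Exp = Algebra.Properties.CommutativeSemiring.Exp (CommutativeRing.commutativeSemiring ℚ.+-*-commutativeRing)

fromℕ-+ : ∀ a b → fromℕ (a + b) ≡ fromℕ a ℚ.+ fromℕ b
fromℕ-+ a b = ℚ.toℚᵘ-injective (ℚᵘ.≃-trans (ℚᵘ.*≡* (eq (pos a) (pos b))) (ℚᵘ.≃-sym (ℚ.toℚᵘ-homo-+ (fromℕ a) (fromℕ b))))
  where
  eq : ∀ x y → (x ℤ.+ y) ℤ.* (pos 1 ℤ.* pos 1) ≡ (x ℤ.* pos 1 ℤ.+ y ℤ.* pos 1) ℤ.* pos 1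
  eq = ℤSolver.solve-∀

fromℕ-* : ∀ a b → fromℕ (a * b) ≡ fromℕ a ℚ.* fromℕ b
fromℕ-* a b = ℚ.toℚᵘ-injective (ℚᵘ.≃-trans (ℚᵘ.*≡* (trans (cong (ℤ._* (pos 1 ℤ.* pos 1)) (ℤ.pos-* a b)) (eq (pos a) (pos b)))) (ℚᵘ.≃-sym (ℚ.toℚᵘ-homo-* (fromℕ a) (fromℕ b))))
  where
  eq : ∀ x y → x ℤ.* y ℤ.* (pos 1 ℤ.* pos 1) ≡ x ℤ.* y ℤ.* pos 1
  eq = ℤSolver.solve-∀

fromℕ-mono : ∀ {a b} → a ≤ b → fromℕ a ℚ.≤ fromℕ b
fromℕ-mono a≤b = ℚ.*≤* (ℤ.*-monoʳ-≤-nonNeg (pos 1) (ℤ.+≤+ a≤b))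

fromℕ-≥0 : ∀ a → 0ℚ ℚ.≤ fromℕ a
fromℕ-≥0 a = fromℕ-mono {0} {a} z≤n

/-cancel : ∀ a b .{{_ : NonZero b}} → (pos a ℚ./ b) ℚ.* fromℕ b ≡ fromℕ a
/-cancel a (suc b) = ℚ.toℚᵘ-injective (ℚᵘ.≃-trans (ℚ.toℚᵘ-homo-* (pos a ℚ./ suc b) (fromℕ (suc b)))
  (ℚᵘ.≃-trans (ℚᵘ.*-cong (ℚ.toℚᵘ-fromℚᵘ (ℚᵘ.mkℚᵘ (pos a) b)) (ℚᵘ.≃-refl {toℚᵘ (fromℕ (suc b))}))
    (ℚᵘ.*≡* (eq (pos a) (pos (suc b))))))
  where
  eq : ∀ x y → x ℤ.* y ℤ.* pos 1 ≡ x ℤ.* (y ℤ.* pos 1)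
  eq = ℤSolver.solve-∀

ℙ-≤ : ∀ {A : Set} {P : A → Set} (P? : Decidable P) xs x → 0ℚ ℚ.≤ x →
      fromℕ (length (filter P? xs)) ℚ.≤ x ℚ.* fromℕ (length xs) → ℙ P? xs ℚ.≤ x
ℙ-≤ P? []         x 0≤x _ = 0≤x
ℙ-≤ P? xs@(_ ∷ _) x 0≤x h = ℚ.*-cancelʳ-≤-pos (fromℕ (length xs))
  (ℚ.≤-trans (ℚ.≤-reflexive (/-cancel (length (filter P? xs)) (length xs))) h)

2*nC2 : ∀ n → 2 * (n C 2) ≡ n * pred n
2*nC2 zero          = refl
2*nC2 (suc zero)    = refl
2*nC2 (suc (suc n)) = begin
  2 * (suc (suc n) C 2)                  ≡⟨ cong (2 *_) (nCk+nC[k+1]≡[n+1]C[k+1] (suc n) 1) ⟨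
  2 * (suc n C 1 + suc n C 2)          ≡⟨ cong (λ x → 2 * (x + suc n C 2)) (nC1≡n (suc n)) ⟩
  2 * (suc n + suc n C 2)              ≡⟨ *-distribˡ-+ 2 (suc n) (suc n C 2) ⟩
  2 * suc n + 2 * (suc n C 2)        ≡⟨ cong (2 * suc n +_) (2*nC2 (suc n)) ⟩
  2 * suc n + suc n * n              ≡⟨ eq n ⟩
  suc (suc n) * suc n                    ∎
  where
  open ≡-Reasoning
  eq : ∀ n → 2 * suc n + suc n * n ≡ suc (suc n) * suc n
  eq = solve-∀

module _ {x y : ℚ} (0≤x : 0ℚ ℚ.≤ x) (x≤y : x ℚ.≤ y) where

  *-mono-≤-nonNeg : ∀ {z w} → 0ℚ ℚ.≤ z → z ℚ.≤ w → x ℚ.* z ℚ.≤ y ℚ.* w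
  *-mono-≤-nonNeg {z} {w} 0≤z z≤w = ℚ.≤-trans
    (ℚ.*-monoˡ-≤-nonNeg x {{ℚ.nonNegative 0≤x}} z≤w)
    (ℚ.*-monoʳ-≤-nonNeg w {{ℚ.nonNegative (ℚ.≤-trans 0≤z z≤w)}} x≤y)

*-≥0 : ∀ {x y} → 0ℚ ℚ.≤ x → 0ℚ ℚ.≤ y → 0ℚ ℚ.≤ x ℚ.* y
*-≥0 {x} {y} 0≤x 0≤y = ℚ.≤-trans (ℚ.≤-reflexive (sym (ℚ.*-zeroˡ y))) (ℚ.*-monoʳ-≤-nonNeg y {{ℚ.nonNegative 0≤y}} 0≤x)

*->0 : ∀ {x y} → 0ℚ ℚ.< x → 0ℚ ℚ.< y → 0ℚ ℚ.< x ℚ.* y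
*->0 {x} {y} 0<x 0<y = ℚ.≤-<-trans (ℚ.≤-reflexive (sym (ℚ.*-zeroˡ y))) (ℚ.*-monoˡ-<-pos y {{ℚ.positive 0<y}} 0<x)

^-≥0 : ∀ {x} → 0ℚ ℚ.≤ x → ∀ k → 0ℚ ℚ.≤ x ^ℚ k
^-≥0 0≤x zero    = 0≤1
^-≥0 0≤x (suc k) = *-≥0 0≤x (^-≥0 0≤x k)

^->0 : ∀ {x} → 0ℚ ℚ.< x → ∀ k → 0ℚ ℚ.< x ^ℚ k
^->0 0<x zero    = 0<1
^->0 0<x (suc k) = *->0 0<x (^->0 0<x k)

^-mono-base : ∀ {x y} → 0ℚ ℚ.≤ x → x ℚ.≤ y → ∀ k → x ^ℚ k ℚ.≤ y ^ℚ k
^-mono-base 0≤x x≤y zero    = ℚ.≤-refl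
^-mono-base 0≤x x≤y (suc k) = *-mono-≤-nonNeg 0≤x x≤y (^-≥0 0≤x k) (^-mono-base 0≤x x≤y k)

^-cancel-≤ : ∀ {x y} → 0ℚ ℚ.≤ y → ∀ k → x ^ℚ suc k ℚ.≤ y ^ℚ suc k → x ℚ.≤ y
^-cancel-≤ {x} {y} 0≤y k h = ℚ.≮⇒≥ λ y<x → ℚ.<-irrefl refl (begin-strict
  y ℚ.* y ^ℚ k  ≤⟨ ℚ.*-monoˡ-≤-nonNeg y {{ℚ.nonNegative 0≤y}} (^-mono-base 0≤y (ℚ.<⇒≤ y<x) k) ⟩
  y ℚ.* x ^ℚ k  <⟨ ℚ.*-monoˡ-<-pos (x ^ℚ k) {{ℚ.positive (^->0 (ℚ.≤-<-trans 0≤y y<x) k)}} y<x ⟩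
  x ℚ.* x ^ℚ k  ≤⟨ h ⟩
  y ℚ.* y ^ℚ k  ∎)
  where open ℚ.≤-Reasoning

-- Squaring a bound by a rational power

module _ (n : ℕ) .{{_ : NonZero n}} where

  private
    N = fromℕ n
    0<N : 0ℚ ℚ.< N
    0<N = ℚ.<-≤-trans 0<1 (1≤fromℕ n)

  -- r^b ≤ n^a, with the exponent a = i − j split to avoid negative powers.
  powerBound : ℚ → ℕ → ℕ → ℕ → Set
  powerBound r b i j = r ^ℚ b ℚ.* N ^ℚ j ℚ.≤ N ^ℚ i

  -- With B = `suc b`, raise r^B N^j ≤ N^i to the power 2b′ and extract a B-th root. The equation is
  -- (i′ - j′) / b′ = 2 (i - j) / B + 1 with denominators cleared: the exponent q becomes 2q + 1.
  -- The auxiliary factor N^(2b′j) avoids negative powers.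
  powerBound-square : ∀ {r} b b′ {i j i′ j′} → 0ℚ ℚ.≤ r →
    suc b * i′ + (2 * b′) * j ≡ (2 * b′) * i + suc b * b′ + suc b * j′ →
    powerBound r (suc b) i j → powerBound (r ℚ.* r ℚ.* N) b′ i′ j′
  powerBound-square {r} b b′ {i} {j} {i′} {j′} 0≤r e h = ^-cancel-≤ (^-≥0 (ℚ.<⇒≤ 0<N) i′) b
    (ℚ.*-cancelʳ-≤-pos (N ^ℚ (2 * b′ * j)) {{ℚ.positive (^->0 0<N (2 * b′ * j))}} (begin
      ((r ℚ.* r ℚ.* N) ^ℚ b′ ℚ.* N ^ℚ j′) ^ℚ suc b ℚ.* N ^ℚ (2 * b′ * j)
        ≡⟨ collect ⟩
      (r ^ℚ suc b ℚ.* N ^ℚ j) ^ℚ (2 * b′) ℚ.* N ^ℚ (suc b * b′ + suc b * j′)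
        ≤⟨ ℚ.*-monoʳ-≤-nonNeg (N ^ℚ (suc b * b′ + suc b * j′)) {{ℚ.nonNegative (^-≥0 (ℚ.<⇒≤ 0<N) (suc b * b′ + suc b * j′))}}
             (^-mono-base (*-≥0 (^-≥0 0≤r (suc b)) (^-≥0 (ℚ.<⇒≤ 0<N) j)) h (2 * b′)) ⟩
      (N ^ℚ i) ^ℚ (2 * b′) ℚ.* N ^ℚ (suc b * b′ + suc b * j′)
        ≡⟨ cong (ℚ._* N ^ℚ (suc b * b′ + suc b * j′)) (Exp.^-assocʳ N i (2 * b′)) ⟩
      N ^ℚ (i * (2 * b′)) ℚ.* N ^ℚ (suc b * b′ + suc b * j′)
        ≡⟨ Exp.^-homo-* N (i * (2 * b′)) (suc b * b′ + suc b * j′) ⟨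
      N ^ℚ (i * (2 * b′) + (suc b * b′ + suc b * j′))
        ≡⟨ cong (N ^ℚ_) exponent ⟩
      N ^ℚ (i′ * suc b + 2 * b′ * j)
        ≡⟨ Exp.^-homo-* N (i′ * suc b) (2 * b′ * j) ⟩
      N ^ℚ (i′ * suc b) ℚ.* N ^ℚ (2 * b′ * j)
        ≡⟨ cong (ℚ._* N ^ℚ (2 * b′ * j)) (Exp.^-assocʳ N i′ (suc b)) ⟨
      (N ^ℚ i′) ^ℚ suc b ℚ.* N ^ℚ (2 * b′ * j) ∎))
    where
    open ℚ.≤-Reasoning
    exponent : i * (2 * b′) + (suc b * b′ + suc b * j′) ≡ i′ * suc b + 2 * b′ * j
    exponent = trans (cong₂ _+_ (*-comm i (2 * b′)) refl) (trans (sym (+-assoc (2 * b′ * i) _ _))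
      (trans (sym e) (cong (_+ 2 * b′ * j) (*-comm (suc b) i′))))
    collect : ((r ℚ.* r ℚ.* N) ^ℚ b′ ℚ.* N ^ℚ j′) ^ℚ suc b ℚ.* N ^ℚ (2 * b′ * j) ≡
              (r ^ℚ suc b ℚ.* N ^ℚ j) ^ℚ (2 * b′) ℚ.* N ^ℚ (suc b * b′ + suc b * j′)
    collect = begin-equality
      ((r ℚ.* r ℚ.* N) ^ℚ b′ ℚ.* N ^ℚ j′) ^ℚ suc b ℚ.* Z
        ≡⟨ cong (ℚ._* Z) (Exp.^-distrib-* ((r ℚ.* r ℚ.* N) ^ℚ b′) (N ^ℚ j′) (suc b)) ⟩
      ((r ℚ.* r ℚ.* N) ^ℚ b′) ^ℚ suc b ℚ.* (N ^ℚ j′) ^ℚ suc b ℚ.* Z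
        ≡⟨ cong₂ (λ x y → x ℚ.* y ℚ.* Z) (Exp.^-assocʳ (r ℚ.* r ℚ.* N) b′ (suc b)) (Exp.^-assocʳ N j′ (suc b)) ⟩
      (r ℚ.* r ℚ.* N) ^ℚ k ℚ.* Y ℚ.* Z
        ≡⟨ cong (λ x → x ℚ.* Y ℚ.* Z) (trans (Exp.^-distrib-* (r ℚ.* r) N k) (cong (ℚ._* X) (Exp.^-distrib-* r r k))) ⟩
      R ℚ.* R ℚ.* X ℚ.* Y ℚ.* Z
        ≡⟨ solve 4 (λ R X Y Z → R :* R :* X :* Y :* Z := R :* R :* Z :* (X :* Y)) refl R X Y Z ⟩
      R ℚ.* R ℚ.* Z ℚ.* (X ℚ.* Y)
        ≡⟨ cong₂ (λ x y → x ℚ.* y) (cong₂ ℚ._*_ R² Z≡) XY ⟨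
      (r ^ℚ suc b) ^ℚ (2 * b′) ℚ.* (N ^ℚ j) ^ℚ (2 * b′) ℚ.* N ^ℚ (suc b * b′ + suc b * j′)
        ≡⟨ cong (ℚ._* N ^ℚ (suc b * b′ + suc b * j′)) (Exp.^-distrib-* (r ^ℚ suc b) (N ^ℚ j) (2 * b′)) ⟨
      (r ^ℚ suc b ℚ.* N ^ℚ j) ^ℚ (2 * b′) ℚ.* N ^ℚ (suc b * b′ + suc b * j′) ∎
      where
      open +-*-Solver
      k = b′ * suc b
      R = r ^ℚ k
      X = N ^ℚ k
      Y = N ^ℚ (j′ * suc b)
      Z = N ^ℚ (2 * b′ * j)
      double : ∀ B b′ → B * (2 * b′) ≡ b′ * B + b′ * B
      double = solve-∀
      R² : (r ^ℚ suc b) ^ℚ (2 * b′) ≡ R ℚ.* R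
      R² = trans (Exp.^-assocʳ r (suc b) (2 * b′)) (trans (cong (r ^ℚ_) (double (suc b) b′)) (Exp.^-homo-* r k k))
      Z≡ : (N ^ℚ j) ^ℚ (2 * b′) ≡ Z
      Z≡ = trans (Exp.^-assocʳ N j (2 * b′)) (cong (N ^ℚ_) (*-comm j (2 * b′)))
      XY : N ^ℚ (suc b * b′ + suc b * j′) ≡ X ℚ.* Y
      XY = trans (cong (N ^ℚ_) (cong₂ _+_ (*-comm (suc b) b′) (*-comm (suc b) j′))) (Exp.^-homo-* N k (j′ * suc b))

  private
    exponents : ∀ B b′ i j i′ j′ → (pos i′ ℤ.- pos j′) ℤ.* pos B ≡ (pos 2 ℤ.* (pos i ℤ.- pos j) ℤ.+ pos B) ℤ.* pos b′ →
                B * i′ + (2 * b′) * j ≡ (2 * b′) * i + B * b′ + B * j′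
    exponents B b′ i j i′ j′ e = ℤ.+-injective (begin
      pos (B * i′ + 2 * b′ * j)
        ≡⟨ cong₂ ℤ._+_ (ℤ.pos-* B i′) (trans (ℤ.pos-* (2 * b′) j) (cong (ℤ._* pos j) (ℤ.pos-* 2 b′))) ⟩
      pos B ℤ.* pos i′ ℤ.+ pos 2 ℤ.* pos b′ ℤ.* pos j
        ≡⟨ lhs (pos B) (pos b′) (pos i) (pos j) (pos i′) (pos j′) ⟩
      (pos i′ ℤ.- pos j′) ℤ.* pos B ℤ.+ (pos B ℤ.* pos j′ ℤ.+ pos 2 ℤ.* pos b′ ℤ.* pos j)
        ≡⟨ cong (ℤ._+ (pos B ℤ.* pos j′ ℤ.+ pos 2 ℤ.* pos b′ ℤ.* pos j)) e ⟩
      (pos 2 ℤ.* (pos i ℤ.- pos j) ℤ.+ pos B) ℤ.* pos b′ ℤ.+ (pos B ℤ.* pos j′ ℤ.+ pos 2 ℤ.* pos b′ ℤ.* pos j)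
        ≡⟨ rhs (pos B) (pos b′) (pos i) (pos j) (pos i′) (pos j′) ⟩
      pos 2 ℤ.* pos b′ ℤ.* pos i ℤ.+ pos B ℤ.* pos b′ ℤ.+ pos B ℤ.* pos j′
        ≡⟨ cong₂ ℤ._+_ (cong₂ ℤ._+_ (trans (ℤ.pos-* (2 * b′) i) (cong (ℤ._* pos i) (ℤ.pos-* 2 b′))) (ℤ.pos-* B b′)) (ℤ.pos-* B j′) ⟨
      pos (2 * b′ * i + B * b′ + B * j′) ∎)
      where
      open ≡-Reasoning
      lhs : ∀ B b′ i j i′ j′ → B ℤ.* i′ ℤ.+ pos 2 ℤ.* b′ ℤ.* j ≡ (i′ ℤ.- j′) ℤ.* B ℤ.+ (B ℤ.* j′ ℤ.+ pos 2 ℤ.* b′ ℤ.* j)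
      lhs = ℤSolver.solve-∀
      rhs : ∀ B b′ i j i′ j′ → (pos 2 ℤ.* (i ℤ.- j) ℤ.+ B) ℤ.* b′ ℤ.+ (B ℤ.* j′ ℤ.+ pos 2 ℤ.* b′ ℤ.* j) ≡
            pos 2 ℤ.* b′ ℤ.* i ℤ.+ B ℤ.* b′ ℤ.+ B ℤ.* j′
      rhs = ℤSolver.solve-∀

    -- `ℚ` keeps 2q + 1 in lowest terms, so its numerator and denominator are known only through a
    -- cross-multiplied equation, from which one spare factor ↧ q is cancelled.
    numerators : ∀ q q′ → q′ ≡ q ℚ.+ q ℚ.+ 1ℚ → ↥ q′ ℤ.* ↧ q ≡ (pos 2 ℤ.* ↥ q ℤ.+ ↧ q) ℤ.* ↧ q′
    numerators q@(mkℚ a b _) q′@(mkℚ a′ b′ _) e = ℤ.*-cancelˡ-≡ (pos (suc b)) _ _ (begin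
      pos (suc b) ℤ.* (a′ ℤ.* pos (suc b))
        ≡⟨ left (pos (suc b)) a′ ⟩
      a′ ℤ.* (pos (suc b) ℤ.* pos (suc b) ℤ.* pos 1)
        ≡⟨ cong (a′ ℤ.*_) (trans (ℤ.pos-* (suc b * suc b) 1) (cong (ℤ._* pos 1) (ℤ.pos-* (suc b) (suc b)))) ⟨
      a′ ℤ.* pos (suc b * suc b * 1)
        ≡⟨ ℚᵘ.drop-*≡* unnormalised ⟩
      ((a ℤ.* pos (suc b) ℤ.+ a ℤ.* pos (suc b)) ℤ.* pos 1 ℤ.+ pos 1 ℤ.* pos (suc b * suc b)) ℤ.* pos (suc b′)
        ≡⟨ cong (λ x → ((a ℤ.* pos (suc b) ℤ.+ a ℤ.* pos (suc b)) ℤ.* pos 1 ℤ.+ pos 1 ℤ.* x) ℤ.* pos (suc b′)) (ℤ.pos-* (suc b) (suc b)) ⟩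
      ((a ℤ.* pos (suc b) ℤ.+ a ℤ.* pos (suc b)) ℤ.* pos 1 ℤ.+ pos 1 ℤ.* (pos (suc b) ℤ.* pos (suc b))) ℤ.* pos (suc b′)
        ≡⟨ right (pos (suc b)) a (pos (suc b′)) ⟩
      pos (suc b) ℤ.* ((pos 2 ℤ.* a ℤ.+ pos (suc b)) ℤ.* pos (suc b′)) ∎)
      where
      open ≡-Reasoning
      left : ∀ B a′ → B ℤ.* (a′ ℤ.* B) ≡ a′ ℤ.* (B ℤ.* B ℤ.* pos 1)
      left = ℤSolver.solve-∀
      right : ∀ B a b′ → ((a ℤ.* B ℤ.+ a ℤ.* B) ℤ.* pos 1 ℤ.+ pos 1 ℤ.* (B ℤ.* B)) ℤ.* b′ ≡ B ℤ.* ((pos 2 ℤ.* a ℤ.+ B) ℤ.* b′)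
      right = ℤSolver.solve-∀
      unnormalised : toℚᵘ q′ ℚᵘ.≃ toℚᵘ q ℚᵘ.+ toℚᵘ q ℚᵘ.+ toℚᵘ 1ℚ
      unnormalised = ℚᵘ.≃-trans (ℚ.toℚᵘ-cong e) (ℚᵘ.≃-trans (ℚ.toℚᵘ-homo-+ (q ℚ.+ q) 1ℚ)
        (ℚᵘ.+-cong (ℚ.toℚᵘ-homo-+ q q) (ℚᵘ.≃-refl {toℚᵘ 1ℚ})))

    positivePart negativePart : ℤ → ℕ
    positivePart (pos a)    = a
    positivePart -[1+ a ] = 0
    negativePart (pos a)    = 0
    negativePart -[1+ a ] = suc a

    parts : ∀ a → a ≡ pos (positivePart a) ℤ.- pos (negativePart a)
    parts (pos a)    = sym (ℤ.+-identityʳ (pos a))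
    parts -[1+ a ] = refl

    toPowerBound : ∀ {r} q → 0ℚ ℚ.< r → r ≤[ n ^ q ] → powerBound r (↧ₙ q) (positivePart (↥ q)) (negativePart (↥ q))
    toPowerBound q 0<r (inj₁ r≤0) = ⊥-elim (ℚ.<-irrefl refl (ℚ.<-≤-trans 0<r r≤0))
    toPowerBound (mkℚ (pos a) b _)    0<r (inj₂ h) = ℚ.≤-trans (ℚ.≤-reflexive (ℚ.*-identityʳ _)) h
    toPowerBound (mkℚ -[1+ a ] b _) 0<r (inj₂ h) = h

    fromPowerBound : ∀ {r} q → powerBound r (↧ₙ q) (positivePart (↥ q)) (negativePart (↥ q)) → r ≤[ n ^ q ]
    fromPowerBound (mkℚ (pos a) b _)    h = inj₂ (ℚ.≤-trans (ℚ.≤-reflexive (sym (ℚ.*-identityʳ _))) h)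
    fromPowerBound (mkℚ -[1+ a ] b _) h = inj₂ h

    ≤^-square′ : ∀ {r} q q′ → q′ ≡ q ℚ.+ q ℚ.+ 1ℚ → 0ℚ ℚ.< r → r ≤[ n ^ q ] → r ℚ.* r ℚ.* N ≤[ n ^ q′ ]
    ≤^-square′ {r} q@(mkℚ a b _) q′ e 0<r h = fromPowerBound q′
      (powerBound-square {r} b (↧ₙ q′) {positivePart a} {negativePart a} {positivePart (↥ q′)} {negativePart (↥ q′)} (ℚ.<⇒≤ 0<r)
        (exponents (suc b) (↧ₙ q′) (positivePart a) (negativePart a) (positivePart (↥ q′)) (negativePart (↥ q′))
          (subst₂ (λ x y → x ℤ.* pos (suc b) ≡ (pos 2 ℤ.* y ℤ.+ pos (suc b)) ℤ.* ↧ q′) (parts (↥ q′)) (parts a) (numerators q q′ e)))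
        (toPowerBound q 0<r h))

  ≤^-square : ∀ {r} q → 0ℚ ℚ.< r → r ≤[ n ^ q ] → r ℚ.* r ℚ.* N ≤[ n ^ q ℚ.+ q ℚ.+ 1ℚ ]
  ≤^-square q = ≤^-square′ q (q ℚ.+ q ℚ.+ 1ℚ) refl

-- Cuts are open, which leaves room: with p < p₁ < q and q still in the cut of y, the outer
-- difference is witnessed by some r slightly below 1 and by p₁ - 1. The ratio ρ = 1 - y enters the
-- claim as 1 - ρ, which is how this double difference arises.
1-[1-_] : ∀ y p → cut y p → cut (fromℚ 1ℚ -ʳ (fromℚ 1ℚ -ʳ y)) p
1-[1- y ] p yp =
  let (q , p<q , yq) = rounded y yp
      (p₁ , p<p₁ , p₁<q) = ℚ.<-dense p<q
      (r , <r , r<1) = ℚ.<-dense (below-1 p<p₁)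
  in r , p₁ ℚ.- 1ℚ , r<1
     -- The outer negation is witnessed by q - 1: its opposite 1 - q is not in the cut of 1 - y,
     -- because q lies in that of y.
     , (q ℚ.- 1ℚ , ℚ.+-monoˡ-< (ℚ.- 1ℚ) p₁<q
       , λ (r′ , s′ , r′<1 , (t′ , s′<t′ , ¬y) , lt) →
           ℚ.<-irrefl refl (begin-strict
             ℚ.- (q ℚ.- 1ℚ)      <⟨ lt ⟩
             r′ ℚ.+ s′           <⟨ ℚ.+-mono-< r′<1 s′<t′ ⟩
             1ℚ ℚ.+ t′           ≡⟨ cong (1ℚ ℚ.+_) (neg-involutive t′) ⟨
             1ℚ ℚ.- (ℚ.- t′)     <⟨ ℚ.+-monoʳ-< 1ℚ (ℚ.neg-antimono-< (cut⇒< y yq ¬y)) ⟩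
             1ℚ ℚ.- q            ≡⟨ solve 2 (λ o q → o :- q := :- (q :- o)) refl 1ℚ q ⟩
             ℚ.- (q ℚ.- 1ℚ)      ∎))
     , (begin-strict
         p                                       ≡⟨ solve 3 (λ o p p₁ → p := (p :+ o :- p₁) :+ (p₁ :- o)) refl 1ℚ p p₁ ⟩
         (p ℚ.+ 1ℚ ℚ.- p₁) ℚ.+ (p₁ ℚ.- 1ℚ)       <⟨ ℚ.+-monoˡ-< (p₁ ℚ.- 1ℚ) <r ⟩
         r ℚ.+ (p₁ ℚ.- 1ℚ)                       ∎)
  where
  open ℚ.≤-Reasoning
  open +-*-Solver
  below-1 : ∀ {p₁} → p ℚ.< p₁ → p ℚ.+ 1ℚ ℚ.- p₁ ℚ.< 1ℚ
  below-1 {p₁} p<p₁ = begin-strict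
    p ℚ.+ 1ℚ ℚ.- p₁       <⟨ ℚ.+-monoˡ-< (ℚ.- p₁) (ℚ.+-monoˡ-< 1ℚ p<p₁) ⟩
    p₁ ℚ.+ 1ℚ ℚ.- p₁      ≡⟨ solve 2 (λ o x → x :+ o :- x := o) refl 1ℚ p₁ ⟩
    1ℚ                    ∎

*-approximate : ∀ {a p d} → 0ℚ ℚ.< a → p ℚ.< a ℚ.* d → ∃ λ d′ → d′ ℚ.< d × p ℚ.< a ℚ.* d′
*-approximate {a} {p} {d} 0<a p<ad =
  let (d′ , <d′ , d′<d) = ℚ.<-dense quotient<d
  in d′ , d′<d , ℚ.≤-<-trans (ℚ.≤-reflexive (sym a*quotient)) (ℚ.*-monoʳ-<-pos a <d′)
  where
  open ℚ.≤-Reasoning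
  instance
    a-pos : Positive a
    a-pos = ℚ.positive 0<a
    a≢0 : ℚ.NonZero a
    a≢0 = ℚ.pos⇒nonZero a
  quotient = (ℚ.1/ a) ℚ.* p
  a*quotient : a ℚ.* quotient ≡ p
  a*quotient = trans (sym (ℚ.*-assoc a (ℚ.1/ a) p)) (trans (cong (ℚ._* p) (ℚ.*-inverseʳ a)) (ℚ.*-identityˡ p))
  quotient<d : quotient ℚ.< d
  quotient<d = ℚ.*-cancelˡ-<-nonNeg a {{ℚ.pos⇒nonNeg a}} (ℚ.≤-<-trans (ℚ.≤-reflexive a*quotient) p<ad)

positiveFactor : ∀ {a x} → 0ℚ ℚ.≤ a → 0ℚ ℚ.< a ℚ.* x → 0ℚ ℚ.< x
positiveFactor {a} {x} 0≤a 0<ax = ℚ.≰⇒> λ x≤0 → ℚ.<-irrefl refl (ℚ.<-≤-trans 0<ax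
  (ℚ.≤-trans (ℚ.*-monoˡ-≤-nonNeg a {{ℚ.nonNegative 0≤a}} x≤0) (ℚ.≤-reflexive (ℚ.*-zeroʳ a))))


-- Squaring is continuous from below: lower one factor at a time by `*-approximate`, then put the
-- larger of the two values in both places. The sparseness bound speaks only of rationals below d,
-- so the estimate has to move from d to such a d′.
square-approximate : ∀ {c p d} → 0ℚ ℚ.< c → 0ℚ ℚ.≤ d → 0ℚ ℚ.≤ p → p ℚ.< c ℚ.* d ℚ.* d →
                     ∃ λ d′ → 0ℚ ℚ.≤ d′ × d′ ℚ.< d × p ℚ.< c ℚ.* d′ ℚ.* d′
square-approximate {c} {p} {d} 0<c 0≤d 0≤p p< =
  let 0≤cd = *-≥0 {c} {d} (ℚ.<⇒≤ 0<c) 0≤d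
      0<d = positiveFactor {c ℚ.* d} {d} 0≤cd (ℚ.≤-<-trans 0≤p p<)
      (d₁ , d₁<d , p<₁) = *-approximate {c ℚ.* d} {p} {d} (*->0 {c} {d} 0<c 0<d) p<
      0<d₁ = positiveFactor {c ℚ.* d} {d₁} 0≤cd (ℚ.≤-<-trans 0≤p p<₁)
      0<cd₁ = *->0 {c} {d₁} 0<c 0<d₁
      (d₂ , d₂<d , p<₂) = *-approximate {c ℚ.* d₁} {p} {d} 0<cd₁ (ℚ.<-≤-trans p<₁ (ℚ.≤-reflexive (*-swapʳ c d d₁)))
      0<d₂ = positiveFactor {c ℚ.* d₁} {d₂} (ℚ.<⇒≤ 0<cd₁) (ℚ.≤-<-trans 0≤p p<₂)
  in larger {d₁} {d₂} d₁<d 0<d₁ d₂<d 0<d₂ p<₂ (ℚ.≤-total d₁ d₂)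
  where
  open +-*-Solver
  *-swapʳ : ∀ x y z → x ℚ.* y ℚ.* z ≡ x ℚ.* z ℚ.* y
  *-swapʳ = solve 3 (λ x y z → x :* y :* z := x :* z :* y) refl
  larger : ∀ {d₁ d₂} → d₁ ℚ.< d → 0ℚ ℚ.< d₁ → d₂ ℚ.< d → 0ℚ ℚ.< d₂ → p ℚ.< c ℚ.* d₁ ℚ.* d₂ → d₁ ℚ.≤ d₂ ⊎ d₂ ℚ.≤ d₁ →
           ∃ λ d′ → 0ℚ ℚ.≤ d′ × d′ ℚ.< d × p ℚ.< c ℚ.* d′ ℚ.* d′
  larger {d₁} {d₂} _ _ d₂<d 0<d₂ lt (inj₁ d₁≤d₂) = d₂ , ℚ.<⇒≤ 0<d₂ , d₂<d , (ℚ.<-≤-trans lt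
    (ℚ.*-monoʳ-≤-nonNeg d₂ {{ℚ.nonNegative (ℚ.<⇒≤ 0<d₂)}} (ℚ.*-monoˡ-≤-nonNeg c {{ℚ.nonNegative (ℚ.<⇒≤ 0<c)}} d₁≤d₂)))
  larger {d₁} {d₂} d₁<d 0<d₁ _ _ lt (inj₂ d₂≤d₁) = d₁ , ℚ.<⇒≤ 0<d₁ , d₁<d , (ℚ.<-≤-trans lt
    (ℚ.*-monoˡ-≤-nonNeg (c ℚ.* d₁) {{ℚ.nonNegative (*-≥0 {c} {d₁} (ℚ.<⇒≤ 0<c) (ℚ.<⇒≤ 0<d₁))}} d₂≤d₁))

module _ (n : ℕ) .{{_ : NonZero n}} (ε : ℝ) (c d : ℚ) (c≡ : c ≡ fromℕ 6 ℚ.* (fromℕ 4 ℚ.* fromℕ 4) ℚ.* fromℕ n) (0<c : 0ℚ ℚ.< c)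
         (sparse : fromℚ d ≤ʳ (pos 1 ℚ./ 4) ·ʳ n ^ʳ (fromℚ (ℚ.- ½) -ʳ ε)) where

  private
    N = fromℕ n
    0≤N : 0ℚ ℚ.≤ N
    0≤N = fromℕ-≥0 n
    0<N : 0ℚ ℚ.< N
    0<N = ℚ.<-≤-trans 0<1 (1≤fromℕ n)

    bound : ℝ
    bound = fromℕ 6 ·ʳ n ^ʳ (-ʳ (fromℕ 2 ·ʳ ε))

    negative : ∀ {p} → p ℚ.< 0ℚ → cut bound p
    negative {p} p<0 =
      let (p′ , p<p′ , p′<0) = ℚ.<-dense p<0
          (q , xq) = inhabited (-ʳ (fromℕ 2 ·ʳ ε))
      in (pos 1 ℚ./ 6) ℚ.* p′
         , (0ℚ , q , ℚ.<-≤-trans (ℚ.*-monoʳ-<-pos (pos 1 ℚ./ 6) p′<0) (ℚ.≤-reflexive (ℚ.*-zeroʳ (pos 1 ℚ./ 6))) , xq , inj₁ ℚ.≤-refl)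
         , ℚ.<-≤-trans p<p′ (ℚ.≤-reflexive (sym (trans (sym (ℚ.*-assoc (fromℕ 6) (pos 1 ℚ./ 6) p′)) (ℚ.*-identityˡ p′))))

    -- Doubling q < -1/2 + t, where -t is not in the cut of ε, gives 2q + 1 < 2t, and -2t is not in
    -- the cut of 2ε.
    exponent : ∀ q → cut (fromℚ (ℚ.- ½) -ʳ ε) q → cut (-ʳ (fromℕ 2 ·ʳ ε)) (q ℚ.+ q ℚ.+ 1ℚ)
    exponent q (a , b , a<-½ , (t , b<t , ¬ε) , q<a+b) = t ℚ.+ t
      , (begin-strict
          q ℚ.+ q ℚ.+ 1ℚ                               <⟨ ℚ.+-monoˡ-< 1ℚ (ℚ.+-mono-< q< q<) ⟩
          (ℚ.- ½ ℚ.+ t) ℚ.+ (ℚ.- ½ ℚ.+ t) ℚ.+ 1ℚ       ≡⟨ solve 3 (λ h o t → (h :+ t) :+ (h :+ t) :+ o := (h :+ h :+ o) :+ (t :+ t)) refl (ℚ.- ½) 1ℚ t ⟩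
          0ℚ ℚ.+ (t ℚ.+ t)                             ≡⟨ ℚ.+-identityˡ (t ℚ.+ t) ⟩
          t ℚ.+ t                                      ∎)
      , λ (r , εr , lt) → ¬ε (closed ε (ℚ.*-cancelˡ-<-nonNeg (fromℕ 2) (ℚ.≤-<-trans (ℚ.≤-reflexive (double t)) lt)) εr)
      where
      open ℚ.≤-Reasoning
      open +-*-Solver
      q< : q ℚ.< ℚ.- ½ ℚ.+ t
      q< = ℚ.<-trans q<a+b (ℚ.+-mono-< a<-½ b<t)
      double : ∀ t → fromℕ 2 ℚ.* (ℚ.- t) ≡ ℚ.- (t ℚ.+ t)
      double t = trans (cong (ℚ._* (ℚ.- t)) (fromℕ-+ 1 1)) (trans (solve 2 (λ o t → (o :+ o) :* (:- t) := :- (o :* t :+ o :* t)) refl 1ℚ t)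
        (cong (λ x → ℚ.- (x ℚ.+ x)) (ℚ.*-identityˡ t)))

    quadruple : ∀ {d′ r} → d′ ℚ.< (pos 1 ℚ./ 4) ℚ.* r → fromℕ 4 ℚ.* d′ ℚ.< r
    quadruple {d′} {r} lt = ℚ.<-≤-trans (ℚ.*-monoʳ-<-pos (fromℕ 4) lt)
      (ℚ.≤-reflexive (trans (sym (ℚ.*-assoc (fromℕ 4) (pos 1 ℚ./ 4) r)) (ℚ.*-identityˡ r)))

    -- Sparseness supplies d′ < r/4 and r < r′ ≤ n^q with q below -1/2 - ε. Hence c d′² = 6 (4d′)² n
    -- ≤ 6 r² n, and r² n < r′² n ≤ n^(2q + 1), where 2q + 1 lies below -2ε.
    square : ∀ {d′ p} → 0ℚ ℚ.≤ d′ → d′ ℚ.< d → p ℚ.< c ℚ.* d′ ℚ.* d′ → cut bound p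
    square {d′} {p} 0≤d′ d′<d p< with sparse d′ d′<d
    ... | r , (r′ , q , r<r′ , xq , r′≤) , d′<r/4 =
      r ℚ.* r ℚ.* N
      , (r′ ℚ.* r′ ℚ.* N , q ℚ.+ q ℚ.+ 1ℚ , ℚ.*-monoˡ-<-pos N {{ℚ.positive 0<N}} rr<r′r′ , exponent q xq , ≤^-square n q 0<r′ r′≤)
      , (begin-strict
          p                                             <⟨ p< ⟩
          c ℚ.* d′ ℚ.* d′                               ≡⟨ cong (λ x → x ℚ.* d′ ℚ.* d′) c≡ ⟩
          fromℕ 6 ℚ.* (fromℕ 4 ℚ.* fromℕ 4) ℚ.* N ℚ.* d′ ℚ.* d′
            ≡⟨ solve 4 (λ s f N d → s :* (f :* f) :* N :* d :* d := s :* ((f :* d) :* (f :* d) :* N)) refl (fromℕ 6) (fromℕ 4) N d′ ⟩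
          fromℕ 6 ℚ.* (e ℚ.* e ℚ.* N)                   ≤⟨ ℚ.*-monoˡ-≤-nonNeg (fromℕ 6) (ℚ.*-monoʳ-≤-nonNeg N {{ℚ.nonNegative 0≤N}} (*-mono-≤-nonNeg 0≤e (ℚ.<⇒≤ e<r) 0≤e (ℚ.<⇒≤ e<r))) ⟩
          fromℕ 6 ℚ.* (r ℚ.* r ℚ.* N)                   ∎)
      where
      open ℚ.≤-Reasoning
      open +-*-Solver
      e = fromℕ 4 ℚ.* d′
      0≤e : 0ℚ ℚ.≤ e
      0≤e = *-≥0 (fromℕ-≥0 4) 0≤d′
      e<r : e ℚ.< r
      e<r = quadruple d′<r/4
      0<r : 0ℚ ℚ.< r
      0<r = ℚ.≤-<-trans 0≤e e<r
      0<r′ : 0ℚ ℚ.< r′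
      0<r′ = ℚ.<-trans 0<r r<r′
      rr<r′r′ : r ℚ.* r ℚ.< r′ ℚ.* r′
      rr<r′r′ = ℚ.<-trans (ℚ.*-monoʳ-<-pos r {{ℚ.positive 0<r}} r<r′) (ℚ.*-monoˡ-<-pos r′ {{ℚ.positive 0<r′}} r<r′)

  sparse⇒≤ : 0ℚ ℚ.≤ d → ∀ {P} → P ℚ.≤ c ℚ.* d ℚ.* d →
             fromℚ P ≤ʳ fromℚ 1ℚ -ʳ (fromℚ 1ℚ -ʳ fromℕ 6 ·ʳ n ^ʳ (-ʳ (fromℕ 2 ·ʳ ε)))
  sparse⇒≤ 0≤d P≤ p p<P = 1-[1- bound ] p (cases (p ℚ.<? 0ℚ))
    where
    cases : Dec (p ℚ.< 0ℚ) → cut bound p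
    cases (yes p<0) = negative p<0
    cases (no p≮0)  =
      let (d′ , 0≤d′ , d′<d , lt) = square-approximate {c} {p} {d} 0<c 0≤d (ℚ.≮⇒≥ p≮0) (ℚ.<-≤-trans p<P P≤)
      in square {d′} {p} 0≤d′ d′<d lt

-- Domination ratio

module _ (n p D L K b Q : ℕ) (1≤n : 1 ≤ n) (p+1≡n : suc p ≡ n) (nL≤3D : n * L ≤ 3 * D) (b≤Q : b ≤ Q) where

  -- As ratios: b / Q ≤ 4L² / p and L ≤ 3D / n. With density d = D / (n p) this makes b / Q at most
  -- 36 d² p, which is then relaxed to 96 d² n.
  few-heavy : p * b ≤ (L + K) * K * (Q * 2) → K ≤ L → b * (n * p * (n * p)) ≤ 96 * n * (D * D) * Q
  few-heavy pb≤ K≤L = begin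
    b * (n * p * (n * p))                  ≡⟨ eq₁ b n p ⟩
    n * n * p * (p * b)                    ≤⟨ *-monoʳ-≤ (n * n * p) (≤-trans pb≤ (*-monoˡ-≤ (Q * 2) (*-mono-≤ (+-monoʳ-≤ L K≤L) K≤L))) ⟩
    n * n * p * ((L + L) * L * (Q * 2))    ≡⟨ eq₂ n p L Q ⟩
    4 * p * Q * (n * L * (n * L))          ≤⟨ *-monoʳ-≤ (4 * p * Q) (*-mono-≤ nL≤3D nL≤3D) ⟩
    4 * p * Q * (3 * D * (3 * D))          ≡⟨ eq₃ p Q D ⟩
    36 * p * (D * D) * Q                   ≤⟨ *-monoˡ-≤ Q (*-monoˡ-≤ (D * D) (*-mono-≤ {36} {96} (m≤m+n 36 60) (≤-trans (n≤1+n p) (≤-reflexive p+1≡n)))) ⟩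
    96 * n * (D * D) * Q                   ∎
    where
    open ≤-Reasoning
    eq₁ : ∀ b n p → b * (n * p * (n * p)) ≡ n * n * p * (p * b)
    eq₁ = solve-∀
    eq₂ : ∀ n p L Q → n * n * p * ((L + L) * L * (Q * 2)) ≡ 4 * p * Q * (n * L * (n * L))
    eq₂ = solve-∀
    eq₃ : ∀ p Q D → 4 * p * Q * (3 * D * (3 * D)) ≡ 36 * p * (D * D) * Q
    eq₃ = solve-∀

  -- Here L is so large that 3L ≥ 2p, whence 2np ≤ 9D. Squaring produces the constant 81, below 96n,
  -- and b ≤ Q does the rest.
  many-heavy : 2 * n < 3 * (L + 1) → b * (n * p * (n * p)) ≤ 96 * n * (D * D) * Q
  many-heavy 2n< = begin
    b * (n * p * (n * p))                  ≤⟨ m≤n*m _ 4 ⟩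
    4 * (b * (n * p * (n * p)))            ≡⟨ eq₁ b n p ⟩
    b * (n * (2 * p) * (n * (2 * p)))      ≤⟨ *-mono-≤ b≤Q (*-mono-≤ np≤ np≤) ⟩
    Q * (3 * (3 * D) * (3 * (3 * D)))      ≡⟨ eq₂ Q D ⟩
    81 * 1 * (D * D) * Q                   ≤⟨ *-monoˡ-≤ Q (*-monoˡ-≤ (D * D) (*-mono-≤ {81} {96} (m≤m+n 81 15) 1≤n)) ⟩
    96 * n * (D * D) * Q                   ∎
    where
    open ≤-Reasoning
    eq₁ : ∀ b n p → 4 * (b * (n * p * (n * p))) ≡ b * (n * (2 * p) * (n * (2 * p)))
    eq₁ = solve-∀
    eq₂ : ∀ Q D → Q * (3 * (3 * D) * (3 * (3 * D))) ≡ 81 * 1 * (D * D) * Q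
    eq₂ = solve-∀
    eq₃ : ∀ p → 3 + 2 * p ≡ suc (2 * suc p)
    eq₃ = solve-∀
    eq₄ : ∀ L → 3 * (L + 1) ≡ 3 + 3 * L
    eq₄ = solve-∀
    eq₅ : ∀ n L → n * (3 * L) ≡ 3 * (n * L)
    eq₅ = solve-∀
    2p≤3L : 2 * p ≤ 3 * L
    2p≤3L = +-cancelˡ-≤ 3 _ _ (≤-trans (≤-reflexive (trans (eq₃ p) (cong (λ x → suc (2 * x)) p+1≡n))) (≤-trans 2n< (≤-reflexive (eq₄ L))))
    np≤ : n * (2 * p) ≤ 3 * (3 * D)
    np≤ = ≤-trans (*-monoʳ-≤ n 2p≤3L) (≤-trans (≤-reflexive (eq₅ n L)) (*-monoʳ-≤ 3 nL≤3D))

-- In the application X is n (n - 1) and D the degree sum, so d = D / X; multiplication by X² turns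
-- the claim into one about naturals.
rational-bound : ∀ k n D b Q X d → 1 ≤ X → fromℕ D ≡ d ℚ.* fromℕ X → b * (X * X) ≤ k * n * (D * D) * Q →
                 fromℕ b ℚ.≤ fromℕ k ℚ.* fromℕ n ℚ.* d ℚ.* d ℚ.* fromℕ Q
rational-bound k n D b Q X d 1≤X D≡ h = ℚ.*-cancelʳ-≤-pos (x ℚ.* x) {{ℚ.positive (*->0 0<x 0<x)}} (begin
  fromℕ b ℚ.* (x ℚ.* x)                                          ≡⟨ trans (cong (fromℕ b ℚ.*_) (sym (fromℕ-* X X))) (sym (fromℕ-* b (X * X))) ⟩
  fromℕ (b * (X * X))                                            ≤⟨ fromℕ-mono h ⟩
  fromℕ (k * n * (D * D) * Q)                                    ≡⟨ trans (fromℕ-* (k * n * (D * D)) Q) (cong (ℚ._* fromℕ Q) (trans (fromℕ-* (k * n) (D * D)) (cong₂ ℚ._*_ (fromℕ-* k n) (fromℕ-* D D)))) ⟩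
  fromℕ k ℚ.* fromℕ n ℚ.* (fromℕ D ℚ.* fromℕ D) ℚ.* fromℕ Q      ≡⟨ cong (λ y → fromℕ k ℚ.* fromℕ n ℚ.* (y ℚ.* y) ℚ.* fromℕ Q) D≡ ⟩
  fromℕ k ℚ.* fromℕ n ℚ.* (d ℚ.* x ℚ.* (d ℚ.* x)) ℚ.* fromℕ Q    ≡⟨ solve 5 (λ k n d x Q → k :* n :* (d :* x :* (d :* x)) :* Q := k :* n :* d :* d :* Q :* (x :* x)) refl (fromℕ k) (fromℕ n) d x (fromℕ Q) ⟩
  fromℕ k ℚ.* fromℕ n ℚ.* d ℚ.* d ℚ.* fromℕ Q ℚ.* (x ℚ.* x)      ∎)
  where
  open ℚ.≤-Reasoning
  open +-*-Solver
  x = fromℕ X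
  0<x : 0ℚ ℚ.< x
  0<x = ℚ.<-≤-trans 0<1 (fromℕ-mono 1≤X)

density-nonNeg : ∀ d m X → 1 ≤ X → fromℕ m ≡ d ℚ.* fromℕ X → 0ℚ ℚ.≤ d
density-nonNeg d m X 1≤X m≡ = ℚ.≮⇒≥ λ d<0 → ℚ.<-irrefl refl (begin-strict
  0ℚ               ≤⟨ fromℕ-≥0 m ⟩
  fromℕ m          ≡⟨ m≡ ⟩
  d ℚ.* fromℕ X    <⟨ ℚ.*-monoˡ-<-pos (fromℕ X) {{ℚ.positive (ℚ.<-≤-trans 0<1 (fromℕ-mono 1≤X))}} d<0 ⟩
  0ℚ ℚ.* fromℕ X   ≡⟨ ℚ.*-zeroˡ (fromℕ X) ⟩
  0ℚ               ∎)
  where open ℚ.≤-Reasoning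

module _ (I : ZeroOneInstance) (S : Weighted.Solution I) where

  open Weighted I using (degree)
  open Analysis I S

  private
    1≤n : 1 ≤ n
    1≤n = ≤-trans (s≤s z≤n) (size≥3 I)
    p = pred n
    p+1≡n : suc p ≡ n
    p+1≡n = suc-pred n {{>-nonZero 1≤n}}
    D = ∑ degree
    Q = length (hamiltonCycles n)
    1≤np : 1 ≤ n * p
    1≤np = *-mono-≤ 1≤n (s≤s⁻¹ (≤-trans (≤-trans (s≤s (s≤s z≤n)) (size≥3 I)) (≤-reflexive (sym p+1≡n))))
    beats≤ : beats ≤ Q
    beats≤ = List.length-filter (λ H → weight I H <? weight I H°) (hamiltonCycles n)

  beats-bound : beats * (n * p * (n * p)) ≤ 96 * n * (D * D) * Q
  beats-bound with 3 * (#heavy + 1) ≤? 2 * n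
  ... | yes few = few-heavy n p D #heavy #hard beats Q 1≤n p+1≡n heavy-bound beats≤ count-bound (hard≤heavy few)
  ... | no many = many-heavy n p D #heavy #hard beats Q 1≤n p+1≡n heavy-bound beats≤ (≰⇒> many)

  dominates : ∀ ε d → Sparse I d ε →
    fromℚ (ℙ (λ H → weight I H <? weight I H°) (hamiltonCycles n)) ≤ʳ
    fromℚ 1ℚ -ʳ (fromℚ 1ℚ -ʳ fromℕ 6 ·ʳ size^ I (-ʳ (fromℕ 2 ·ʳ ε)))
  dominates ε d sparse = sparse⇒≤ n {{>-nonZero 1≤n}} ε (fromℕ 96 ℚ.* fromℕ n) d c≡ 0<c (Sparse.bound sparse) 0≤d
    (ℙ-≤ (λ H → weight I H <? weight I H°) (hamiltonCycles n) _ (*-≥0 (*-≥0 (ℚ.<⇒≤ 0<c) 0≤d) 0≤d)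
      (rational-bound 96 n D beats Q (n * p) d 1≤np D≡ beats-bound))
    where
    m = weight I (edges n)
    N₂ = n C 2
    -- The 6 is the constant of the claimed ratio, and 4 · 4 the square of the 4 in the sparseness
    -- bound.
    c≡ : fromℕ 96 ℚ.* fromℕ n ≡ fromℕ 6 ℚ.* (fromℕ 4 ℚ.* fromℕ 4) ℚ.* fromℕ n
    c≡ = cong (ℚ._* fromℕ n) (trans (fromℕ-* 6 16) (cong (fromℕ 6 ℚ.*_) (fromℕ-* 4 4)))
    0<c : 0ℚ ℚ.< fromℕ 96 ℚ.* fromℕ n
    0<c = *->0 (ℚ.<-≤-trans 0<1 (fromℕ-mono {1} {96} (s≤s z≤n))) (ℚ.<-≤-trans 0<1 (fromℕ-mono 1≤n))
    D≡ : fromℕ D ≡ d ℚ.* fromℕ (n * p)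
    D≡ = begin
      fromℕ D                                ≡⟨ cong fromℕ (∑-degree I) ⟩
      fromℕ (m + m)                          ≡⟨ fromℕ-+ m m ⟩
      fromℕ m ℚ.+ fromℕ m                    ≡⟨ cong (λ x → x ℚ.+ x) (Sparse.density sparse) ⟩
      d ℚ.* fromℕ N₂ ℚ.+ d ℚ.* fromℕ N₂      ≡⟨ ℚ.*-distribˡ-+ d (fromℕ N₂) (fromℕ N₂) ⟨
      d ℚ.* (fromℕ N₂ ℚ.+ fromℕ N₂)          ≡⟨ cong (d ℚ.*_) (fromℕ-+ N₂ N₂) ⟨
      d ℚ.* fromℕ (N₂ + N₂)                  ≡⟨ cong (λ x → d ℚ.* fromℕ x) (trans (cong (λ x → N₂ + x) (sym (+-identityʳ N₂))) (2*nC2 n)) ⟩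
      d ℚ.* fromℕ (n * p)                    ∎
      where open ≡-Reasoning
    0≤d : 0ℚ ℚ.≤ d
    0≤d = density-nonNeg d D (n * p) 1≤np D≡

theorem5p13 : (ε : ℝ) → fromℚ 0ℚ <ʳ ε → ε <ʳ fromℚ ½ →
    ∃ λ (A : DominationAlgorithm) →
    RunsInTimeO A (λ n → n ^ 4) ×
    (∀ (I : ZeroOneInstance) (d : ℚ) → 225 ≤ size I → Sparse I d ε →
    DominationRatioAtLeast A I
    (fromℚ 1ℚ -ʳ fromℕ 6 ·ʳ size^ I (-ʳ (fromℕ 2 ·ʳ ε))))
theorem5p13 ε _ _ =
  record { program = localSearch ; wordExponent = 4 ; execute = λ I → Weighted.Solution.execution (Weighted.solution I) }
  , (2000 , λ I → ≤-trans (Weighted.Solution.fast (Weighted.solution I)) (localSearchTime-≤ (size I) (≤-trans (s≤s z≤n) (size≥3 I))))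
  , λ I d _ sparse → dominates I (Weighted.solution I) ε d sparse
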